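{- Let $p$ range over primes $p>3$ (for each function below, over those $p$ for which it is defined, i.e. $p$ does not divide the denominator of $n$). (i) For $n\in\{5,-4,\tfrac15,\tfrac45,\tfrac54,-\tfrac14\}$, the functions $p\mapsto F_p(0,1,n)\bmod 16$ are pairwise equivalent. (ii) The function $p\mapsto F_p(0,1,5)\bmod 16$ is equivalent to $p\mapsto\prod_{0<i<j<p/2,\ p\nmid f(i,j)}\big(\frac{f(i,j)}{p}\big)$ for each of the forms $f(i,j)=i^2+ij-j^2,\ i^2+3ij+j^2,\ i^2-3ij+j^2,\ 4i^2+j^2,\ i^2+4j^2,\ 5i^2-j^2,\ i^2-5j^2$. (iii) The function $p\mapsto F_p(0,1,5)\bmod 16$ is also equivalent to $p\mapsto\prod_{i,j=1,\ p\nmid i^2-ij-j^2}^{(p-1)/2}\big(\frac{i^2-ij-j^2}{p}\big)$. (iv) $p\mapsto F_p(0,1,5)\bmod 16$ and all the products in (ii) and (iii) are periodic functions of $p$.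
   Context: $\big(\frac{\cdot}{p}\big)$ is the Legendre symbol; products are over integers $i,j$. For a rational $n$ whose denominator is prime to $p$, $F_p(0,1,n)=\sum_{y=1}^{p}\big(\frac{y(y+1)(y+w)}{p}\big)$ where $w$ is an integer with $w\equiv n\pmod p$; "$\bmod 16$" denotes the least nonnegative residue modulo $16$. A function $g$ on a set of primes is periodic if there is $m\in\mathbb Z_{>0}$ with $g(p_1)=g(p_2)$ whenever $p_1\equiv p_2\pmod m$ lie in its domain. Two functions $g,h$ on sets of primes are equivalent if there is $m\in\mathbb Z_{>0}$ such that for each $r$ with $1\le r<m$, $\gcd(r,m)=1$, there is a degree-one polynomial $f_r$ with rational coefficients such that $g(p)=f_r(h(p))$ for all primes $p$ in the common domain with $p\equiv r\pmod m$. -}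

module Defs where

open import Data.Bool using (Bool; true; false; if_then_else_)
open import Data.Nat as ℕ using (ℕ; zero; suc; _≡ᵇ_; _<ᵇ_)
open import Data.Nat.Primality using (Prime)
open import Data.Nat.Divisibility using (_∣_)
open import Data.Nat.GCD using (gcd)
open import Data.Integer as ℤ using (ℤ; +_; _%ℕ_)
open import Data.Rational as ℚ using (ℚ; ↥_; ↧ₙ_; 0ℚ)
open import Data.List using (List; []; _∷_; map; upTo; foldr; concatMap)
open import Data.Bool.ListAction using (any)
import Data.Integer.Divisibility as ℤD
open import Data.Product using (Σ; _×_; ∃; ∃-syntax; _,_)
open import Relation.Binary.PropositionalEquality using (_≡_; _≢_)
open import Relation.Nullary using (¬_)

-- Basic arithmetic modulo p (p is always a prime in use; p = 0 is a junk case)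

modp : ℤ → ℕ → ℕ
modp a zero    = 0
modp a (suc k) = a %ℕ suc k

divb : ℕ → ℤ → Bool
divb p a = modp a p ≡ᵇ 0

range1 : ℕ → List ℕ
range1 k = map suc (upTo k)

sumℤ : List ℤ → ℤ
sumℤ = foldr ℤ._+_ (+ 0)

prodℤ : List ℤ → ℤ
prodℤ = foldr ℤ._*_ (+ 1)

isSquareMod : ℕ → ℤ → Bool
isSquareMod p a = any (λ x → divb p ((+ x) ℤ.* (+ x) ℤ.- a)) (upTo p)

legendre : ℤ → ℕ → ℤ
legendre a p =
  if divb p a then + 0
  else (if isSquareMod p a then + 1 else ℤ.-[1+ 0 ])

-- For a rational n (denominator prime to p), an integer w ≡ n (mod p):
-- the least w ∈ [0,p) with w * den(n) ≡ num(n) (mod p).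

findFirst : (ℕ → Bool) → List ℕ → ℕ
findFirst P []       = 0
findFirst P (x ∷ xs) = if P x then x else findFirst P xs

residue : ℚ → ℕ → ℤ
residue n p =
  + findFirst (λ w → divb p ((+ w) ℤ.* (+ (↧ₙ n)) ℤ.- (↥ n))) (upTo p)

Fp01 : ℕ → ℚ → ℤ
Fp01 p n = sumℤ (map (λ y → legendre ((+ y) ℤ.* (+ y ℤ.+ + 1) ℤ.* (+ y ℤ.+ residue n p)) p)
                     (range1 p))

mod16 : ℤ → ℕ
mod16 a = a %ℕ 16

-- Functions on sets of primes: a domain (a predicate on ℕ, always
-- contained in the primes) and rational values on it.

record PrimeFun : Set₁ where
  field
    dom : ℕ → Set
    val : ℕ → ℚ
open PrimeFun public

BigPrime : ℕ → Set
BigPrime p = Prime p × 3 ℕ.< p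

CongMod : ℕ → ℕ → ℕ → Set
CongMod a b m = (+ m) ℤD.∣ ((+ a) ℤ.- (+ b))

Periodic : PrimeFun → Set
Periodic g = Σ ℕ λ m → 0 ℕ.< m ×
  (∀ p₁ p₂ → dom g p₁ → dom g p₂ → CongMod p₁ p₂ m → val g p₁ ≡ val g p₂)

-- degree-one polynomial a x + b over ℚ : a ≠ 0
Equivalent : PrimeFun → PrimeFun → Set
Equivalent g h = Σ ℕ λ m → 0 ℕ.< m ×
  (∀ r → r ℕ.< m → gcd r m ≡ 1 →
    Σ ℚ λ a → Σ ℚ λ b → a ≢ 0ℚ ×
      (∀ p → dom g p → dom h p → CongMod p r m → val g p ≡ a ℚ.* val h p ℚ.+ b))

ℕtoℚ : ℕ → ℚ
ℕtoℚ k = (+ k) ℚ./ 1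

ℤtoℚ : ℤ → ℚ
ℤtoℚ k = k ℚ./ 1

Ffun : ℚ → PrimeFun
Ffun n = record
  { dom = λ p → BigPrime p × ¬ (p ∣ ↧ₙ n)
  ; val = λ p → ℕtoℚ (mod16 (Fp01 p n)) }

legProd : (ℤ → ℤ → ℤ) → ℕ → List (ℕ × ℕ) → ℤ
legProd f p ps = prodℤ (map term ps)
  where
  term : ℕ × ℕ → ℤ
  term (i , j) = if divb p (f (+ i) (+ j)) then + 1 else legendre (f (+ i) (+ j)) p

-- half p = (p - 1) / 2 ; for odd p, the integers j with 0 < j < p/2 are 1..half p
half : ℕ → ℕ
half p = (p ℕ.∸ 1) ℕ./ 2

pairsLt : ℕ → List (ℕ × ℕ)
pairsLt p = concatMap (λ j → map (λ i → (i , j)) (range1 (j ℕ.∸ 1))) (range1 (half p))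

pairsAll : ℕ → List (ℕ × ℕ)
pairsAll p = concatMap (λ i → map (λ j → (i , j)) (range1 (half p))) (range1 (half p))

prodII : (ℤ → ℤ → ℤ) → PrimeFun
prodII f = record { dom = BigPrime ; val = λ p → ℤtoℚ (legProd f p (pairsLt p)) }

prodIII : PrimeFun
prodIII = record { dom = BigPrime
                 ; val = λ p → ℤtoℚ (legProd (λ i j → i ℤ.* i ℤ.- i ℤ.* j ℤ.- j ℤ.* j) p (pairsAll p)) }

valuesI : List ℚ
valuesI = (+ 5) ℚ./ 1 ∷ ℤ.-[1+ 3 ] ℚ./ 1 ∷ (+ 1) ℚ./ 5 ∷ (+ 4) ℚ./ 5 ∷ (+ 5) ℚ./ 4 ∷ ℤ.-[1+ 0 ] ℚ./ 4 ∷ []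

five : ℚ
five = (+ 5) ℚ./ 1

formsII : List (ℤ → ℤ → ℤ)
formsII =
    (λ i j → i ℤ.* i ℤ.+ i ℤ.* j ℤ.- j ℤ.* j)
  ∷ (λ i j → i ℤ.* i ℤ.+ + 3 ℤ.* i ℤ.* j ℤ.+ j ℤ.* j)
  ∷ (λ i j → i ℤ.* i ℤ.- + 3 ℤ.* i ℤ.* j ℤ.+ j ℤ.* j)
  ∷ (λ i j → + 4 ℤ.* i ℤ.* i ℤ.+ j ℤ.* j)
  ∷ (λ i j → i ℤ.* i ℤ.+ + 4 ℤ.* j ℤ.* j)
  ∷ (λ i j → + 5 ℤ.* i ℤ.* i ℤ.- j ℤ.* j)
  ∷ (λ i j → i ℤ.* i ℤ.- + 5 ℤ.* j ℤ.* j)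
  ∷ []

{-# OPTIONS --safe #-}

-- Each of the functions is constant on the reduced residue classes modulo 80. Let χ be the Legendre symbol and
-- h = (p - 1) / 2; products of symbols are handled as exclusive-ors of the bits "χ = -1". By Gauss's lemma the
-- number of pairs (i , j) in [1 , h]² with i / j = t has the parity of h plus the bit of t, so that the product
-- of a form symmetric in i and j is a product over the ratios t up to inversion. In terms of w = t + 1/t it is the
-- parity of the number N of x for which x, x + 1 and x + 5 have prescribed symbols. The forms α i² + β j² become
-- symmetric under i = a - b, j = ± (a + b), and a character sum computation shows that Fp01 modulo 16 and the
-- parity of any of the numbers N determine each other.
--
-- It remains to count modulo 2 the x for which x, x + 1 and x + 5 are all squares. If χ(-1) = 1 or χ(5) = 1,
-- translation by a 2-torsion point of y² = x (x + 1) (x + 5) is an involution on them, and only its fixed points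
-- matter. If χ(-1) = χ(5) = -1 the parity is given by the symbol of the h-th Lucas number, because the polynomial
-- V with V (t - 1/t) = t^h + (- 1/t)^h vanishes exactly at the t - 1/t with t a square. That symbol, χ(5) and
-- χ(5 + √5) all follow from applying Frobenius to ζ - 1/ζ, for ζ a primitive fifth root of unity.

module Submission where

open import Defs
open import Algebra.Bundles using (CommutativeRing; AbelianGroup)
import Algebra.Construct.DirectProduct as DirectProduct
import Algebra.Properties.CommutativeSemiring.Binomial
import Algebra.Properties.CommutativeSemiring.Exp
import Algebra.Properties.Semiring.Exp
import Algebra.Properties.Semiring.Mult
import Algebra.Properties.Semiring.Sum
open import Data.Empty using (⊥; ⊥-elim)
open import Data.Fin as Fin using (toℕ; fromℕ; inject₁)
import Data.Fin.Properties as FinP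
open import Data.Nat as ℕ using (ℕ; zero; suc; _<_; _≤_; _≡ᵇ_; _<ᵇ_; s≤s; z≤n; _!)
open import Data.Nat.Combinatorics using (_C_; nCn≡1; nCk≡n!/k![n-k]!; k![n∸k]!∣n!)
import Data.Nat.Divisibility as ℕD
import Data.Nat.DivMod as ℕDM
open import Data.Nat.Primality using (Prime; euclidsLemma; prime⇒irreducible; prime⇒nonZero; prime⇒nonTrivial)
import Data.Nat.Properties as ℕP
open import Data.Product using (Σ; _×_; ∃; _,_; proj₁; proj₂)
open import Data.Sum using (_⊎_; inj₁; inj₂; [_,_]′)
open import Function using (_∘_; id)
open import Level using (0ℓ)
open import Relation.Binary.PropositionalEquality as ≡ using (_≡_)
open import Relation.Nullary using (¬_; Dec; yes; no)

-- Constancy on classes settles both notions at once: within a class two such functions differ by a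
-- constant, so a polynomial of slope 1 relates them. The modulus is 16 · 5: `p` modulo 16 enters
-- through `8 · count + K = p - L ± F`, and `p` modulo 5 through `ζ`. The same relation explains the
-- modulus 16 of the character sum, since 8 · count modulo 16 is the parity of `count`. The points
-- 0, -1, -5 come from the factors w - 2, w + 2, α w + β: the forms lead to β / α = ± 3 or ± 6/5,
-- and then the three roots have differences in the ratio 1 : 4 : 5. The obstacle is the case where
-- -1 and 5 are both nonsquares. Translation by (r , 0) sends x - r to (r - r′)(r - r″) / (x - r),
-- with numerator 5, -4 or 20 for r = 0, -1, -5; none of these is then a square, so no translation
-- preserves the triples of squares. The parity is read off instead as the symbol of a product over
-- all squares t, which is the value of one polynomial at 1.

prime∤! : ∀ {p} → Prime p → ∀ k → k < p → ¬ (p ℕD.∣ k !)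
prime∤! {p} pr zero    k<p d = ℕD.>⇒∤ k<p′ d
  where
  k<p′ : 1 < p
  k<p′ = ℕ.nonTrivial⇒n>1 p {{prime⇒nonTrivial pr}}
prime∤! pr (suc k) k<p d =
  [ ℕD.>⇒∤ k<p , prime∤! pr k (ℕP.<-trans (ℕP.n<1+n k) k<p) ]′ (euclidsLemma (suc k) (k !) pr d)

-- The prime divides `p !`, which is the binomial coefficient times `k !` times `(p ∸ k) !`, and by
-- `prime∤!` it divides neither factorial.
prime∣C : ∀ {p} → Prime p → ∀ k → 0 < k → k < p → p ℕD.∣ (p C k)
prime∣C {p} pr k 0<k k<p =
  [ id , (λ d → ⊥-elim ([ prime∤! pr k k<p , prime∤! pr (p ℕ.∸ k) (ℕP.∸-monoʳ-< 0<k (ℕP.<⇒≤ k<p)) ]′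
                          (euclidsLemma (k !) ((p ℕ.∸ k) !) pr d))) ]′
    (euclidsLemma (p C k) (k ! ℕ.* (p ℕ.∸ k) !) pr (≡.subst (p ℕD.∣_) (≡.sym C*) p∣p!))
  where
  instance
    nz : ℕ.NonZero (k ! ℕ.* (p ℕ.∸ k) !)
    nz = ℕP.m*n≢0 (k !) ((p ℕ.∸ k) !) {{ℕP._!≢0 k}} {{ℕP._!≢0 (p ℕ.∸ k)}}
  C* : (p C k) ℕ.* (k ! ℕ.* (p ℕ.∸ k) !) ≡ p !
  C* = ≡.trans (≡.cong (ℕ._* (k ! ℕ.* (p ℕ.∸ k) !)) (nCk≡n!/k![n-k]! (ℕP.<⇒≤ k<p)))
         (ℕDM.m/n*n≡m (k![n∸k]!∣n! (ℕP.<⇒≤ k<p)))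
  p∣p! : p ℕD.∣ p !
  p∣p! = lem p (ℕP.≤-<-trans z≤n k<p)
    where
    lem : ∀ n → 0 < n → n ℕD.∣ n !
    lem (suc n) _ = ℕD.m∣m*n (n !)

-- Frobenius, powers and quadratic extensions of commutative rings

module Frobenius (S : CommutativeRing 0ℓ 0ℓ) where
  open CommutativeRing S
  open Algebra.Properties.Semiring.Exp semiring using (_^_; ^-congˡ)
  open Algebra.Properties.Semiring.Mult semiring using (×-homo-+; ×-homo-1; ×-congʳ; ×-assoc-*; ×-congˡ; ×-assocˡ) renaming (_×_ to _·_)
  open Algebra.Properties.Semiring.Sum semiring using (sum; sum-init-last; sum-cong-≋; sum-replicate-zero)
  open Algebra.Properties.CommutativeSemiring.Binomial commutativeSemiring
  open import Relation.Binary.Reasoning.Setoid setoid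

  -- All inner terms of the binomial expansion are multiples of p. The ring is arbitrary because
  -- `𝔽[ζ]` has zero divisors for some p.
  frobenius : ∀ {p} → Prime p → p · 1# ≈ 0# → ∀ x y → (x + y) ^ p ≈ x ^ p + y ^ p
  frobenius {zero}  pr = ⊥-elim (ℕ.≢-nonZero⁻¹ 0 {{prime⇒nonZero pr}} ≡.refl)
  frobenius p@{suc n} pr char x y = begin
    (x + y) ^ p                                                   ≈⟨ theorem p x y ⟩
    binomialTerm x y p Fin.zero + sum (binomialTerm x y p ∘ Fin.suc) ≈⟨ +-cong first (sum-init-last (binomialTerm x y p ∘ Fin.suc)) ⟩
    y ^ p + (sum (binomialTerm x y p ∘ Fin.suc ∘ inject₁) + binomialTerm x y p (Fin.suc (fromℕ n)))
      ≈⟨ +-congˡ (+-cong (trans (sum-cong-≋ middle) (sum-replicate-zero n)) last) ⟩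
    y ^ p + (0# + x ^ p)                                          ≈⟨ +-congˡ (+-identityˡ (x ^ p)) ⟩
    y ^ p + x ^ p                                                 ≈⟨ +-comm (y ^ p) (x ^ p) ⟩
    x ^ p + y ^ p                                                 ∎
    where
    multiple≈0 : ∀ m z → p ℕD.∣ m → m · z ≈ 0#
    multiple≈0 m z (ℕD.divides-refl q) = begin
      (q ℕ.* p) · z       ≈⟨ ×-congʳ (q ℕ.* p) (sym (*-identityˡ z)) ⟩
      (q ℕ.* p) · (1# * z) ≈⟨ sym (×-assoc-* (q ℕ.* p) 1# z) ⟩
      ((q ℕ.* p) · 1#) * z ≈⟨ *-congʳ (sym (×-assocˡ 1# q p)) ⟩
      (q · (p · 1#)) * z   ≈⟨ *-congʳ (×-congʳ q char) ⟩
      (q · 0#) * z         ≈⟨ ×-assoc-* q 0# z ⟩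
      q · (0# * z)         ≈⟨ ×-congʳ q (zeroˡ z) ⟩
      q · 0#               ≈⟨ ·0 q ⟩
      0# ∎
      where
      ·0 : ∀ q → q · 0# ≈ 0#
      ·0 zero    = refl
      ·0 (suc q) = trans (+-identityˡ _) (·0 q)
    first : binomialTerm x y p Fin.zero ≈ y ^ p
    first = trans (+-identityʳ _) (*-identityˡ (y ^ p))
    last : binomialTerm x y p (Fin.suc (fromℕ n)) ≈ x ^ p
    last = lem (toℕ (fromℕ n)) (FinP.toℕ-fromℕ n)
      where
      lem : ∀ k → k ≡ n → (p C suc k) · (x ^ suc k * y ^ (n ℕ.∸ k)) ≈ x ^ p
      lem k ≡.refl = begin
        (p C p) · (x ^ p * y ^ (n ℕ.∸ n)) ≈⟨ reflexive (≡.cong₂ (λ c m → c · (x ^ p * y ^ m)) (nCn≡1 p) (ℕP.n∸n≡0 n)) ⟩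
        1 · (x ^ p * 1#)                  ≈⟨ trans (+-identityʳ _) (*-identityʳ (x ^ p)) ⟩
        x ^ p ∎
    middle : ∀ i → binomialTerm x y p (Fin.suc (inject₁ i)) ≈ 0#
    middle i = multiple≈0 _ _ (prime∣C pr (suc (toℕ (inject₁ i))) (s≤s z≤n)
      (s≤s (≡.subst (_< n) (≡.sym (FinP.toℕ-inject₁ i)) (FinP.toℕ<n i))))

module Powers (S : CommutativeRing 0ℓ 0ℓ) where
  open CommutativeRing S
  open Algebra.Properties.Semiring.Exp semiring
  open Algebra.Properties.CommutativeSemiring.Exp commutativeSemiring using (^-distrib-*)
  open import Relation.Binary.Reasoning.Setoid setoid

  1^ : ∀ n → 1# ^ n ≈ 1#
  1^ zero    = refl
  1^ (suc n) = trans (*-identityˡ (1# ^ n)) (1^ n)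

  ^-periodic : ∀ x m r q → x ^ m ≈ 1# → x ^ (r ℕ.+ q ℕ.* m) ≈ x ^ r
  ^-periodic x m r q e = begin
    x ^ (r ℕ.+ q ℕ.* m)   ≈⟨ ^-homo-* x r (q ℕ.* m) ⟩
    x ^ r * x ^ (q ℕ.* m) ≈⟨ *-congˡ (^-congʳ x (ℕP.*-comm q m)) ⟩
    x ^ r * x ^ (m ℕ.* q) ≈⟨ *-congˡ (sym (^-assocʳ x m q)) ⟩
    x ^ r * (x ^ m) ^ q   ≈⟨ *-congˡ (trans (^-congˡ q e) (1^ q)) ⟩
    x ^ r * 1#            ≈⟨ *-identityʳ (x ^ r) ⟩
    x ^ r ∎

  -- Since the exponent `suc h` is even, `b ^ suc h * c ^ k` is a power of `b ^ 2 * c`, hence of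
  -- `d ^ 2`. It serves for `Δ ^ 2 = 5 φ̄ ^ 2`, where 5 need not have a square root in the ring.
  even-power : ∀ a b c d h k → d ^ 2 ≈ b ^ 2 * c → suc h ≡ 2 ℕ.* k →
               (a * b) * (b ^ h * c ^ k) ≈ a * d ^ suc h
  even-power a b c d h k e eq = begin
    (a * b) * (b ^ h * c ^ k)   ≈⟨ *-assoc a b _ ⟩
    a * (b * (b ^ h * c ^ k))   ≈⟨ *-congˡ (sym (*-assoc b (b ^ h) (c ^ k))) ⟩
    a * (b ^ suc h * c ^ k)     ≈⟨ *-congˡ (*-congʳ (trans (^-congʳ b eq) (sym (^-assocʳ b 2 k)))) ⟩
    a * ((b ^ 2) ^ k * c ^ k)   ≈⟨ *-congˡ (sym (^-distrib-* (b ^ 2) c k)) ⟩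
    a * (b ^ 2 * c) ^ k         ≈⟨ *-congˡ (^-congˡ k (sym e)) ⟩
    a * (d ^ 2) ^ k             ≈⟨ *-congˡ (trans (^-assocʳ d 2 k) (^-congʳ d (≡.sym eq))) ⟩
    a * d ^ suc h ∎

-- The quadratic extension B[X] / (X² - u - v X).
module Quadratic (B : CommutativeRing 0ℓ 0ℓ) (u v : CommutativeRing.Carrier B) where
  open CommutativeRing B
  private module Identities where
    open import Algebra.Solver.Ring.NaturalCoefficients.Default commutativeSemiring using (solve; _:=_; _:+_; _:*_)

    assoc₁ : ∀ u v a b c d e f →
      (a * c + b * d * u) * e + (a * d + b * c + b * d * v) * f * u ≈
      a * (c * e + d * f * u) + b * (c * f + d * e + d * f * v) * u
    assoc₁ = solve 8 (λ u v a b c d e f →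
      (a :* c :+ b :* d :* u) :* e :+ (a :* d :+ b :* c :+ b :* d :* v) :* f :* u :=
      a :* (c :* e :+ d :* f :* u) :+ b :* (c :* f :+ d :* e :+ d :* f :* v) :* u) refl

    assoc₂ : ∀ u v a b c d e f →
      (a * c + b * d * u) * f + (a * d + b * c + b * d * v) * e + (a * d + b * c + b * d * v) * f * v ≈
      a * (c * f + d * e + d * f * v) + b * (c * e + d * f * u) + b * (c * f + d * e + d * f * v) * v
    assoc₂ = solve 8 (λ u v a b c d e f →
      (a :* c :+ b :* d :* u) :* f :+ (a :* d :+ b :* c :+ b :* d :* v) :* e :+ (a :* d :+ b :* c :+ b :* d :* v) :* f :* v :=
      a :* (c :* f :+ d :* e :+ d :* f :* v) :+ b :* (c :* e :+ d :* f :* u) :+ b :* (c :* f :+ d :* e :+ d :* f :* v) :* v) refl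

    comm₁ : ∀ u a b c d →
      a * c + b * d * u ≈
      c * a + d * b * u
    comm₁ = solve 5 (λ u a b c d →
      a :* c :+ b :* d :* u :=
      c :* a :+ d :* b :* u) refl

    comm₂ : ∀ v a b c d →
      a * d + b * c + b * d * v ≈
      c * b + d * a + d * b * v
    comm₂ = solve 5 (λ v a b c d →
      a :* d :+ b :* c :+ b :* d :* v :=
      c :* b :+ d :* a :+ d :* b :* v) refl

    dˡ₁ : ∀ u a b c d e f →
      a * (c + e) + b * (d + f) * u ≈
      (a * c + b * d * u) + (a * e + b * f * u)
    dˡ₁ = solve 7 (λ u a b c d e f →
      a :* (c :+ e) :+ b :* (d :+ f) :* u :=
      (a :* c :+ b :* d :* u) :+ (a :* e :+ b :* f :* u)) refl

    dˡ₂ : ∀ v a b c d e f →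
      a * (d + f) + b * (c + e) + b * (d + f) * v ≈
      (a * d + b * c + b * d * v) + (a * f + b * e + b * f * v)
    dˡ₂ = solve 7 (λ v a b c d e f →
      a :* (d :+ f) :+ b :* (c :+ e) :+ b :* (d :+ f) :* v :=
      (a :* d :+ b :* c :+ b :* d :* v) :+ (a :* f :+ b :* e :+ b :* f :* v)) refl

    dʳ₁ : ∀ u a b c d e f →
      (c + e) * a + (d + f) * b * u ≈
      (c * a + d * b * u) + (e * a + f * b * u)
    dʳ₁ = solve 7 (λ u a b c d e f →
      (c :+ e) :* a :+ (d :+ f) :* b :* u :=
      (c :* a :+ d :* b :* u) :+ (e :* a :+ f :* b :* u)) refl

    dʳ₂ : ∀ v a b c d e f →
      (c + e) * b + (d + f) * a + (d + f) * b * v ≈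
      (c * b + d * a + d * b * v) + (e * b + f * a + f * b * v)
    dʳ₂ = solve 7 (λ v a b c d e f →
      (c :+ e) :* b :+ (d :+ f) :* a :+ (d :+ f) :* b :* v :=
      (c :* b :+ d :* a :+ d :* b :* v) :+ (e :* b :+ f :* a :+ f :* b :* v)) refl

  open Identities

  abelianGroup : AbelianGroup 0ℓ 0ℓ
  abelianGroup = DirectProduct.abelianGroup +-abelianGroup +-abelianGroup

  private module A = AbelianGroup abelianGroup

  infixl 7 _⊛_
  _⊛_ : A.Carrier → A.Carrier → A.Carrier
  (a , b) ⊛ (c , d) = a * c + b * d * u , a * d + b * c + b * d * v

  extension : CommutativeRing 0ℓ 0ℓ
  extension = record
    { Carrier = A.Carrier ; _≈_ = A._≈_ ; _+_ = A._∙_ ; _*_ = _⊛_ ; -_ = A._⁻¹ ; 0# = A.ε ; 1# = 1# , 0#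
    ; isCommutativeRing = record
      { isRing = record
        { +-isAbelianGroup = A.isAbelianGroup
        ; *-cong = λ (e , f) (e′ , f′) →
            +-cong (*-cong e e′) (*-cong (*-cong f f′) refl) ,
            +-cong (+-cong (*-cong e f′) (*-cong f e′)) (*-cong (*-cong f f′) refl)
        ; *-assoc = λ (a , b) (c , d) (e , f) → assoc₁ u v a b c d e f , assoc₂ u v a b c d e f
        ; *-identity = (λ (a , b) → idˡ₁ u a b , idˡ₂ v a b) , (λ (a , b) → idʳ₁ u a b , idʳ₂ v a b)
        ; distrib = (λ (a , b) (c , d) (e , f) → dˡ₁ u a b c d e f , dˡ₂ v a b c d e f) ,
                    (λ (a , b) (c , d) (e , f) → dʳ₁ u a b c d e f , dʳ₂ v a b c d e f)
        }
      ; *-comm = λ (a , b) (c , d) → comm₁ u a b c d , comm₂ v a b c d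
      }
    }
    where
    0*0 : ∀ b u → 0# * b * u ≈ 0#
    0*0 b u = trans (*-congʳ (zeroˡ b)) (zeroˡ u)
    0*0′ : ∀ b u → b * 0# * u ≈ 0#
    0*0′ b u = trans (*-congʳ (zeroʳ b)) (zeroˡ u)
    idˡ₁ : ∀ u a b → 1# * a + 0# * b * u ≈ a
    idˡ₁ u a b = trans (+-cong (*-identityˡ a) (0*0 b u)) (+-identityʳ a)
    idˡ₂ : ∀ v a b → 1# * b + 0# * a + 0# * b * v ≈ b
    idˡ₂ v a b = trans (+-cong (trans (+-cong (*-identityˡ b) (zeroˡ a)) (+-identityʳ b)) (0*0 b v)) (+-identityʳ b)
    idʳ₁ : ∀ u a b → a * 1# + b * 0# * u ≈ a
    idʳ₁ u a b = trans (+-cong (*-identityʳ a) (0*0′ b u)) (+-identityʳ a)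
    idʳ₂ : ∀ v a b → a * 0# + b * 1# + b * 0# * v ≈ b
    idʳ₂ v a b = trans (+-cong (trans (+-cong (zeroʳ a) (*-identityʳ b)) (+-identityˡ b)) (0*0′ b v)) (+-identityʳ b)

open import Algebra.Structures using (IsCommutativeMonoid)
open import Data.Bool using (Bool; true; false; T; _∧_; not; _xor_; if_then_else_)
import Data.Bool.Properties as BP
open import Data.Integer as ℤ using (ℤ; +_; -_; _+_; _-_; _*_; 0ℤ; 1ℤ; -1ℤ; ∣_∣; _^_; _%ℕ_; _/ℕ_)
open import Data.Integer.DivMod using (n%ℕd<d; a≡a%ℕn+[a/ℕn]*n)
import Data.Integer.Divisibility.Signed as ℤS
import Data.Integer.Properties as ℤP
open import Data.Integer.Tactic.RingSolver using (solve-∀)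
open import Data.List using (List; []; _∷_; _++_; applyUpTo; concatMap; length; map; replicate; upTo)
import Data.List.Properties as LP
open import Data.List.Membership.Propositional using (_∈_; lose)
open import Data.List.Membership.Propositional.Properties using (∈-upTo⁺)
open import Data.List.Relation.Unary.Any using (here; there; satisfied)
import Data.List.Relation.Unary.Any.Properties as AnyP
open import Data.Nat using (⌊_/2⌋; ⌈_/2⌉; _%_; _/_)
open import Data.Nat.Coprimality using (prime⇒coprime; coprime-Bézout)
open import Data.Nat.GCD using (gcd; module Bézout)
open import Data.Rational as ℚ using (ℚ; ↥_; ↧ₙ_)
import Data.Rational.Properties as ℚP
open import Data.Unit using (tt)
open import Relation.Binary.PropositionalEquality hiding (J)

-- Bits, and finite sums in commutative monoids

≡ᵇ-sound : ∀ m n → (m ≡ᵇ n) ≡ true → m ≡ n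
≡ᵇ-sound m n eq = ℕP.≡ᵇ⇒≡ m n (subst T (sym eq) tt)

≡ᵇ-refl : ∀ m → (m ≡ᵇ m) ≡ true
≡ᵇ-refl zero    = refl
≡ᵇ-refl (suc m) = ≡ᵇ-refl m

true≢false : ∀ {ℓ} {X : Set ℓ} {b} → b ≡ true → b ≡ false → X
true≢false refl ()

∧-true : ∀ {a b} → a ∧ b ≡ true → a ≡ true × b ≡ true
∧-true {true} {true} refl = refl , refl

∧-intro : ∀ {a b} → a ≡ true → b ≡ true → a ∧ b ≡ true
∧-intro refl refl = refl

bool-ext : ∀ {a b} → (a ≡ true → b ≡ true) → (b ≡ true → a ≡ true) → a ≡ b
bool-ext {true}  {b} f g = sym (f refl)
bool-ext {false} {true} f g = g refl
bool-ext {false} {false} f g = refl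

decide : ∀ b → (b ≡ true) ⊎ (b ≡ false)
decide true  = inj₁ refl
decide false = inj₂ refl

-- Instantiated with exclusive-or, integer product and integer sum, so that reindexing is proved
-- once for parities, products and character sums.
module Sums {A : Set} (_∙_ : A → A → A) (ε : A) (isCM : IsCommutativeMonoid _≡_ _∙_ ε) where
  open IsCommutativeMonoid isCM using (assoc; comm; identityˡ; identityʳ)
  open ≡-Reasoning

  sum : ℕ → (ℕ → A) → A
  sum zero    f = ε
  sum (suc n) f = f 0 ∙ sum n (f ∘ suc)

  infixr 5 _▸_
  _▸_ : Bool → A → A
  true  ▸ x = x
  false ▸ x = ε

  sum-cong : ∀ n {f g} → (∀ i → i < n → f i ≡ g i) → sum n f ≡ sum n g
  sum-cong zero    e = refl
  sum-cong (suc n) e = cong₂ _∙_ (e 0 (s≤s z≤n)) (sum-cong n λ i i<n → e (suc i) (s≤s i<n))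

  sum-ε : ∀ n {f} → (∀ i → i < n → f i ≡ ε) → sum n f ≡ ε
  sum-ε zero    e = refl
  sum-ε (suc n) e = trans (cong₂ _∙_ (e 0 (s≤s z≤n)) (sum-ε n λ i i<n → e (suc i) (s≤s i<n))) (identityˡ ε)

  interchange : ∀ a b c d → (a ∙ b) ∙ (c ∙ d) ≡ (a ∙ c) ∙ (b ∙ d)
  interchange a b c d = begin
    (a ∙ b) ∙ (c ∙ d) ≡⟨ assoc a b _ ⟩
    a ∙ (b ∙ (c ∙ d)) ≡⟨ cong (a ∙_) (sym (assoc b c d)) ⟩
    a ∙ ((b ∙ c) ∙ d) ≡⟨ cong (λ z → a ∙ (z ∙ d)) (comm b c) ⟩
    a ∙ ((c ∙ b) ∙ d) ≡⟨ cong (a ∙_) (assoc c b d) ⟩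
    a ∙ (c ∙ (b ∙ d)) ≡⟨ sym (assoc a c _) ⟩
    (a ∙ c) ∙ (b ∙ d) ∎

  sum-∙ : ∀ n f g → sum n (λ i → f i ∙ g i) ≡ sum n f ∙ sum n g
  sum-∙ zero    f g = sym (identityˡ ε)
  sum-∙ (suc n) f g = trans (cong ((f 0 ∙ g 0) ∙_) (sum-∙ n (f ∘ suc) (g ∘ suc))) (interchange _ _ _ _)

  sum-swap : ∀ m n (F : ℕ → ℕ → A) → sum m (λ i → sum n (F i)) ≡ sum n (λ j → sum m (λ i → F i j))
  sum-swap zero    n F = sym (sum-ε n λ _ _ → refl)
  sum-swap (suc m) n F = trans (cong (sum n (F 0) ∙_) (sum-swap m n (F ∘ suc))) (sym (sum-∙ n _ _))

  ▸-cong : ∀ b {x y} → (b ≡ true → x ≡ y) → b ▸ x ≡ b ▸ y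
  ▸-cong true  e = e refl
  ▸-cong false e = refl

  sum-single : ∀ n k {f} → k < n → (∀ i → i < n → i ≢ k → f i ≡ ε) → sum n f ≡ f k
  sum-single (suc n) zero    _ e =
    trans (cong (_ ∙_) (sum-ε n λ i i<n → e (suc i) (s≤s i<n) λ ())) (identityʳ _)
  sum-single (suc n) (suc k) (s≤s k<n) e =
    trans (cong₂ _∙_ (e 0 (s≤s z≤n) λ ())
                     (sum-single n k k<n λ i i<n i≢k → e (suc i) (s≤s i<n) (i≢k ∘ ℕP.suc-injective)))
          (identityˡ _)

  sum-snoc : ∀ n f → sum (suc n) f ≡ sum n f ∙ f n
  sum-snoc zero    f = comm (f 0) ε
  sum-snoc (suc n) f = trans (cong (f 0 ∙_) (sum-snoc n (f ∘ suc))) (sym (assoc _ _ _))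

  sum-reverse : ∀ n f → sum n f ≡ sum n (λ i → f (n ℕ.∸ suc i))
  sum-reverse zero    f = refl
  sum-reverse (suc n) f =
    trans (sum-snoc n f) (trans (comm _ _) (cong (f n ∙_) (sum-reverse n f)))

  sum-split : ∀ m n f → sum (m ℕ.+ n) f ≡ sum m f ∙ sum n (λ i → f (m ℕ.+ i))
  sum-split zero    n f = sym (identityˡ _)
  sum-split (suc m) n f = trans (cong (f 0 ∙_) (sum-split m n (f ∘ suc))) (sym (assoc _ _ _))

  -- The i-th term is spread over all j as the indicator of `π i = j`, and the two sums are
  -- exchanged: for each j with `d j` exactly one i survives, and for the other j none does. The
  -- bits `c` and `d` stand for the subsets between which `π` is a bijection.
  sum-bij : ∀ m n (c d : ℕ → Bool) (π : ℕ → ℕ) →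
            (∀ i → i < m → c i ≡ true → π i < n × d (π i) ≡ true) →
            (∀ j → j < n → d j ≡ true → ∃ λ i → i < m × c i ≡ true × π i ≡ j) →
            (∀ i i′ → i < m → i′ < m → c i ≡ true → c i′ ≡ true → π i ≡ π i′ → i ≡ i′) →
            ∀ (f : ℕ → A) → sum m (λ i → c i ▸ f (π i)) ≡ sum n (λ j → d j ▸ f j)
  sum-bij m n c d π into onto inj f = begin
    sum m (λ i → c i ▸ f (π i))                               ≡⟨ sum-cong m spread ⟩
    sum m (λ i → sum n (λ j → (c i ∧ (π i ≡ᵇ j)) ▸ f j))      ≡⟨ sum-swap m n _ ⟩
    sum n (λ j → sum m (λ i → (c i ∧ (π i ≡ᵇ j)) ▸ f j))      ≡⟨ sum-cong n collect ⟩
    sum n (λ j → d j ▸ f j) ∎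
    where
    off : ∀ a b x → a ≢ b → (a ≡ᵇ b) ▸ x ≡ ε
    off a b x a≢b with a ≡ᵇ b in eq
    ... | true  = ⊥-elim (a≢b (≡ᵇ-sound a b eq))
    ... | false = refl

    spread : ∀ i → i < m → c i ▸ f (π i) ≡ sum n (λ j → (c i ∧ (π i ≡ᵇ j)) ▸ f j)
    spread i i<m with c i in ci
    ... | false = sym (sum-ε n λ _ _ → refl)
    ... | true  = sym (trans (sum-single n (π i) (proj₁ (into i i<m ci))
                               λ j _ j≢ → off (π i) j (f j) (j≢ ∘ sym))
                             (cong (_▸ f (π i)) (≡ᵇ-refl (π i))))

    hit : ∀ i i′ j → i′ < m → c i′ ≡ true → π i′ ≡ j → i < m → i ≢ i′ → (c i ∧ (π i ≡ᵇ j)) ▸ f j ≡ ε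
    hit i i′ j i′<m ci′ e i<m i≢ with c i in ci
    ... | false = refl
    ... | true  = off (π i) j (f j) λ e′ → i≢ (inj i i′ i<m i′<m ci ci′ (trans e′ (sym e)))

    collect : ∀ j → j < n → sum m (λ i → (c i ∧ (π i ≡ᵇ j)) ▸ f j) ≡ d j ▸ f j
    collect j j<n with d j in dj
    ... | true with onto j j<n dj
    ...   | i , i<m , ci , refl =
      trans (sum-single m i i<m λ i₁ i₁<m i₁≢ → hit i₁ i _ i<m ci refl i₁<m i₁≢)
            (cong (_▸ f (π i)) (∧-intro ci (≡ᵇ-refl (π i))))
    collect j j<n | false = sum-ε m λ i i<m → miss i i<m
      where
      miss : ∀ i → i < m → (c i ∧ (π i ≡ᵇ j)) ▸ f j ≡ ε
      miss i i<m with c i in ci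
      ... | false = refl
      ... | true  = off (π i) j (f j) λ e → true≢false (proj₂ (into i i<m ci)) (trans (cong d e) dj)

T⇒≡ : ∀ {b} → T b → b ≡ true
T⇒≡ {true} _ = refl

≡⇒T : ∀ {b} → b ≡ true → T b
≡⇒T refl = tt

multiple< : ∀ {m} k → k < m → m ℕD.∣ k → k ≡ 0
multiple< zero    _   _ = refl
multiple< (suc k) k<m d = ⊥-elim (ℕD.>⇒∤ k<m d)

remainder-unique : ∀ {m i j} k → i < m → j < m → + i - + j ≡ k * + m → i ≡ j
remainder-unique {m} {i} {j} k i<m j<m eq = [ ordered i<m j<m d , (λ j≤i → sym (ordered j<m i<m d′ j≤i)) ]′ (ℕP.≤-total i j)
  where
  d : m ℕD.∣ ∣ i ℤ.⊖ j ∣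
  d = subst (λ x → m ℕD.∣ ∣ x ∣) (ℤP.m-n≡m⊖n i j) (ℤS.∣⇒∣ᵤ (ℤS.divides k eq))
  d′ : m ℕD.∣ ∣ j ℤ.⊖ i ∣
  d′ = subst (m ℕD.∣_) (ℤP.∣m⊖n∣≡∣n⊖m∣ i j) d
  ordered : ∀ {i j} → i < m → j < m → m ℕD.∣ ∣ i ℤ.⊖ j ∣ → i ≤ j → i ≡ j
  ordered {i} {j} _ j<m d i≤j = ℕP.≤-antisym i≤j (ℕP.m∸n≡0⇒m≤n
    (multiple< (j ℕ.∸ i) (ℕP.≤-<-trans (ℕP.m∸n≤m j i) j<m) (subst (m ℕD.∣_) (ℤP.∣⊖∣-≤ i≤j) d)))

-- Signs, monic polynomials and Lucas polynomials

xor-isCM : IsCommutativeMonoid _≡_ _xor_ false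
xor-isCM = CommutativeRing.+-isCommutativeMonoid BP.xor-∧-commutativeRing

sgn : Bool → ℤ
sgn true  = -1ℤ
sgn false = 1ℤ

sgn-xor : ∀ a b → sgn (a xor b) ≡ sgn a * sgn b
sgn-xor true  true  = refl
sgn-xor true  false = refl
sgn-xor false true  = refl
sgn-xor false false = refl

odd : ℕ → Bool
odd zero    = false
odd (suc n) = not (odd n)

<ᵇ-true : ∀ {m n} → (m <ᵇ n) ≡ true → m < n
<ᵇ-true {m} {n} e = ℕP.<ᵇ⇒< m n (≡⇒T e)

<ᵇ-intro : ∀ {m n} → m < n → (m <ᵇ n) ≡ true
<ᵇ-intro lt = T⇒≡ (ℕP.<⇒<ᵇ lt)

<ᵇ-false : ∀ {m n} → (m <ᵇ n) ≡ false → n ≤ m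
<ᵇ-false {m} {n} e = ℕP.≮⇒≥ λ lt → true≢false (<ᵇ-intro lt) e

<ᵇ-intro-false : ∀ {m n} → n ≤ m → (m <ᵇ n) ≡ false
<ᵇ-intro-false {m} {n} le with m <ᵇ n in e
... | true  = ⊥-elim (ℕP.<⇒≱ (<ᵇ-true e) le)
... | false = refl

module ⊕ = Sums _xor_ false xor-isCM
module ∏ = Sums _*_ 1ℤ ℤP.*-1-isCommutativeMonoid

∏-sgn : ∀ n f → ∏.sum n (λ i → sgn (f i)) ≡ sgn (⊕.sum n f)
∏-sgn zero    f = refl
∏-sgn (suc n) f = trans (cong (sgn (f 0) *_) (∏-sgn n (f ∘ suc))) (sym (sgn-xor (f 0) _))

∏-const : ∀ n t → ∏.sum n (λ _ → t) ≡ t ^ n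
∏-const zero    t = refl
∏-const (suc n) t = cong (t *_) (∏-const n t)

^-distrib-* : ∀ a b n → (a * b) ^ n ≡ a ^ n * b ^ n
^-distrib-* a b zero    = refl
^-distrib-* a b (suc n) = trans (cong (a * b *_) (^-distrib-* a b n)) (lem a b (a ^ n) (b ^ n))
  where
  lem : ∀ a b c d → a * b * (c * d) ≡ a * c * (b * d)
  lem = solve-∀

-- A list of lower coefficients stands for a monic polynomial, whose degree is the length of the list.
eval : List ℤ → ℤ → ℤ
eval []       x = 1ℤ
eval (c ∷ cs) x = c + x * eval cs x

-- Synthetic division: `quotient cs a` is the quotient of `c ∷ cs` by X - a, whatever the constant
-- coefficient c. Its coefficients are Horner's partial values at a.
quotient : List ℤ → ℤ → List ℤ
quotient []       a = []
quotient (c ∷ cs) a = eval (c ∷ cs) a ∷ quotient cs a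

eval-factor : ∀ c cs a x → eval (c ∷ cs) x - eval (c ∷ cs) a ≡ (x - a) * eval (quotient cs a) x
eval-factor c []        a x = lem c a x
  where
  lem : ∀ c a x → (c + x * + 1) - (c + a * + 1) ≡ (x - a) * + 1
  lem = solve-∀
eval-factor c (d ∷ cs) a x = trans (lem c x a _ _) (trans (cong (λ z → (x - a) * eval (d ∷ cs) a + x * z) (eval-factor d cs a x))
    (lem′ x a (eval (d ∷ cs) a) (eval (quotient cs a) x)))
  where
  lem : ∀ c x a e f → (c + x * e) - (c + a * f) ≡ (x - a) * f + x * (e - f)
  lem = solve-∀
  lem′ : ∀ x a f q → (x - a) * f + x * ((x - a) * q) ≡ (x - a) * (f + x * q)
  lem′ = solve-∀

length-quotient : ∀ cs a → length (quotient cs a) ≡ length cs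
length-quotient []       a = refl
length-quotient (c ∷ cs) a = cong suc (length-quotient cs a)

eval-power : ∀ c n x → eval (c ∷ replicate n 0ℤ) x ≡ c + x ^ suc n
eval-power c zero    x = refl
eval-power c (suc n) x = cong (λ z → c + x * z) (trans (eval-power 0ℤ n x) (ℤP.+-identityˡ _))

-- The p-th powers of ζ and - ζ⁻¹, elements of orders 5 and 10, depend only on p modulo 10, and a
-- prime above 5 is congruent to one of these four.
data Unit10 : Set where
  u1 u3 u7 u9 : Unit10

toNat : Unit10 → ℕ
toNat u1 = 1
toNat u3 = 3
toNat u7 = 7
toNat u9 = 9

five-bit : Unit10 → Bool
five-bit u1 = false
five-bit u3 = true
five-bit u7 = true
five-bit u9 = false

xor-same : ∀ a → a xor a ≡ false
xor-same true  = refl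
xor-same false = refl

xor-move : ∀ {a b c} → a xor b ≡ c → b ≡ c xor a
xor-move {true}  {true}  refl = refl
xor-move {true}  {false} refl = refl
xor-move {false} {true}  refl = refl
xor-move {false} {false} refl = refl

∧-distrib-xor : ∀ a b c → a ∧ (b xor c) ≡ (a ∧ b) xor (a ∧ c)
∧-distrib-xor true  b c = refl
∧-distrib-xor false b c = refl

-- lucas n is the monic polynomial L with L (t - 1/t) = t ^ (n + 1) + (- 1/t) ^ (n + 1).
addLower : List ℤ → List ℤ → List ℤ
addLower []       _        = []
addLower (c ∷ cs) []       = c + 1ℤ ∷ cs
addLower (c ∷ cs) (d ∷ ds) = c + d ∷ addLower cs ds

lucas : ℕ → List ℤ
lucas 0             = 0ℤ ∷ []
lucas 1             = + 2 ∷ 0ℤ ∷ []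
lucas (suc (suc n)) = addLower (0ℤ ∷ lucas (suc n)) (lucas n)

length-addLower : ∀ cs ds → length (addLower cs ds) ≡ length cs
length-addLower []       ds       = refl
length-addLower (c ∷ cs) []       = refl
length-addLower (c ∷ cs) (d ∷ ds) = cong suc (length-addLower cs ds)

-- The implicit leading term of `ds` has to fall on a listed coefficient of `cs`; with equal degrees
-- the sum would not be monic.
eval-addLower : ∀ cs ds → length ds < length cs → ∀ x → eval (addLower cs ds) x ≡ eval cs x + eval ds x
eval-addLower (c ∷ cs) []       _        x = lem c (eval cs x) x
  where
  lem : ∀ c e x → c + 1ℤ + x * e ≡ c + x * e + 1ℤ
  lem = solve-∀
eval-addLower (c ∷ cs) (d ∷ ds) (s≤s lt) x =
  trans (cong (λ z → c + d + x * z) (eval-addLower cs ds lt x)) (lem c d x (eval cs x) (eval ds x))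
  where
  lem : ∀ c d x e f → c + d + x * (e + f) ≡ c + x * e + (d + x * f)
  lem = solve-∀

length-lucas : ∀ n → length (lucas n) ≡ suc n
length-lucas 0             = refl
length-lucas 1             = refl
length-lucas (suc (suc n)) = trans (length-addLower (0ℤ ∷ lucas (suc n)) (lucas n)) (cong suc (length-lucas (suc n)))

eval-lucas : ∀ n x → eval (lucas (suc (suc n))) x ≡ x * eval (lucas (suc n)) x + eval (lucas n) x
eval-lucas n x = trans (eval-addLower (0ℤ ∷ lucas (suc n)) (lucas n)
    (subst₂ _<_ (sym (length-lucas n)) (cong suc (sym (length-lucas (suc n)))) (ℕP.m≤n⇒m≤1+n ℕP.≤-refl)) x)
  (cong (_+ eval (lucas n) x) (ℤP.+-identityˡ (x * eval (lucas (suc n)) x)))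

isThree isNine : Unit10 → Bool
isThree u3 = true
isThree _  = false
isNine u9 = true
isNine _  = false

⊕-const : ∀ n → ⊕.sum n (λ _ → true) ≡ odd n
⊕-const zero    = refl
⊕-const (suc n) = cong not (⊕-const n)

-- Triangular sums and lists of pairs

module Triangle {A : Set} (_∙_ : A → A → A) (ε : A) (isCM : IsCommutativeMonoid _≡_ _∙_ ε) where
  open Sums _∙_ ε isCM
  open IsCommutativeMonoid isCM using (assoc; identityˡ)

  triangle rows : ℕ → (ℕ → ℕ → A) → A
  triangle n F = sum n (λ j → sum j (λ i → F i j))
  rows     n F = sum n (λ i → sum (n ℕ.∸ suc i) (λ k → F i (suc i ℕ.+ k)))

  triangle≡rows : ∀ n F → triangle n F ≡ rows n F
  triangle≡rows zero    F = refl
  triangle≡rows (suc n) F = trans (identityˡ _) (trans (sum-∙ n (F 0 ∘ suc) (λ j → sum j (λ i → F (suc i) (suc j))))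
    (cong (sum n (F 0 ∘ suc) ∙_) (triangle≡rows n (λ i j → F (suc i) (suc j)))))

  triangle-reverse : ∀ n F → triangle n F ≡ triangle n (λ i j → F (j ℕ.∸ suc i) j)
  triangle-reverse n F = sum-cong n λ j _ → sum-reverse j (λ i → F i j)

open Triangle _xor_ false xor-isCM using (triangle; rows; triangle≡rows; triangle-reverse)

triangle-cong : ∀ n {F G} → (∀ i j → i < j → j < n → F i j ≡ G i j) → triangle n F ≡ triangle n G
triangle-cong n e = ⊕.sum-cong n λ j j<n → ⊕.sum-cong j λ i i<j → e i j i<j j<n

<ᵇ-sum : ∀ n j (f : ℕ → Bool) → j ≤ n → ⊕.sum n (λ k → (k <ᵇ j) ∧ f k) ≡ ⊕.sum j f
<ᵇ-sum n       zero    f _       = ⊕.sum-ε n λ _ _ → refl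
<ᵇ-sum (suc n) (suc j) f (s≤s l) = cong (f 0 xor_) (<ᵇ-sum n j (f ∘ suc) l)

xorList : ∀ {X : Set} → (X → Bool) → List X → Bool
xorList g []       = false
xorList g (x ∷ xs) = g x xor xorList g xs

xorList-++ : ∀ {X : Set} (g : X → Bool) xs ys → xorList g (xs ++ ys) ≡ xorList g xs xor xorList g ys
xorList-++ g []       ys = refl
xorList-++ g (x ∷ xs) ys = trans (cong (g x xor_) (xorList-++ g xs ys)) (sym (BP.xor-assoc (g x) (xorList g xs) (xorList g ys)))

xorList-map : ∀ {X Y : Set} (g : Y → Bool) (f : X → Y) xs → xorList g (map f xs) ≡ xorList (g ∘ f) xs
xorList-map g f []       = refl
xorList-map g f (x ∷ xs) = cong (g (f x) xor_) (xorList-map g f xs)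

xorList-concatMap : ∀ {X Y : Set} (g : Y → Bool) (f : X → List Y) xs → xorList g (concatMap f xs) ≡ xorList (λ x → xorList g (f x)) xs
xorList-concatMap g f []       = refl
xorList-concatMap g f (x ∷ xs) = trans (xorList-++ g (f x) (concatMap f xs)) (cong (xorList g (f x) xor_) (xorList-concatMap g f xs))

xorList-applyUpTo : ∀ (g : ℕ → Bool) f n → xorList g (applyUpTo f n) ≡ ⊕.sum n (g ∘ f)
xorList-applyUpTo g f zero    = refl
xorList-applyUpTo g f (suc n) = cong (g (f 0) xor_) (xorList-applyUpTo g (f ∘ suc) n)

xorList-range1 : ∀ (g : ℕ → Bool) n → xorList g (range1 n) ≡ ⊕.sum n (g ∘ suc)
xorList-range1 g n = trans (xorList-map g suc (upTo n)) (xorList-applyUpTo (g ∘ suc) id n)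

xorList-cong : ∀ {X : Set} {g g′ : X → Bool} xs → (∀ x → g x ≡ g′ x) → xorList g xs ≡ xorList g′ xs
xorList-cong []       e = refl
xorList-cong (x ∷ xs) e = cong₂ _xor_ (e x) (xorList-cong xs e)

half-double : ∀ h → (h ℕ.+ h) ℕ./ 2 ≡ h
half-double h = trans (cong (ℕ._/ 2) (trans (cong (h ℕ.+_) (sym (ℕP.+-identityʳ h))) (ℕP.*-comm 2 h))) (ℕDM.m*n/n≡m h 2)

-- Integer sums, and the values predicted from p modulo 80

module ∑ = Sums _+_ 0ℤ ℤP.+-0-isCommutativeMonoid

⟦_⟧ : Bool → ℤ
⟦ true  ⟧ = 1ℤ
⟦ false ⟧ = 0ℤ

∑-const : ∀ n c → ∑.sum n (λ _ → c) ≡ + n * c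
∑-const zero    c = sym (ℤP.*-zeroˡ c)
∑-const (suc n) c = trans (cong (λ z → c + z) (∑-const n c)) (lem (+ n) c)
  where
  lem : ∀ n c → c + n * c ≡ (1ℤ + n) * c
  lem = solve-∀

*-∑ : ∀ n c f → c * ∑.sum n f ≡ ∑.sum n (λ i → c * f i)
*-∑ zero    c f = ℤP.*-zeroʳ c
*-∑ (suc n) c f = trans (ℤP.*-distribˡ-+ c (f 0) (∑.sum n (f ∘ suc))) (cong (λ z → c * f 0 + z) (*-∑ n c (f ∘ suc)))

∑-parity : ∀ n f → ∃ λ m → ∑.sum n (λ i → ⟦ f i ⟧) ≡ ⟦ ⊕.sum n f ⟧ + + 2 * m
∑-parity zero    f = 0ℤ , refl
∑-parity (suc n) f = let m , e = ∑-parity n (f ∘ suc) in carry (f 0) (⊕.sum n (f ∘ suc)) m ,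
    trans (cong (λ z → ⟦ f 0 ⟧ + z) e) (step (f 0) (⊕.sum n (f ∘ suc)) m)
  where
  carry : Bool → Bool → ℤ → ℤ
  carry true  true  m = 1ℤ + m
  carry _     _     m = m
  step : ∀ a b m → ⟦ a ⟧ + (⟦ b ⟧ + + 2 * m) ≡ ⟦ a xor b ⟧ + + 2 * carry a b m
  step true true m = lem m
    where
    lem : ∀ m → 1ℤ + (1ℤ + + 2 * m) ≡ 0ℤ + + 2 * (1ℤ + m)
    lem = solve-∀
  step true  false m = cong (λ z → 1ℤ + z) (ℤP.+-identityˡ (+ 2 * m))
  step false true  m = ℤP.+-identityˡ _
  step false false m = ℤP.+-identityˡ _

sumℤ-range1 : ∀ (g : ℕ → ℤ) n → sumℤ (map g (range1 n)) ≡ ∑.sum n (g ∘ suc)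
sumℤ-range1 g n = trans (cong sumℤ (sym (LP.map-∘ (upTo n)))) (go (g ∘ suc) id n)
  where
  go : ∀ (g : ℕ → ℤ) f n → sumℤ (map g (applyUpTo f n)) ≡ ∑.sum n (g ∘ f)
  go g f zero    = refl
  go g f (suc n) = cong (λ z → g (f 0) + z) (go g (f ∘ suc) n)

findFirst-true : ∀ (P : ℕ → Bool) {xs x} → x ∈ xs → P x ≡ true → P (findFirst P xs) ≡ true
findFirst-true P {y ∷ ys} i Px with P y in Py
... | true = Py
findFirst-true P {y ∷ ys} (here refl) Px | false = true≢false Px Py
findFirst-true P {y ∷ ys} (there i)   Px | false = findFirst-true P i Px

-- Contribution of the roots 0, -1 and -5 of x (x + 1) (x + 5); e and s are the bits of -1 and 5.
weight : Bool → Bool → ℤ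
weight b r = 1ℤ + sgn b * sgn r

K : Bool → Bool → Bool → Bool → Bool → ℤ
K b₁ b₂ b₃ e s = weight b₂ false * weight b₃ s + (weight b₁ e * weight b₃ false + weight b₁ (e xor s) * weight b₂ e)

-- The three products of two different characters in the expansion of ∏ (1 + σ χ) each sum to -1
-- over x; together they contribute `- L`.
L : Bool → Bool → Bool → ℤ
L b₁ b₂ b₃ = sgn b₁ * sgn b₂ + (sgn b₁ * sgn b₃ + sgn b₂ * sgn b₃)

%ℕ-cong : ∀ a b k m .{{_ : ℕ.NonZero m}} → a - b ≡ k * + m → a %ℕ m ≡ b %ℕ m
%ℕ-cong a b k m eq = remainder-unique (k - a /ℕ m + b /ℕ m) (n%ℕd<d a m) (n%ℕd<d b m)
    (trans (lem (+ (a %ℕ m)) (+ (b %ℕ m)) (a /ℕ m) (b /ℕ m) (+ m))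
      (trans (cong₂ (λ x y → x - y - (a /ℕ m) * + m + (b /ℕ m) * + m) (sym (a≡a%ℕn+[a/ℕn]*n a m)) (sym (a≡a%ℕn+[a/ℕn]*n b m)))
        (trans (cong (λ z → z - (a /ℕ m) * + m + (b /ℕ m) * + m) eq) (lem′ k (a /ℕ m) (b /ℕ m) (+ m)))))
  where
  lem : ∀ r r′ q q′ m → r - r′ ≡ (r + q * m) - (r′ + q′ * m) - q * m + q′ * m
  lem = solve-∀
  lem′ : ∀ k q q′ m → k * m - q * m + q′ * m ≡ (k - q + q′) * m
  lem′ = solve-∀

odd-+ : ∀ m n → odd (m ℕ.+ n) ≡ odd m xor odd n
odd-+ zero    n = refl
odd-+ (suc m) n = trans (cong not (odd-+ m n)) (lem (odd m) (odd n))
  where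
  lem : ∀ a b → not (a xor b) ≡ not a xor b
  lem true  b = BP.not-involutive b
  lem false b = refl

shift-periodic : ∀ {X : Set} (f : ℕ → X) m → (∀ n → f (m ℕ.+ n) ≡ f n) → ∀ q n → f (n ℕ.+ q ℕ.* m) ≡ f n
shift-periodic f m e zero    n = cong f (ℕP.+-identityʳ n)
shift-periodic f m e (suc q) n = trans (cong f (lem n m (q ℕ.* m))) (trans (e (n ℕ.+ q ℕ.* m)) (shift-periodic f m e q n))
  where
  lem : ∀ n m k → n ℕ.+ (m ℕ.+ k) ≡ m ℕ.+ (n ℕ.+ k)
  lem n m k = trans (sym (ℕP.+-assoc n m k)) (trans (cong (ℕ._+ k) (ℕP.+-comm n m)) (ℕP.+-assoc m n k))

odd⇒suc≡2⌈/2⌉ : ∀ h → odd h ≡ true → suc h ≡ 2 ℕ.* ⌈ h /2⌉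
odd⇒suc≡2⌈/2⌉ 1             _ = refl
odd⇒suc≡2⌈/2⌉ (suc (suc h)) o = trans (cong (suc ∘ suc) (odd⇒suc≡2⌈/2⌉ h (trans (sym (BP.not-involutive (odd h))) o)))
  (sym (cong suc (ℕP.+-suc ⌈ h /2⌉ (⌈ h /2⌉ ℕ.+ 0))))

2⌊/2⌋≤ : ∀ h → 2 ℕ.* ⌊ h /2⌋ ≤ h
2⌊/2⌋≤ h = subst (_≤ h) (cong (⌊ h /2⌋ ℕ.+_) (sym (ℕP.+-identityʳ ⌊ h /2⌋)))
  (subst (⌊ h /2⌋ ℕ.+ ⌊ h /2⌋ ≤_) (ℕP.⌊n/2⌋+⌈n/2⌉≡n h) (ℕP.+-monoʳ-≤ ⌊ h /2⌋ (ℕP.⌊n/2⌋≤⌈n/2⌉ h)))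

<2+2⌊/2⌋ : ∀ h → h < 2 ℕ.* suc ⌊ h /2⌋
<2+2⌊/2⌋ zero          = s≤s z≤n
<2+2⌊/2⌋ (suc zero)    = s≤s (s≤s z≤n)
<2+2⌊/2⌋ (suc (suc h)) = ℕP.≤-trans (s≤s (s≤s (<2+2⌊/2⌋ h))) (ℕP.≤-reflexive (cong suc (sym (ℕP.+-suc (suc ⌊ h /2⌋) (suc ⌊ h /2⌋ ℕ.+ 0)))))

-- Only meaningful at 1, 3, 7 and 9.
unit : ℕ → Unit10
unit 1 = u1
unit 3 = u3
unit 7 = u7
unit _ = u9

-- Bits of -1, 2 and 5 for a prime p > 5, in terms of c = p mod 80.
minus-one-nonsquare two-nonsquare five-nonsquare : ℕ → Bool
minus-one-nonsquare c = odd (half c)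
two-nonsquare c = odd ⌈ half c /2⌉
five-nonsquare c = five-bit (unit (c % 10))

-- Parity of the number of x with x, x + 1 and x + 5 nonzero squares; the arguments are the bits of -1, 5, 2 and p mod 10.
square-parity : Bool → Bool → Bool → Unit10 → Bool
square-parity false s     t u = s
square-parity true  false t u = t xor isNine u
square-parity true  true  t u = t xor isThree u

N₀ : ℕ → Bool
N₀ c = square-parity (minus-one-nonsquare c) (five-nonsquare c) (two-nonsquare c) (unit (c % 10))

-- The relation `8 · count + K = p - 3 + F` for three squares, solved for F modulo 16; there `count`
-- may be replaced by its parity `N₀`. The 3 is `L false false false`.
trace₁₆ : ℕ → ℤ
trace₁₆ c = + 8 * ⟦ N₀ c ⟧ + K false false false (minus-one-nonsquare c) (five-nonsquare c) + + 3 - + (c % 16)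

-- The same relation for prescribed symbols, solved for 8 · count: modulo 16 this is 8 or 0
-- according to the parity of the count.
pattern₁₆ : Bool → Bool → Bool → ℕ → Bool
pattern₁₆ b₁ b₂ b₃ c =
  (+ (c % 16) - L b₁ b₂ b₃ - K b₁ b₂ b₃ (minus-one-nonsquare c) (five-nonsquare c) + sgn b₁ * (sgn b₂ * sgn b₃) * trace₁₆ c) %ℕ 16 ≡ᵇ 8

pattern₁₆′ : Bool × Bool × Bool → ℕ → Bool
pattern₁₆′ (b₁ , b₂ , b₃) = pattern₁₆ b₁ b₂ b₃

-- For -1 a nonsquare this is the right side of `difference-parity≡`, where the bit of -2 is
-- `not t`; for -1 a square it is the outcome of `Square-residue`.
square-product : Bool → Bool → Bool → Bool → Bool
square-product e s t n = if e then not (n xor (not s ∧ not t)) else t ∧ s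

-- Fp01 p n = ± Fp01 p 5; the sign depends on the bits e and s of -1 and 5.
twist : ∀ {n} → n ∈ valuesI → Bool → Bool → Bool
twist (here _) e s = false
twist (there (here _)) e s = e
twist (there (there (here _))) e s = s xor false
twist (there (there (there (here _)))) e s = s xor e
twist (there (there (there (there (here _))))) e s = e
twist (there (there (there (there (there (here _)))))) e s = false

-- The symbols of x, x + 1 and x + 5 in the count whose parity gives the product of f.
form-pattern : ∀ {f} → f ∈ formsII → Bool → Bool → Bool × Bool × Bool
form-pattern (here _) e s = e xor false , not e xor false , not e xor false
form-pattern (there (here _)) e s = e xor e , not e xor e , not e xor e
form-pattern (there (there (here _))) e s = e xor false , not e xor false , not e xor false
form-pattern (there (there (there (here _)))) e s = not e xor (s xor false) , e xor false , not e xor (s xor false)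
form-pattern (there (there (there (there (here _))))) e s = not e xor (s xor e) , e xor e , not e xor (s xor e)
form-pattern (there (there (there (there (there (here _)))))) e s = e xor false , not e xor false , not e xor false
form-pattern (there (there (there (there (there (there (here _))))))) e s = e xor false , not e xor e , not e xor e

-- Congruence modulo a prime p > 5

module Modulo (p : ℕ) (pr : Prime p) (5<p : 5 < p) where

  not-divisible : ∀ d → 1 < d → d < p → ¬ (d ℕD.∣ p)
  not-divisible d 1<d d<p d∣p = [ (λ e → ℕP.<⇒≢ 1<d (sym e)) , ℕP.<⇒≢ d<p ]′ (prime⇒irreducible pr d∣p)

  2∤p : ¬ (2 ℕD.∣ p)
  2∤p = not-divisible 2 (s≤s (s≤s z≤n)) (ℕP.<-trans (s≤s (s≤s (s≤s z≤n))) 5<p)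

  5∤p : ¬ (5 ℕD.∣ p)
  5∤p = not-divisible 5 (s≤s (s≤s z≤n)) 5<p

  opaque
    -- Opaque, so that the division is never unfolded: outside this block h is known through
    -- `p = 2 h + 1`.
    h : ℕ
    h = p / 2

    p≡ : p ≡ suc (h ℕ.+ h)
    p≡ = trans (ℕDM.m≡m%n+[m/n]*n p 2) (cong₂ ℕ._+_ (remainder (p % 2) refl (ℕDM.m%n<n p 2)) (trans (ℕP.*-comm h 2) (cong (h ℕ.+_) (ℕP.+-identityʳ h))))
      where
      remainder : ∀ r → p % 2 ≡ r → r < 2 → p % 2 ≡ 1
      remainder 0 e _ = ⊥-elim (2∤p (ℕD.m%n≡0⇒n∣m p 2 e))
      remainder 1 e _ = e
      remainder (suc (suc _)) e (s≤s (s≤s ()))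

  instance
    p≢0 : ℕ.NonZero p
    p≢0 = prime⇒nonZero pr

  infix 4 _≈_ _≉_
  -- A record rather than an abbreviation for an equation in ℤ, so that a and b can be inferred from
  -- the type of a congruence.
  record _≈_ (a b : ℤ) : Set where
    constructor mk
    field k : ℤ
          eq : a - b ≡ k * + p

  _≉_ : ℤ → ℤ → Set
  a ≉ b = ¬ (a ≈ b)

  -- The general way of deriving one congruence from another: once the cofactor e is found, what
  -- remains is a polynomial identity over ℤ for the ring solver. `combination₂` and `combination₃`
  -- do the same with several congruences.
  combination₁ : ∀ {a b c d} e → c ≈ d → a - b ≡ e * (c - d) → a ≈ b
  combination₁ e (mk k eq) q = mk (e * k) (trans q (trans (cong (e *_) eq) (sym (ℤP.*-assoc e k (+ p)))))

  combination₂ : ∀ {a b c d c′ d′} e e′ → c ≈ d → c′ ≈ d′ →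
                 a - b ≡ e * (c - d) + e′ * (c′ - d′) → a ≈ b
  combination₂ e e′ (mk k eq) (mk k′ eq′) q =
    mk (e * k + e′ * k′) (trans q (trans (cong₂ (λ x y → e * x + e′ * y) eq eq′) (lem e k e′ k′ (+ p))))
    where
    lem : ∀ e k e′ k′ q → e * (k * q) + e′ * (k′ * q) ≡ (e * k + e′ * k′) * q
    lem = solve-∀

  ≈-refl : ∀ {a} → a ≈ a
  ≈-refl {a} = mk 0ℤ (ℤP.+-inverseʳ a)

  ≡⇒≈ : ∀ {a b} → a ≡ b → a ≈ b
  ≡⇒≈ refl = ≈-refl

  ≈-sym : ∀ {a b} → a ≈ b → b ≈ a
  ≈-sym {a} {b} e = combination₁ (- 1ℤ) e (lem a b)
    where
    lem : ∀ a b → b - a ≡ - 1ℤ * (a - b)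
    lem = solve-∀

  ≈-trans : ∀ {a b c} → a ≈ b → b ≈ c → a ≈ c
  ≈-trans {a} {b} {c} e f = combination₂ 1ℤ 1ℤ e f (lem a b c)
    where
    lem : ∀ a b c → a - c ≡ 1ℤ * (a - b) + 1ℤ * (b - c)
    lem = solve-∀

  +-cong : ∀ {a b c d} → a ≈ b → c ≈ d → a + c ≈ b + d
  +-cong {a} {b} {c} {d} e f = combination₂ 1ℤ 1ℤ e f (lem a b c d)
    where
    lem : ∀ a b c d → (a + c) - (b + d) ≡ 1ℤ * (a - b) + 1ℤ * (c - d)
    lem = solve-∀

  *-cong : ∀ {a b c d} → a ≈ b → c ≈ d → a * c ≈ b * d
  *-cong {a} {b} {c} {d} e f = combination₂ c b e f (lem a b c d)
    where
    lem : ∀ a b c d → a * c - b * d ≡ c * (a - b) + b * (c - d)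
    lem = solve-∀

  neg-cong : ∀ {a b} → a ≈ b → - a ≈ - b
  neg-cong {a} {b} e = combination₁ (- 1ℤ) e (lem a b)
    where
    lem : ∀ a b → - a - - b ≡ - 1ℤ * (a - b)
    lem = solve-∀

  sub-cong : ∀ {a b c d} → a ≈ b → c ≈ d → a - c ≈ b - d
  sub-cong e f = +-cong e (neg-cong f)

  p≈0 : + p ≈ 0ℤ
  p≈0 = mk 1ℤ (lem (+ p))
    where
    lem : ∀ q → q - 0ℤ ≡ 1ℤ * q
    lem = solve-∀

  ∣⇒≈0 : ∀ {a} → p ℕD.∣ ∣ a ∣ → a ≈ 0ℤ
  ∣⇒≈0 {a} d with ℤS.∣ᵤ⇒∣ {+ p} {a} d
  ... | ℤS.divides q eq = mk q (trans (ℤP.+-identityʳ a) eq)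

  ≈0⇒∣ : ∀ {a} → a ≈ 0ℤ → p ℕD.∣ ∣ a ∣
  ≈0⇒∣ {a} (mk k eq) = ℤS.∣⇒∣ᵤ {+ p} {a} (ℤS.divides k (trans (sym (ℤP.+-identityʳ a)) eq))

  sub≈0 : ∀ {a b} → a ≈ b → a - b ≈ 0ℤ
  sub≈0 {a} {b} e = combination₁ 1ℤ e (lem a b)
    where
    lem : ∀ a b → (a - b) - 0ℤ ≡ 1ℤ * (a - b)
    lem = solve-∀

  sub≈0⁻ : ∀ {a b} → a - b ≈ 0ℤ → a ≈ b
  sub≈0⁻ {a} {b} e = combination₁ 1ℤ e (lem a b)
    where
    lem : ∀ a b → a - b ≡ 1ℤ * ((a - b) - 0ℤ)
    lem = solve-∀

  red : ℤ → ℕ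
  red a = modp a p

  modp-%ℕ : ∀ a m .{{_ : ℕ.NonZero m}} → modp a m ≡ a %ℕ m
  modp-%ℕ a (suc m) = refl

  red-< : ∀ a → red a < p
  red-< a = subst (_< p) (sym (modp-%ℕ a p)) (n%ℕd<d a p)

  red-≈ : ∀ a → + red a ≈ a
  red-≈ a = ≈-trans (≡⇒≈ (cong +_ (modp-%ℕ a p)))
    (≈-sym (mk (a /ℕ p) (trans (cong (_- + (a %ℕ p)) (a≡a%ℕn+[a/ℕn]*n a p)) (lem (+ (a %ℕ p)) (a /ℕ p * + p)))))
    where
    lem : ∀ r s → (r + s) - r ≡ s
    lem = solve-∀

  red-small : ∀ {n} → n < p → red (+ n) ≡ n
  red-small {n} n<p = trans (modp-%ℕ (+ n) p) (ℕDM.m<n⇒m%n≡m n<p)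

  residue-unique : ∀ {m n} → m < p → n < p → + m ≈ + n → m ≡ n
  residue-unique m<p n<p (mk k eq) = remainder-unique k m<p n<p eq

  red-cong : ∀ {a b} → a ≈ b → red a ≡ red b
  red-cong {a} {b} e = residue-unique (red-< a) (red-< b) (≈-trans (red-≈ a) (≈-trans e (≈-sym (red-≈ b))))

  red-injective : ∀ {a b} → red a ≡ red b → a ≈ b
  red-injective {a} {b} e = ≈-trans (≈-sym (red-≈ a)) (≈-trans (≡⇒≈ (cong +_ e)) (red-≈ b))

  1<p : 1 < p
  1<p = ℕ.nonTrivial⇒n>1 p {{prime⇒nonTrivial pr}}

  opaque
    Z : ℤ → Bool
    Z a = divb p a

    Z-divb : ∀ a → divb p a ≡ Z a
    Z-divb a = refl

    Z-red : ∀ a → Z a ≡ (red a ≡ᵇ 0)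
    Z-red a = refl

  red-0 : red 0ℤ ≡ 0
  red-0 = red-small (ℕP.<-trans (s≤s z≤n) 1<p)

  Z-true : ∀ {a} → Z a ≡ true → a ≈ 0ℤ
  Z-true {a} e = red-injective (trans (≡ᵇ-sound (red a) 0 (trans (sym (Z-red a)) e)) (sym red-0))

  Z-intro : ∀ {a} → a ≈ 0ℤ → Z a ≡ true
  Z-intro {a} e = trans (Z-red a) (cong (_≡ᵇ 0) (trans (red-cong e) red-0))

  Z-false : ∀ {a} → Z a ≡ false → a ≉ 0ℤ
  Z-false {a} e z = true≢false (Z-intro z) e

  Z-intro-false : ∀ {a} → a ≉ 0ℤ → Z a ≡ false
  Z-intro-false {a} n with Z a in eq
  ... | true  = ⊥-elim (n (Z-true eq))
  ... | false = refl

  Z-cong : ∀ {a b} → a ≈ b → Z a ≡ Z b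
  Z-cong {a} {b} e = trans (Z-red a) (trans (cong (_≡ᵇ 0) (red-cong e)) (sym (Z-red b)))

  zero? : ∀ a → (a ≈ 0ℤ) ⊎ (a ≉ 0ℤ)
  zero? a with Z a in eq
  ... | true  = inj₁ (Z-true eq)
  ... | false = inj₂ (Z-false eq)

  eq? : ∀ a b → (a ≈ b) ⊎ (a ≉ b)
  eq? a b with zero? (a - b)
  ... | inj₁ e = inj₁ (sub≈0⁻ e)
  ... | inj₂ n = inj₂ λ e → n (sub≈0 e)

  *-zero : ∀ {a b} → a * b ≈ 0ℤ → (a ≈ 0ℤ) ⊎ (b ≈ 0ℤ)
  *-zero {a} {b} e with euclidsLemma ∣ a ∣ ∣ b ∣ pr (subst (p ℕD.∣_) (ℤP.abs-* a b) (≈0⇒∣ e))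
  ... | inj₁ d = inj₁ (∣⇒≈0 d)
  ... | inj₂ d = inj₂ (∣⇒≈0 d)

  *-nonzero : ∀ {a b} → a ≉ 0ℤ → b ≉ 0ℤ → a * b ≉ 0ℤ
  *-nonzero a≉0 b≉0 e with *-zero e
  ... | inj₁ z = a≉0 z
  ... | inj₂ z = b≉0 z

  nonzero-cong : ∀ {a b} → a ≈ b → a ≉ 0ℤ → b ≉ 0ℤ
  nonzero-cong e n z = n (≈-trans e z)

  factorˡ≉0 : ∀ {a b} → a * b ≉ 0ℤ → a ≉ 0ℤ
  factorˡ≉0 {a} {b} n z = n (combination₁ b z (lem a b))
    where
    lem : ∀ a b → a * b - 0ℤ ≡ b * (a - 0ℤ)
    lem = solve-∀

  factorʳ≉0 : ∀ {a b} → a * b ≉ 0ℤ → b ≉ 0ℤ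
  factorʳ≉0 {a} {b} n = factorˡ≉0 (subst (_≉ 0ℤ) (ℤP.*-comm a b) n)

  cancelˡ : ∀ c {a b} → c ≉ 0ℤ → c * a ≈ c * b → a ≈ b
  cancelˡ c {a} {b} c≉0 e =
    [ ⊥-elim ∘ c≉0 , sub≈0⁻ ]′ (*-zero {c} {a - b} (≈-trans (≡⇒≈ (lem c a b)) (sub≈0 e)))
    where
    lem : ∀ c a b → c * (a - b) ≡ c * a - c * b
    lem = solve-∀

  nat≉0 : ∀ {n} → 0 < n → n < p → + n ≉ 0ℤ
  nat≉0 0<n n<p e = ℕP.<⇒≢ 0<n (sym (residue-unique n<p (ℕP.<-trans 0<n n<p) e))

  1≉0 : 1ℤ ≉ 0ℤ
  1≉0 = nat≉0 (s≤s z≤n) 1<p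

  opaque
    bezout : ∀ n → 0 < n → n < p → Σ ℤ λ b → + n * b ≈ 1ℤ
    bezout n@(suc _) _ n<p with coprime-Bézout (prime⇒coprime pr n<p)
    ... | Bézout.+- x y eq = - + y , mk (- + x) (trans (lem (+ n) (+ y))
             (trans (cong -_ (trans (cong (λ z → + 1 + z) (sym (ℤP.pos-* y n))) (trans (cong +_ eq) (ℤP.pos-* x p)))) (lem′ (+ x) (+ p))))
      where
      lem : ∀ n y → n * (- y) - + 1 ≡ - (+ 1 + y * n)
      lem = solve-∀
      lem′ : ∀ x q → - (x * q) ≡ (- x) * q
      lem′ = solve-∀
    ... | Bézout.-+ x y eq = + y , mk (+ x) (trans (cong (_- + 1) (trans (ℤP.*-comm (+ n) (+ y))
             (trans (sym (ℤP.pos-* y n)) (trans (cong +_ (sym eq)) (cong (λ z → + 1 + z) (ℤP.pos-* x p)))))) (lem (+ x) (+ p)))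
      where
      lem : ∀ x q → (+ 1 + x * q) - + 1 ≡ x * q
      lem = solve-∀

    -- inv 0 = 0, which makes x ↦ c * inv x a total involution.
    inv : ℤ → ℤ
    inv a with red a ℕ.≟ 0
    ... | yes _ = 0ℤ
    ... | no  n = proj₁ (bezout (red a) (ℕP.n≢0⇒n>0 n) (red-< a))

    inv-0 : ∀ {a} → a ≈ 0ℤ → inv a ≡ 0ℤ
    inv-0 {a} e with red a ℕ.≟ 0
    ... | yes _ = refl
    ... | no  n = ⊥-elim (n (trans (red-cong e) red-0))

    *-inv : ∀ {a} → a ≉ 0ℤ → a * inv a ≈ 1ℤ
    *-inv {a} a≉0 with red a ℕ.≟ 0
    ... | yes z = ⊥-elim (a≉0 (red-injective (trans z (sym red-0))))
    ... | no  n = ≈-trans (*-cong (≈-sym (red-≈ a)) ≈-refl) (proj₂ (bezout (red a) (ℕP.n≢0⇒n>0 n) (red-< a)))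

  inv-unique : ∀ {a b} → a * b ≈ 1ℤ → b ≈ inv a
  inv-unique {a} {b} e = cancelˡ a a≉0 (≈-trans e (≈-sym (*-inv a≉0)))
    where
    a≉0 : a ≉ 0ℤ
    a≉0 = factorˡ≉0 {a} {b} (nonzero-cong (≈-sym e) 1≉0)

  inv-cong : ∀ {a b} → a ≈ b → inv a ≈ inv b
  inv-cong {a} {b} e with zero? a
  ... | inj₁ z = ≡⇒≈ (trans (inv-0 z) (sym (inv-0 (≈-trans (≈-sym e) z))))
  ... | inj₂ n = inv-unique (≈-trans (*-cong (≈-sym e) ≈-refl) (*-inv n))

  inv≉0 : ∀ {a} → a ≉ 0ℤ → inv a ≉ 0ℤ
  inv≉0 {a} n = factorʳ≉0 {a} (nonzero-cong (≈-sym (*-inv n)) 1≉0)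

  inv-inv : ∀ a → inv (inv a) ≈ a
  inv-inv a with zero? a
  ... | inj₁ z = ≈-trans (≡⇒≈ (inv-0 (≡⇒≈ (inv-0 z)))) (≈-sym z)
  ... | inj₂ n = ≈-sym (inv-unique (≈-trans (≡⇒≈ (ℤP.*-comm (inv a) a)) (*-inv n)))

  -- Squares

  opaque
    sq : ℤ → Bool
    sq a = isSquareMod p a

    sq-isSquareMod : ∀ a → isSquareMod p a ≡ sq a
    sq-isSquareMod a = refl

    sq-true : ∀ {a} → sq a ≡ true → ∃ λ x → x * x ≈ a
    sq-true {a} e with satisfied (AnyP.any⁻ _ (upTo p) (≡⇒T e))
    ... | x , t = + x , sub≈0⁻ (Z-true (trans (sym (Z-divb _)) (T⇒≡ t)))

    sq-intro : ∀ {a} x → x * x ≈ a → sq a ≡ true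
    sq-intro {a} x e = T⇒≡ (AnyP.any⁺ (λ y → divb p ((+ y) * (+ y) - a)) (lose (∈-upTo⁺ (red-< x))
      (≡⇒T (trans (Z-divb _) (Z-intro (sub≈0 (≈-trans (*-cong (red-≈ x) (red-≈ x)) e)))))))

  sq-cong : ∀ {a b} → a ≈ b → sq a ≡ sq b
  sq-cong {a} {b} e = bool-ext (λ s → let x , x²≈ = sq-true s in sq-intro x (≈-trans x²≈ e))
                               (λ s → let x , x²≈ = sq-true s in sq-intro x (≈-trans x²≈ (≈-sym e)))

  -- Nonzero squares and nonsquares modulo p; both exclude 0.
  Q R : ℤ → Bool
  Q a = not (Z a) ∧ sq a
  R a = not (Z a) ∧ not (sq a)

  Q-cong : ∀ {a b} → a ≈ b → Q a ≡ Q b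
  Q-cong e = cong₂ (λ z s → not z ∧ s) (Z-cong e) (sq-cong e)

  R-cong : ∀ {a b} → a ≈ b → R a ≡ R b
  R-cong e = cong₂ (λ z s → not z ∧ not s) (Z-cong e) (sq-cong e)

  Q-intro : ∀ {a} x → a ≉ 0ℤ → x * x ≈ a → Q a ≡ true
  Q-intro x n e = ∧-intro (cong not (Z-intro-false n)) (sq-intro x e)

  Q-true : ∀ {a} → Q a ≡ true → a ≉ 0ℤ × ∃ λ x → x * x ≈ a
  Q-true {a} e with Z a in z | sq a in s
  Q-true {a} e | false | true = Z-false z , sq-true s

  R-0 : ∀ {a} → a ≈ 0ℤ → R a ≡ false
  R-0 {a} e = cong (λ z → not z ∧ not (sq a)) (Z-intro e)

  Q-0 : ∀ {a} → a ≈ 0ℤ → Q a ≡ false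
  Q-0 {a} e = cong (λ z → not z ∧ sq a) (Z-intro e)

  Q-notR : ∀ {a} → a ≉ 0ℤ → Q a ≡ not (R a)
  Q-notR {a} n rewrite Z-intro-false n with sq a
  ... | true  = refl
  ... | false = refl

  R-square : ∀ x → R (x * x) ≡ false
  R-square x with zero? (x * x)
  ... | inj₁ z = R-0 z
  ... | inj₂ n = cong₂ (λ z s → not z ∧ not s) (Z-intro-false n) (sq-intro x ≈-refl)

  module ModSums {A : Set} (_∙_ : A → A → A) (ε : A) (isCM : IsCommutativeMonoid _≡_ _∙_ ε) where
    open Sums _∙_ ε isCM public

    S : (ℤ → A) → A
    S f = sum p (λ i → f (+ i))

    -- Functions on ℤ/p are functions on ℤ that respect `≈`, hence the first four hypotheses; `red`
    -- brings the values of `π` back to 0, ..., p - 1, where `sum-bij` applies.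
    S-bij : ∀ {c q : ℤ → Bool} {π : ℤ → ℤ} {g : ℤ → A} →
            (∀ {a b} → a ≈ b → c a ≡ c b) → (∀ {a b} → a ≈ b → q a ≡ q b) →
            (∀ {a b} → a ≈ b → π a ≈ π b) → (∀ {a b} → a ≈ b → g a ≡ g b) →
            (∀ t → c t ≡ true → q (π t) ≡ true) →
            (∀ d → q d ≡ true → ∃ λ t → c t ≡ true × π t ≈ d) →
            (∀ t t′ → c t ≡ true → c t′ ≡ true → π t ≈ π t′ → t ≈ t′) →
            S (λ t → c t ▸ g (π t)) ≡ S (λ d → q d ▸ g d)
    S-bij {c} {q} {π} {g} c≈ q≈ π≈ g≈ into onto inj =
      trans (sum-cong p (λ i _ → ▸-cong (c (+ i)) λ _ → g≈ (≈-sym (red-≈ (π (+ i))))))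
        (sum-bij p p (λ i → c (+ i)) (λ j → q (+ j)) (λ i → red (π (+ i)))
          (λ i _ ci → red-< _ , trans (q≈ (red-≈ _)) (into (+ i) ci))
          (λ j j<p dj → let t , ct , e = onto (+ j) dj in
             red t , red-< t , trans (c≈ (red-≈ t)) ct ,
             trans (red-cong (≈-trans (π≈ (red-≈ t)) e)) (red-small j<p))
          (λ i i′ i<p i′<p ci ci′ e → residue-unique i<p i′<p (inj _ _ ci ci′ (red-injective e)))
          (λ j → g (+ j)))

    S-perm : ∀ {π : ℤ → ℤ} {g : ℤ → A} →
             (∀ {a b} → a ≈ b → π a ≈ π b) → (∀ {a b} → a ≈ b → g a ≡ g b) →
             (ρ : ℤ → ℤ) → (∀ d → π (ρ d) ≈ d) → (∀ {t t′} → π t ≈ π t′ → t ≈ t′) →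
             S (λ t → g (π t)) ≡ S g
    S-perm π≈ g≈ ρ πρ inj = S-bij {c = λ _ → true} {q = λ _ → true} (λ _ → refl) (λ _ → refl) π≈ g≈
      (λ _ _ → refl) (λ d _ → ρ d , refl , πρ d) (λ _ _ _ _ → inj)

  module XS = ModSums _xor_ false xor-isCM
  module PS = ModSums _*_ 1ℤ ℤP.*-1-isCommutativeMonoid

  ∏-≈ : ∀ n {f g} → (∀ i → i < n → f i ≈ g i) → ∏.sum n f ≈ ∏.sum n g
  ∏-≈ zero    e = ≈-refl
  ∏-≈ (suc n) e = *-cong (e 0 (s≤s z≤n)) (∏-≈ n λ i i<n → e (suc i) (s≤s i<n))

  ∏-nonzero : ∀ n {f} → (∀ i → i < n → f i ≉ 0ℤ) → ∏.sum n f ≉ 0ℤ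
  ∏-nonzero zero    e = 1≉0
  ∏-nonzero (suc n) {f} e = *-nonzero {f 0} {∏.sum n (f ∘ suc)} (e 0 (s≤s z≤n)) (∏-nonzero n λ i i<n → e (suc i) (s≤s i<n))

  ∏-zero : ∀ n {f} → ∏.sum n f ≈ 0ℤ → ∃ λ i → i < n × f i ≈ 0ℤ
  ∏-zero zero    e = ⊥-elim (1≉0 e)
  ∏-zero (suc n) {f} e with *-zero {f 0} {∏.sum n (f ∘ suc)} e
  ... | inj₁ z = 0 , s≤s z≤n , z
  ... | inj₂ z = let i , i<n , z′ = ∏-zero n z in suc i , s≤s i<n , z′

  -- Splitting off X - r 0 leaves a monic quotient of degree one less. The other roots annihilate it
  -- because they differ from r 0 and ℤ/p has no zero divisors. It serves for X^h - 1 in Euler's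
  -- criterion and again for a Lucas polynomial.
  vieta : ∀ n cs (r : ℕ → ℤ) → length cs ≡ n → (∀ i → i < n → eval cs (r i) ≈ 0ℤ) →
          (∀ i j → i < j → j < n → r i ≉ r j) → ∀ x → eval cs x ≈ ∏.sum n (λ i → x - r i)
  vieta zero    []       r _ _ _ x = ≈-refl
  vieta (suc n) (c ∷ cs) r len roots distinct x =
    ≈-trans (factor x)
      (*-cong {x - r 0} ≈-refl
        (vieta n (quotient cs (r 0)) (r ∘ suc)
          (trans (length-quotient cs (r 0)) (ℕP.suc-injective len))
          (λ i i<n → [ (λ z → ⊥-elim (distinct 0 (suc i) (s≤s z≤n) (s≤s i<n) (≈-sym (sub≈0⁻ z)))) , id ]′
                       (*-zero {r (suc i) - r 0} (≈-trans (≈-sym (factor (r (suc i)))) (roots (suc i) (s≤s i<n)))))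
          (λ i j i<j j<n → distinct (suc i) (suc j) (s≤s i<j) (s≤s j<n)) x))
    where
    factor : ∀ x → eval (c ∷ cs) x ≈ (x - r 0) * eval (quotient cs (r 0)) x
    factor x = combination₁ 1ℤ (roots 0 (s≤s z≤n)) (lem (eval (c ∷ cs) x) _ (eval (c ∷ cs) (r 0)) (eval-factor c cs (r 0) x))
      where
      lem′ : ∀ e g f → e - g ≡ (e - f) - g + f
      lem′ = solve-∀
      lem″ : ∀ g f → g - g + f ≡ 1ℤ * (f - 0ℤ)
      lem″ = solve-∀
      lem : ∀ e g f → e - f ≡ g → e - g ≡ 1ℤ * (f - 0ℤ)
      lem e g f eq = trans (lem′ e g f) (trans (cong (λ z → z - g + f) eq) (lem″ g f))

  -- Gauss's lemma and Euler's criterion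

  h<p : h < p
  h<p = subst (h <_) (sym p≡) (s≤s (ℕP.m≤m+n h h))

  0<h : 0 < h
  0<h = lem h p≡
    where
    lem : ∀ k → p ≡ suc (k ℕ.+ k) → 0 < k
    lem zero    e = ⊥-elim (ℕP.<-irrefl (sym e) 1<p)
    lem (suc k) e = s≤s z≤n

  2<p : 2 < p
  2<p = subst (2 <_) (sym p≡) (s≤s (ℕP.+-mono-≤ 0<h 0<h))

  2≉0 : + 2 ≉ 0ℤ
  2≉0 = nat≉0 (s≤s z≤n) 2<p

  1≉-1 : 1ℤ ≉ -1ℤ
  1≉-1 e = 2≉0 (combination₁ 1ℤ e refl)

  neg≉0 : ∀ {a} → a ≉ 0ℤ → - a ≉ 0ℤ
  neg≉0 {a} n z = n (combination₁ -1ℤ z (lem a))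
    where
    lem : ∀ a → a - 0ℤ ≡ -1ℤ * (- a - 0ℤ)
    lem = solve-∀

  sgn≉0 : ∀ b → sgn b ≉ 0ℤ
  sgn≉0 true  = neg≉0 {1ℤ} 1≉0
  sgn≉0 false = 1≉0

  sgn-injective : ∀ {a b} → sgn a ≈ sgn b → a ≡ b
  sgn-injective {true}  {true}  e = refl
  sgn-injective {true}  {false} e = ⊥-elim (1≉-1 (≈-sym e))
  sgn-injective {false} {true}  e = ⊥-elim (1≉-1 e)
  sgn-injective {false} {false} e = refl

  ^-cong : ∀ {a b} n → a ≈ b → a ^ n ≈ b ^ n
  ^-cong zero    e = ≈-refl
  ^-cong (suc n) e = *-cong e (^-cong n e)

  -- The residues 1, …, h represent the nonzero classes up to sign.

  hi low : ℤ → Bool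
  hi  a = h <ᵇ red a
  low a = not (red a ≡ᵇ 0) ∧ not (hi a)

  hi-cong : ∀ {a b} → a ≈ b → hi a ≡ hi b
  hi-cong e = cong (h <ᵇ_) (red-cong e)

  low-cong : ∀ {a b} → a ≈ b → low a ≡ low b
  low-cong e = cong (λ r → not (r ≡ᵇ 0) ∧ not (h <ᵇ r)) (red-cong e)

  low≉0 : ∀ {a} → low a ≡ true → a ≉ 0ℤ
  low≉0 {a} l z = true≢false l (cong (λ r → not (r ≡ᵇ 0) ∧ not (h <ᵇ r)) (trans (red-cong z) red-0))

  red≢0 : ∀ {a} → a ≉ 0ℤ → (red a ≡ᵇ 0) ≡ false
  red≢0 {a} n = trans (sym (Z-red a)) (Z-intro-false n)

  low-hi : ∀ {a} → a ≉ 0ℤ → low a ≡ not (hi a)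
  low-hi {a} n = cong (λ b → not b ∧ not (hi a)) (red≢0 n)

  0<red : ∀ {a} → a ≉ 0ℤ → 0 < red a
  0<red {a} n = ℕP.n≢0⇒n>0 λ z → n (red-injective (trans z (sym red-0)))

  red-neg : ∀ {a} → a ≉ 0ℤ → red (- a) ≡ p ℕ.∸ red a
  red-neg {a} n = trans (red-cong e) (red-small (ℕP.∸-monoʳ-< {p} (0<red n) (ℕP.<⇒≤ (red-< a))))
    where
    lem : ∀ q r → - r - (q - r) ≡ -1ℤ * (q - 0ℤ)
    lem = solve-∀
    e : - a ≈ + (p ℕ.∸ red a)
    e = ≈-trans (neg-cong (≈-sym (red-≈ a)))
          (≈-trans (combination₁ -1ℤ p≈0 (lem (+ p) (+ red a)))
            (≡⇒≈ (trans (ℤP.m-n≡m⊖n p (red a)) (ℤP.⊖-≥ (ℕP.<⇒≤ (red-< a))))))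

  hi-neg : ∀ {a} → a ≉ 0ℤ → hi (- a) ≡ not (hi a)
  hi-neg {a} n with hi a in e
  ... | true  = <ᵇ-intro-false (ℕP.≤-trans (ℕP.≤-reflexive (red-neg n))
                  (ℕP.≤-trans (ℕP.∸-monoʳ-≤ p (<ᵇ-true {h} {red a} e))
                    (ℕP.≤-reflexive (trans (cong (ℕ._∸ suc h) p≡) (ℕP.m+n∸m≡n (suc h) h)))))
  ... | false = <ᵇ-intro (ℕP.≤-trans
                    (ℕP.≤-reflexive (sym (trans (cong (ℕ._∸ h) p≡) (ℕP.m+n∸n≡m (suc h) h))))
                    (ℕP.≤-trans (ℕP.∸-monoʳ-≤ p (<ᵇ-false {h} {red a} e)) (ℕP.≤-reflexive (sym (red-neg n)))))

  low-neg : ∀ {a} → a ≉ 0ℤ → low (- a) ≡ hi a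
  low-neg {a} n = trans (low-hi (neg≉0 n)) (trans (cong not (hi-neg n)) (BP.not-involutive _))

  low-unique : ∀ {a b} → low a ≡ true → low b ≡ true → (a ≈ b) ⊎ (a ≈ - b) → a ≈ b
  low-unique la lb (inj₁ e) = e
  low-unique {a} {b} la lb (inj₂ e) = true≢false (trans (sym (low-neg b≉0)) (trans (sym (low-cong e)) la))
      (trans (sym (BP.not-involutive _)) (cong not (trans (sym (low-hi b≉0)) lb)))
    where
    b≉0 : b ≉ 0ℤ
    b≉0 = low≉0 lb

  absr : ℤ → ℤ
  absr a = sgn (hi a) * a

  absr-cong : ∀ {a b} → a ≈ b → absr a ≈ absr b
  absr-cong e = *-cong (≡⇒≈ (cong sgn (hi-cong e))) e

  low-absr : ∀ {a} → a ≉ 0ℤ → low (absr a) ≡ true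
  low-absr {a} n with hi a in e
  ... | true  = trans (low-cong {_} { - a} (≡⇒≈ (ℤP.-1*i≡-i a))) (trans (low-neg n) e)
  ... | false = trans (low-cong {_} {a} (≡⇒≈ (ℤP.*-identityˡ a))) (trans (low-hi n) (cong not e))

  absr-± : ∀ a → (absr a ≈ a) ⊎ (absr a ≈ - a)
  absr-± a with hi a
  ... | true  = inj₂ (≡⇒≈ (ℤP.-1*i≡-i a))
  ... | false = inj₁ (≡⇒≈ (ℤP.*-identityˡ a))

  low-nat : ∀ {k} → k < h → low (+ suc k) ≡ true
  low-nat {k} k<h = trans (cong (λ r → not (r ≡ᵇ 0) ∧ not (h <ᵇ r)) (red-small (ℕP.≤-<-trans k<h h<p)))
                          (cong not (<ᵇ-intro-false k<h))

  module Half {A : Set} (_∙_ : A → A → A) (ε : A) (isCM : IsCommutativeMonoid _≡_ _∙_ ε) where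
    open ModSums _∙_ ε isCM

    sum-low : ∀ (f : ℤ → A) → S (λ j → low j ▸ f j) ≡ sum h (λ k → f (+ suc k))
    sum-low f = sym (sum-bij h p (λ _ → true) (λ j → low (+ j)) suc
      (λ k k<h _ → ℕP.≤-<-trans k<h h<p , low-nat k<h)
      onto (λ _ _ _ _ _ _ → ℕP.suc-injective) (λ j → f (+ j)))
      where
      onto : ∀ j → j < p → low (+ j) ≡ true → ∃ λ k → k < h × true ≡ true × suc k ≡ j
      onto zero    _   l = ⊥-elim (low≉0 {0ℤ} l ≈-refl)
      onto (suc k) j<p l = k , ℕP.≤-trans (ℕP.≤-reflexive (sym (red-small j<p)))
        (<ᵇ-false {h} {red (+ suc k)} (trans (sym (BP.not-involutive (hi (+ suc k))))
          (cong not (trans (sym (low-hi {+ suc k} (low≉0 {+ suc k} l))) l)))) , refl , refl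

  -- The exponent of Gauss's lemma modulo 2, counting the multiples t, 2 t, ..., h t whose least
  -- residue exceeds h.
  γ : ℤ → Bool
  γ t = ⊕.sum h (λ k → hi (t * + suc k))

  square-eq : ∀ {a b} → a * a ≈ b * b → (a ≈ b) ⊎ (a ≈ - b)
  square-eq {a} {b} e = [ inj₁ ∘ sub≈0⁻ , (λ z → inj₂ (combination₁ 1ℤ z (lem′ a b))) ]′
      (*-zero {a - b} {a + b} (combination₁ 1ℤ e (lem a b)))
    where
    lem : ∀ a b → (a - b) * (a + b) - 0ℤ ≡ 1ℤ * (a * a - b * b)
    lem = solve-∀
    lem′ : ∀ a b → a - - b ≡ 1ℤ * ((a + b) - 0ℤ)
    lem′ = solve-∀

  sgn-square : ∀ b → sgn b * sgn b ≡ 1ℤ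
  sgn-square true  = refl
  sgn-square false = refl

  sgn-move : ∀ x {a b} → sgn x * a ≈ b → a ≈ sgn x * b
  sgn-move x {a} {b} e = combination₁ (sgn x) e
      (trans (cong (_- sgn x * b) (trans (sym (ℤP.*-identityˡ a)) (cong (_* a) (sym (sgn-square x))))) (lem (sgn x) a b))
    where
    lem : ∀ s a b → s * s * a - s * b ≡ s * (s * a - b)
    lem = solve-∀

  sgn-split : ∀ z {a b} → a ≈ sgn z * b → (a ≈ b) ⊎ (a ≈ - b)
  sgn-split true  {b = b} e = inj₂ (≈-trans e (≡⇒≈ (ℤP.-1*i≡-i b)))
  sgn-split false {b = b} e = inj₁ (≈-trans e (≡⇒≈ (ℤP.*-identityˡ b)))

  sgn-eq : ∀ x y {a b} → sgn x * a ≈ sgn y * b → (a ≈ b) ⊎ (a ≈ - b)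
  sgn-eq x y {a} {b} e = sgn-split (x xor y) (≈-trans (sgn-move x e)
      (≡⇒≈ (trans (sym (ℤP.*-assoc (sgn x) (sgn y) b)) (cong (_* b) (sym (sgn-xor x y))))))

  -- The map j ↦ ± t j with values in 1, ..., h is a permutation, so the signed multiples of t have
  -- the product H = h !. That product is also `sgn (γ t) * t ^ h * H`, and H can be cancelled.
  gauss : ∀ {t} → t ≉ 0ℤ → t ^ h ≈ sgn (γ t)
  gauss {t} t≉0 = cancelˡ H H≉0 (≈-trans (≡⇒≈ (ℤP.*-comm H (t ^ h)))
      (≈-trans (sgn-move (γ t) flipped) (≡⇒≈ (ℤP.*-comm (sgn (γ t)) H))))
    where
    H : ℤ
    H = ∏.sum h (λ k → + suc k)

    H≉0 : H ≉ 0ℤ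
    H≉0 = ∏-nonzero h λ k k<h → nat≉0 (s≤s z≤n) (ℕP.≤-<-trans k<h h<p)

    open Half _*_ 1ℤ ℤP.*-1-isCommutativeMonoid

    π : ℤ → ℤ
    π j = absr (t * j)

    π-sgn : ∀ {a b} → π a ≈ π b → (a ≈ b) ⊎ (a ≈ - b)
    π-sgn {a} {b} e =
      [ (λ e′ → inj₁ (cancelˡ t t≉0 e′)) ,
        (λ e′ → inj₂ (cancelˡ t t≉0 (≈-trans e′ (≡⇒≈ (ℤP.neg-distribʳ-* t b))))) ]′
      (sgn-eq (hi (t * a)) (hi (t * b)) {t * a} {t * b} e)

    t*inv : ∀ d → t * (inv t * d) ≈ d
    t*inv d = combination₁ d (*-inv t≉0) (lem t (inv t) d)
      where
      lem : ∀ t i d → t * (i * d) - d ≡ d * (t * i - 1ℤ)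
      lem = solve-∀

    π-absr : ∀ d → (π (absr (inv t * d)) ≈ d) ⊎ (π (absr (inv t * d)) ≈ - d)
    π-absr d = sgn-split (u xor v) (≈-trans (≡⇒≈ (lem (sgn u) t (sgn v) (inv t * d)))
        (*-cong (≡⇒≈ (sym (sgn-xor u v))) (t*inv d)))
      where
      v u : Bool
      v = hi (inv t * d)
      u = hi (t * absr (inv t * d))
      lem : ∀ x t y w → x * (t * (y * w)) ≡ (x * y) * (t * w)
      lem = solve-∀

    permuted : PS.S (λ j → low j PS.▸ + red (π j)) ≡ PS.S (λ j → low j PS.▸ + red j)
    permuted = PS.S-bij low-cong low-cong (λ e → absr-cong (*-cong {t} ≈-refl e)) (λ e → cong +_ (red-cong e))
      (λ j l → low-absr (*-nonzero {t} {j} t≉0 (low≉0 l)))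
      (λ d l → absr (inv t * d) , low-absr (*-nonzero {inv t} {d} (inv≉0 t≉0) (low≉0 l)) ,
               low-unique (low-absr (*-nonzero {t} t≉0 (low≉0 (low-absr (*-nonzero {inv t} {d} (inv≉0 t≉0) (low≉0 l)))))) l (π-absr d))
      (λ a b la lb e → low-unique la lb (π-sgn e))

    flipped : sgn (γ t) * (t ^ h * H) ≈ H
    flipped = ≈-trans (≡⇒≈ chain)
        (≈-trans (∏-≈ h (λ k _ → ≈-sym (red-≈ (π (+ suc k)))))
        (≈-trans (≡⇒≈ (trans (sym (sum-low (λ j → + red (π j)))) (trans permuted (sum-low (λ j → + red j)))))
                 (∏-≈ h (λ k _ → red-≈ (+ suc k)))))
      where
      chain : sgn (γ t) * (t ^ h * H) ≡ ∏.sum h (λ k → sgn (hi (t * + suc k)) * (t * + suc k))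
      chain = sym (trans (∏.sum-∙ h (λ k → sgn (hi (t * + suc k))) (λ k → t * + suc k))
                (cong₂ _*_ (∏-sgn h (λ k → hi (t * + suc k)))
                  (trans (∏.sum-∙ h (λ _ → t) (λ k → + suc k)) (cong (_* H) (∏-const h t)))))

  fermat : ∀ {t} → t ≉ 0ℤ → t ^ h * t ^ h ≈ 1ℤ
  fermat {t} n = ≈-trans (*-cong (gauss n) (gauss n)) (≡⇒≈ (sgn-square (γ t)))

  private
    h₁ : ℕ
    h₁ = ℕ.pred h

    h≡ : suc h₁ ≡ h
    h≡ = ℕP.suc-pred h {{ℕ.>-nonZero 0<h}}

  sq-^h : ∀ {a} → a ≉ 0ℤ → sq a ≡ true → a ^ h ≈ 1ℤ
  sq-^h {a} n s with sq-true s
  ... | x , e = ≈-trans (^-cong h (≈-sym e)) (≈-trans (≡⇒≈ (^-distrib-* x x h))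
                  (fermat (factorˡ≉0 {x} {x} (nonzero-cong (≈-sym e) n))))

  -- The squares of 1, …, h exhaust the roots of X^h - 1.
  ^h-sq : ∀ {a} → a ^ h ≈ 1ℤ → sq a ≡ true
  ^h-sq {a} e = let k , k<h , z = ∏-zero h vanish in sq-intro (+ suc k) (≈-sym (sub≈0⁻ z))
    where
    poly : List ℤ
    poly = -1ℤ ∷ replicate h₁ 0ℤ

    eval-poly : ∀ {x} → x ^ h ≈ 1ℤ → eval poly x ≈ 0ℤ
    eval-poly {x} e = ≈-trans (≡⇒≈ (trans (eval-power -1ℤ h₁ x) (cong (λ n → -1ℤ + x ^ n) h≡)))
                        (combination₁ 1ℤ e (lem (x ^ h)))
      where
      lem : ∀ y → (-1ℤ + y) - 0ℤ ≡ 1ℤ * (y - 1ℤ)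
      lem = solve-∀

    suc≉0 : ∀ k → k < h → + suc k ≉ 0ℤ
    suc≉0 k k<h = nat≉0 (s≤s z≤n) (ℕP.≤-<-trans k<h h<p)

    distinct : ∀ i j → i < j → j < h → + suc i * + suc i ≉ + suc j * + suc j
    distinct i j i<j j<h e = ℕP.<⇒≢ i<j (ℕP.suc-injective (residue-unique
        (ℕP.≤-<-trans i<h h<p) (ℕP.≤-<-trans j<h h<p)
        (low-unique (low-nat i<h) (low-nat j<h) (square-eq e))))
      where
      i<h : i < h
      i<h = ℕP.<-trans i<j j<h

    vanish : ∏.sum h (λ k → a - + suc k * + suc k) ≈ 0ℤ
    vanish = ≈-trans (≈-sym (vieta h poly (λ k → + suc k * + suc k)
        (trans (cong suc (LP.length-replicate h₁)) h≡)
        (λ k k<h → eval-poly (≈-trans (≡⇒≈ (^-distrib-* (+ suc k) (+ suc k) h)) (fermat (suc≉0 k k<h))))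
        distinct a))
      (eval-poly e)

  R-intro : ∀ {a} → a ≉ 0ℤ → sq a ≡ false → R a ≡ true
  R-intro n s = cong₂ (λ z t → not z ∧ not t) (Z-intro-false n) s

  R-sq : ∀ {a} → sq a ≡ true → R a ≡ false
  R-sq {a} s = trans (cong (λ t → not (Z a) ∧ not t) s) (BP.∧-zeroʳ _)

  -- Both bits are read off `a ^ h`: it is 1 for squares by Fermat, and where it is 1 the root count
  -- in `^h-sq` provides a square root.
  R-γ : ∀ {a} → a ≉ 0ℤ → R a ≡ γ a
  R-γ {a} n = [ (λ s → trans (R-sq s) (sym (sgn-injective (≈-trans (≈-sym (gauss n)) (sq-^h n s))))) ,
                (λ s → trans (R-intro n s) (sym (BP.¬-not λ g → true≢false
                          (^h-sq (≈-trans (gauss n) (≡⇒≈ (cong sgn g)))) s))) ]′ (decide (sq a))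

  euler : ∀ {a} → a ≉ 0ℤ → a ^ h ≈ sgn (R a)
  euler n = ≈-trans (gauss n) (≡⇒≈ (cong sgn (sym (R-γ n))))

  R-* : ∀ {a b} → a ≉ 0ℤ → b ≉ 0ℤ → R (a * b) ≡ R a xor R b
  R-* {a} {b} a≉0 b≉0 = sgn-injective (≈-trans (≈-sym (euler (*-nonzero {a} {b} a≉0 b≉0)))
    (≈-trans (≡⇒≈ (^-distrib-* a b h)) (≈-trans (*-cong (euler a≉0) (euler b≉0)) (≡⇒≈ (sym (sgn-xor (R a) (R b)))))))

  -1^ : ∀ n → -1ℤ ^ n ≡ sgn (odd n)
  -1^ zero    = refl
  -1^ (suc n) = trans (cong (-1ℤ *_) (-1^ n)) (lem (odd n))
    where
    lem : ∀ b → -1ℤ * sgn b ≡ sgn (not b)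
    lem true  = refl
    lem false = refl

  -1≉0 : -1ℤ ≉ 0ℤ
  -1≉0 = sgn≉0 true

  R-minus-one : R -1ℤ ≡ odd h
  R-minus-one = sgn-injective (≈-trans (≈-sym (euler -1≉0)) (≡⇒≈ (-1^ h)))

  -- A fifth root of unity over ℤ/p, and the symbol of 5

  𝔽 : CommutativeRing 0ℓ 0ℓ
  𝔽 = record
    { Carrier = ℤ ; _≈_ = _≈_ ; _+_ = _+_ ; _*_ = _*_ ; -_ = -_ ; 0# = 0ℤ ; 1# = 1ℤ
    ; isCommutativeRing = record
      { isRing = record
        { +-isAbelianGroup = record
          { isGroup = record
            { isMonoid = record
              { isSemigroup = record
                { isMagma = record
                  { isEquivalence = record { refl = ≈-refl ; sym = ≈-sym ; trans = ≈-trans }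
                  ; ∙-cong = +-cong }
                ; assoc = λ a b c → ≡⇒≈ (ℤP.+-assoc a b c) }
              ; identity = (λ a → ≡⇒≈ (ℤP.+-identityˡ a)) , (λ a → ≡⇒≈ (ℤP.+-identityʳ a)) }
            ; inverse = (λ a → ≡⇒≈ (ℤP.+-inverseˡ a)) , (λ a → ≡⇒≈ (ℤP.+-inverseʳ a))
            ; ⁻¹-cong = neg-cong }
          ; comm = λ a b → ≡⇒≈ (ℤP.+-comm a b) }
        ; *-cong = *-cong
        ; *-assoc = λ a b c → ≡⇒≈ (ℤP.*-assoc a b c)
        ; *-identity = (λ a → ≡⇒≈ (ℤP.*-identityˡ a)) , (λ a → ≡⇒≈ (ℤP.*-identityʳ a))
        ; distrib = (λ a b c → ≡⇒≈ (ℤP.*-distribˡ-+ a b c)) , (λ a b c → ≡⇒≈ (ℤP.*-distribʳ-+ a b c)) }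
      ; *-comm = λ a b → ≡⇒≈ (ℤP.*-comm a b) } }

  -- τ = (0 , 1) satisfies τ² = 1 - τ, and ζ = ((0 , 0) , (1 , 0)) satisfies ζ² = τ ζ - 1,
  -- so that ζ is a primitive fifth root of unity with ζ + ζ⁻¹ = τ.
  𝔽[τ] 𝔽[ζ] : CommutativeRing 0ℓ 0ℓ
  𝔽[τ] = Quadratic.extension 𝔽 1ℤ -1ℤ
  𝔽[ζ] = Quadratic.extension 𝔽[τ] (-1ℤ , 0ℤ) (0ℤ , 1ℤ)

  module E₁ = CommutativeRing 𝔽[τ]
  module E₂ = CommutativeRing 𝔽[ζ]
  open Algebra.Properties.Semiring.Exp E₁.semiring public using () renaming (_^_ to _^₁_; ^-congˡ to ^₁-cong)
  open Algebra.Properties.Semiring.Exp E₂.semiring using () renaming (_^_ to _^₂_; ^-congˡ to ^₂-cong; ^-assocʳ to ^₂-*; ^-congʳ to ^₂-congʳ)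
  open Algebra.Properties.Semiring.Mult E₂.semiring using () renaming (_×_ to _·_)

  ι : E₁.Carrier → E₂.Carrier
  ι a = a , (0ℤ , 0ℤ)

  ι-* : ∀ a b → ι a E₂.* ι b E₂.≈ ι (a E₁.* b)
  ι-* a b = E₁.+-identityʳ (a E₁.* b) ,
    E₁.trans (E₁.+-identityʳ (a E₁.* E₁.0# E₁.+ E₁.0# E₁.* b))
      (E₁.trans (E₁.+-cong {a E₁.* E₁.0#} {_} {E₁.0# E₁.* b} (E₁.zeroʳ a) (E₁.zeroˡ b)) (E₁.+-identityʳ E₁.0#))

  ι-^ : ∀ a n → ι a ^₂ n E₂.≈ ι (a ^₁ n)
  ι-^ a zero    = E₂.refl
  ι-^ a (suc n) = E₂.trans (E₂.*-congˡ {ι a} (ι-^ a n)) (ι-* a (a ^₁ n))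

  ·1 : ∀ n → n · E₂.1# E₂.≈ ι (+ n , 0ℤ)
  ·1 zero    = E₂.refl
  ·1 (suc n) = E₂.+-congˡ {E₂.1#} (·1 n)

  char : p · E₂.1# E₂.≈ E₂.0#
  char = E₂.trans (·1 p) ((p≈0 , ≈-refl) , (≈-refl , ≈-refl))

  -- `-ζ̄` is ζ - τ, that is - ζ⁻¹, because ζ (τ - ζ) = 1.
  ζ -ζ̄ z : E₂.Carrier
  ζ  = (0ℤ , 0ℤ) , (1ℤ , 0ℤ)
  -ζ̄ = (0ℤ , -1ℤ) , (1ℤ , 0ℤ)
  z  = ζ E₂.+ -ζ̄

  -- This is τ² - 4, the discriminant of X² - τ X + 1. Its norm is 5, which gives the symbol of 5,
  -- and its square is 5 (1 + τ)², which gives the Lucas number.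
  Δ : E₁.Carrier
  Δ = - + 3 , -1ℤ

  -- The quotient (ζ^u - ζ^-u) / (ζ - ζ⁻¹), for instance ζ² + 1 + ζ⁻² = - τ for u = 3.
  factor : Unit10 → E₁.Carrier
  factor u1 = 1ℤ , 0ℤ
  factor u3 = 0ℤ , -1ℤ
  factor u7 = 0ℤ , 1ℤ
  factor u9 = -1ℤ , 0ℤ

  by-computation : ∀ {x y : E₂.Carrier} → x ≡ y → x E₂.≈ y
  by-computation refl = E₂.refl

  -- With z = ζ - ζ⁻¹ one has z² = Δ, and z ^ p = ζ ^ p - ζ ^ -p is a multiple of z.
  Δ-power : ∀ u q → p ≡ toNat u ℕ.+ q ℕ.* 10 → Δ ^₁ suc h E₁.≈ factor u E₁.* Δ
  Δ-power u q eq = proj₁ (begin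
    ι (Δ ^₁ suc h)            ≈⟨ E₂.sym (ι-^ Δ (suc h)) ⟩
    ι Δ ^₂ suc h              ≈⟨ ^₂-cong (suc h) (by-computation {ι Δ} {z ^₂ 2} refl) ⟩
    (z ^₂ 2) ^₂ suc h         ≈⟨ ^₂-* z 2 (suc h) ⟩
    -- The exponent is p + 1: one factor z is split off, and Frobenius acts on the other p.
    z ^₂ (2 ℕ.* suc h)        ≈⟨ ^₂-congʳ z (trans (cong (λ m → suc h ℕ.+ m) (ℕP.+-identityʳ (suc h))) (cong suc (trans (ℕP.+-suc h h) (sym p≡)))) ⟩
    z E₂.* z ^₂ p             ≈⟨ E₂.*-congˡ {z} (Frobenius.frobenius 𝔽[ζ] pr char ζ -ζ̄) ⟩
    z E₂.* (ζ ^₂ p E₂.+ -ζ̄ ^₂ p) ≈⟨ E₂.*-congˡ {z} (E₂.+-cong {ζ ^₂ p} (reduce ζ (by-computation refl)) (reduce -ζ̄ (by-computation refl))) ⟩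
    z E₂.* (ζ ^₂ toNat u E₂.+ -ζ̄ ^₂ toNat u) ≈⟨ final u ⟩
    ι (factor u E₁.* Δ) ∎)
    where
    open import Relation.Binary.Reasoning.Setoid E₂.setoid
    reduce : ∀ x → x ^₂ 10 E₂.≈ E₂.1# → x ^₂ p E₂.≈ x ^₂ toNat u
    reduce x e = E₂.trans (^₂-congʳ x eq) (Powers.^-periodic 𝔽[ζ] x 10 (toNat u) q e)
    final : ∀ u → z E₂.* (ζ ^₂ toNat u E₂.+ -ζ̄ ^₂ toNat u) E₂.≈ ι (factor u E₁.* Δ)
    final u1 = by-computation refl
    final u3 = by-computation refl
    final u7 = by-computation refl
    final u9 = by-computation refl

  5≉0 : + 5 ≉ 0ℤ
  5≉0 = nat≉0 (s≤s z≤n) 5<p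

  -- The product of a + b τ and its conjugate a + b (- 1 - τ).
  norm : E₁.Carrier → ℤ
  norm (a , b) = a * a - a * b - b * b

  norm-cong : ∀ {x y} → x E₁.≈ y → norm x ≈ norm y
  norm-cong (e , f) = sub-cong (sub-cong (*-cong e e) (*-cong e f)) (*-cong f f)

  norm-* : ∀ x y → norm (x E₁.* y) ≡ norm x * norm y
  norm-* (a , b) (c , d) = lem a b c d
    where
    lem : ∀ a b c d →
      (a * c + b * d * 1ℤ) * (a * c + b * d * 1ℤ) -
      (a * c + b * d * 1ℤ) * (a * d + b * c + b * d * -1ℤ) -
      (a * d + b * c + b * d * -1ℤ) * (a * d + b * c + b * d * -1ℤ) ≡
      (a * a - a * b - b * b) * (c * c - c * d - d * d)
    lem = solve-∀

  norm-^ : ∀ x n → norm (x ^₁ n) ≡ norm x ^ n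
  norm-^ x zero    = refl
  norm-^ x (suc n) = trans (norm-* x (x ^₁ n)) (cong (norm x *_) (norm-^ x n))

  norm-factor : ∀ u → norm (factor u) ≡ sgn (five-bit u)
  norm-factor u1 = refl
  norm-factor u3 = refl
  norm-factor u7 = refl
  norm-factor u9 = refl

  -- Norms in `Δ-power` give 5^(h + 1) = ± 5 with the norm of `factor u` as sign, and Euler's
  -- criterion reads off the symbol. The argument treats the cases where 𝔽[τ] is a field and where
  -- it splits alike.
  R-5 : ∀ u q → p ≡ toNat u ℕ.+ q ℕ.* 10 → R (+ 5) ≡ five-bit u
  R-5 u q eq = sgn-injective (≈-trans (≈-sym (euler 5≉0)) (cancelˡ (+ 5) 5≉0
    (≈-trans (≡⇒≈ (sym (norm-^ Δ (suc h))))
      (≈-trans (norm-cong (Δ-power u q eq))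
        (≡⇒≈ (trans (norm-* (factor u) Δ) (trans (ℤP.*-comm (norm (factor u)) (+ 5)) (cong (+ 5 *_) (norm-factor u)))))))))

  module _ {t : ℤ} (t²≈ : t * t ≈ 1ℤ - t) where

    at : E₁.Carrier → ℤ
    at (a , b) = a + b * t

    at-cong : ∀ {x y} → x E₁.≈ y → at x ≈ at y
    at-cong (e , f) = +-cong e (*-cong f ≈-refl)

    at-* : ∀ x y → at (x E₁.* y) ≈ at x * at y
    at-* (a , b) (c , d) = combination₁ (- (b * d)) t²≈ (lem a b c d t)
      where
      lem : ∀ a b c d t →
        (a * c + b * d * 1ℤ) + (a * d + b * c + b * d * -1ℤ) * t - (a + b * t) * (c + d * t) ≡
        - (b * d) * (t * t - (1ℤ - t))
      lem = solve-∀

    at-^ : ∀ x n → at (x ^₁ n) ≈ at x ^ n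
    at-^ x zero    = ≈-refl
    at-^ x (suc n) = ≈-trans (at-* x (x ^₁ n)) (*-cong {at x} ≈-refl (at-^ x n))

    Δ≉0 : at Δ ≉ 0ℤ
    -- By t² + t = 1 one has (- 3 - t)(t - 2) = 5, which is a unit.
    Δ≉0 = factorˡ≉0 {at Δ} {t - + 2} (nonzero-cong (combination₁ 1ℤ t²≈ (lem t)) 5≉0)
      where
      lem : ∀ t → + 5 - (- + 3 + -1ℤ * t) * (t - + 2) ≡ 1ℤ * (t * t - (1ℤ - t))
      lem = solve-∀

    -- Replacing τ by a root t in ℤ/p maps 𝔽[τ] to ℤ/p. If `factor u` is a sign, `Δ-power` becomes
    -- Δ(t)^(h + 1) = ± Δ(t), and Euler's criterion applies.
    R-Δ : ∀ u q → p ≡ toNat u ℕ.+ q ℕ.* 10 → ∀ b → factor u ≡ (sgn b , 0ℤ) → R (at Δ) ≡ b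
    R-Δ u q eq b c≡ = sgn-injective (≈-trans (≈-sym (euler Δ≉0)) (cancelˡ (at Δ) Δ≉0
      (≈-trans (≈-sym (at-^ Δ (suc h)))
        (≈-trans (at-cong (Δ-power u q eq))
          (≈-trans (at-* (factor u) Δ) (≡⇒≈ (trans (cong (λ c → at c * at Δ) c≡)
            (trans (cong (_* at Δ) (ℤP.+-identityʳ (sgn b))) (ℤP.*-comm (sgn b) (at Δ))))))))))

  -- The two roots - τ and 1 + τ of X² = X + 1. The trace of the n-th power of either is the n-th
  -- Lucas number.
  φ φ̄ : E₁.Carrier
  φ = 0ℤ , -1ℤ
  φ̄ = 1ℤ , 1ℤ

  trace : E₁.Carrier → ℤ
  trace (a , b) = + 2 * a - b

  five^ : ∀ k → (+ 5 , 0ℤ) ^₁ k E₁.≈ ((+ 5) ^ k , 0ℤ)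
  five^ zero    = E₁.refl
  five^ (suc k) = E₁.trans (E₁.*-congˡ {+ 5 , 0ℤ} (five^ k)) (≡⇒≈ (lem ((+ 5) ^ k)) , ≡⇒≈ (lem′ ((+ 5) ^ k)))
    where
    lem : ∀ x → + 5 * x + 0ℤ * 0ℤ * 1ℤ ≡ + 5 * x
    lem = solve-∀
    lem′ : ∀ x → + 5 * 0ℤ + 0ℤ * x + 0ℤ * 0ℤ * -1ℤ ≡ 0ℤ
    lem′ = solve-∀

  -- From Δ² = 5 φ̄² and h + 1 = 2 k follows 5^k φ̄^(h + 1) = Δ^(h + 1), and `Δ-power` evaluates the
  -- right side. Multiplication by φ = - 1 / φ̄ lowers the exponent to h; the minus sign comes from
  -- φ φ̄ = -1. The left side is 5^k times the h-th Lucas number.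
  trace-power : ∀ u q k → p ≡ toNat u ℕ.+ q ℕ.* 10 → suc h ≡ 2 ℕ.* k →
                (+ 5) ^ k * trace (φ̄ ^₁ h) ≈ - trace (φ E₁.* (factor u E₁.* Δ))
  trace-power u q k eq h≡2k = extract (φ̄ ^₁ h) (φ E₁.* (factor u E₁.* Δ))
      (E₁.trans (E₁.*-congˡ { -1ℤ , 0ℤ} (E₁.*-congˡ {φ̄ ^₁ h} (E₁.sym (five^ k))))
        (E₁.trans (Powers.even-power 𝔽[τ] φ φ̄ (+ 5 , 0ℤ) Δ h k (≈-refl , ≈-refl) h≡2k)
          (E₁.*-congˡ {φ} (Δ-power u q eq))))
    where
    extract : ∀ x y → (-1ℤ , 0ℤ) E₁.* (x E₁.* ((+ 5) ^ k , 0ℤ)) E₁.≈ y → (+ 5) ^ k * trace x ≈ - trace y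
    extract (a , b) (c , d) (e , f) = combination₂ (- + 2) 1ℤ e f (lem ((+ 5) ^ k) a b c d)
      where
      lem : ∀ n a b c d → n * (+ 2 * a - b) - - (+ 2 * c - d) ≡
        - + 2 * (-1ℤ * (a * n + b * 0ℤ * 1ℤ) + 0ℤ * (a * 0ℤ + b * n + b * 0ℤ * -1ℤ) * 1ℤ - c) +
        1ℤ * (-1ℤ * (a * 0ℤ + b * n + b * 0ℤ * -1ℤ) + 0ℤ * (a * n + b * 0ℤ * 1ℤ) + 0ℤ * (a * 0ℤ + b * n + b * 0ℤ * -1ℤ) * -1ℤ - d)
      lem = solve-∀

  -- Parities of sums over all residues

  open XS public using (S; S-perm)

  ▸-∧ : ∀ b c → b XS.▸ c ≡ b ∧ c
  ▸-∧ true  c = refl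
  ▸-∧ false c = refl

  S-cong : ∀ {f g : ℤ → Bool} → (∀ x → f x ≡ g x) → S f ≡ S g
  S-cong e = XS.sum-cong p λ i _ → e (+ i)

  S-xor : ∀ f g → S (λ x → f x xor g x) ≡ S f xor S g
  S-xor f g = XS.sum-∙ p (λ i → f (+ i)) (λ i → g (+ i))

  S-bij : ∀ {c q : ℤ → Bool} {π : ℤ → ℤ} {g : ℤ → Bool} →
          (∀ {a b} → a ≈ b → c a ≡ c b) → (∀ {a b} → a ≈ b → q a ≡ q b) →
          (∀ {a b} → a ≈ b → π a ≈ π b) → (∀ {a b} → a ≈ b → g a ≡ g b) →
          (∀ t → c t ≡ true → q (π t) ≡ true) →
          (∀ d → q d ≡ true → ∃ λ t → c t ≡ true × π t ≈ d) →
          (∀ t t′ → c t ≡ true → c t′ ≡ true → π t ≈ π t′ → t ≈ t′) →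
          S (λ t → c t ∧ g (π t)) ≡ S (λ d → q d ∧ g d)
  S-bij {c} {q} {π} {g} c≈ q≈ π≈ g≈ into onto inj =
    trans (S-cong (λ t → sym (▸-∧ (c t) (g (π t)))))
      (trans (XS.S-bij c≈ q≈ π≈ g≈ into onto inj) (S-cong (λ d → ▸-∧ (q d) (g d))))

  -- Comparison of least residues

  eqb lt : ℤ → ℤ → Bool
  eqb a b = red a ≡ᵇ red b
  lt  a b = red a <ᵇ red b

  lt-cong : ∀ {a b c d} → a ≈ b → c ≈ d → lt a c ≡ lt b d
  lt-cong e f = cong₂ _<ᵇ_ (red-cong e) (red-cong f)

  eqb-true : ∀ {a b} → eqb a b ≡ true → a ≈ b
  eqb-true {a} {b} e = red-injective (≡ᵇ-sound (red a) (red b) e)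

  eqb-intro : ∀ {a b} → a ≈ b → eqb a b ≡ true
  eqb-intro {a} {b} e = trans (cong (_≡ᵇ red b) (red-cong e)) (≡ᵇ-refl (red b))

  eqb-false : ∀ {a b} → a ≉ b → eqb a b ≡ false
  eqb-false n = BP.¬-not (λ e → n (eqb-true e))

  trichotomy : ∀ a b → (lt a b xor lt b a) xor eqb a b ≡ true
  trichotomy a b = lem (red a) (red b)
    where
    lem : ∀ m n → ((m <ᵇ n) xor (n <ᵇ m)) xor (m ≡ᵇ n) ≡ true
    lem zero    zero    = refl
    lem zero    (suc n) = refl
    lem (suc m) zero    = refl
    lem (suc m) (suc n) = lem m n

  S-point : ∀ {f : ℤ → Bool} r → (∀ {a b} → a ≈ b → f a ≡ f b) → S (λ x → eqb x r ∧ f x) ≡ f r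
  S-point {f} r f≈ = trans
    (XS.sum-single p (red r) (red-< r) λ i i<p i≢ → cong (_∧ f (+ i)) (eqb-false λ e → i≢ (trans (sym (red-small i<p)) (red-cong e))))
    (trans (cong (_∧ f (+ red r)) (eqb-intro (red-≈ r))) (f≈ (red-≈ r)))

  -- The condition `c` is compared with the two points only where `f` holds: the fixed-point
  -- equations to which this is applied can be solved only under the nonvanishing that `f` provides.
  S-two-points : ∀ {c f : ℤ → Bool} r r′ → (∀ {a b} → a ≈ b → f a ≡ f b) →
                 (∀ x → f x ≡ true → c x ≡ eqb x r xor eqb x r′) →
                 S (λ x → c x ∧ f x) ≡ f r xor f r′
  S-two-points {c} {f} r r′ f≈ e = trans (S-cong pointwise)
      (trans (S-xor (λ x → eqb x r ∧ f x) (λ x → eqb x r′ ∧ f x)) (cong₂ _xor_ (S-point r f≈) (S-point r′ f≈)))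
    where
    pointwise : ∀ x → c x ∧ f x ≡ (eqb x r ∧ f x) xor (eqb x r′ ∧ f x)
    pointwise x with f x in fx
    ... | false = trans (BP.∧-zeroʳ (c x)) (sym (cong₂ _xor_ (BP.∧-zeroʳ (eqb x r)) (BP.∧-zeroʳ (eqb x r′))))
    ... | true  = trans (BP.∧-identityʳ (c x)) (trans (e x fx)
                    (sym (cong₂ _xor_ (BP.∧-identityʳ (eqb x r)) (BP.∧-identityʳ (eqb x r′)))))

  -- An involution pairs off the points it moves.
  S-involution : ∀ {π : ℤ → ℤ} {f : ℤ → Bool} →
                 (∀ {a b} → a ≈ b → π a ≈ π b) → (∀ {a b} → a ≈ b → f a ≡ f b) →
                 (∀ x → π (π x) ≈ x) → (∀ x → f x ≡ true → f (π x) ≡ true) →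
                 S f ≡ S (λ x → eqb x (π x) ∧ f x)
  S-involution {π} {f} π≈ f≈ ππ fπ = begin
    S f ≡⟨ S-cong (λ x → split (lt x (π x)) (lt (π x) x) (eqb x (π x)) (f x) (trichotomy x (π x))) ⟩
    S (λ x → (up x xor down x) xor fixed x) ≡⟨ trans (S-xor (λ x → up x xor down x) fixed) (cong (_xor S fixed) (S-xor up down)) ⟩
    (S up xor S down) xor S fixed ≡⟨ cong (λ z → (S up xor z) xor S fixed) (trans (S-cong flip) (S-perm π≈ up≈ π ππ inj)) ⟩
    (S up xor S up) xor S fixed ≡⟨ cong (_xor S fixed) (xor-same (S up)) ⟩
    S fixed ∎
    where
    open ≡-Reasoning
    up down fixed : ℤ → Bool
    up    x = lt x (π x) ∧ f x
    down  x = lt (π x) x ∧ f x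
    fixed x = eqb x (π x) ∧ f x

    split : ∀ a b c d → (a xor b) xor c ≡ true → d ≡ ((a ∧ d) xor (b ∧ d)) xor (c ∧ d)
    split true  true  true  true  _ = refl
    split true  false false true  _ = refl
    split false true  false true  _ = refl
    split false false true  true  _ = refl
    split a b c false _ = sym (cong₂ _xor_ (cong₂ _xor_ (BP.∧-zeroʳ a) (BP.∧-zeroʳ b)) (BP.∧-zeroʳ c))

    fπ≡ : ∀ x → f (π x) ≡ f x
    fπ≡ x = bool-ext (λ e → trans (sym (f≈ (ππ x))) (fπ (π x) e)) (fπ x)

    up≈ : ∀ {a b} → a ≈ b → up a ≡ up b
    up≈ e = cong₂ _∧_ (lt-cong e (π≈ e)) (f≈ e)

    flip : ∀ x → down x ≡ up (π x)
    flip x = cong₂ _∧_ (lt-cong ≈-refl (≈-sym (ππ x))) (sym (fπ≡ x))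

    inj : ∀ {a b} → π a ≈ π b → a ≈ b
    inj {a} {b} e = ≈-trans (≈-sym (ππ a)) (≈-trans (π≈ e) (ππ b))

  S-symmetric : ∀ f → (∀ {a b} → a ≈ b → f a ≡ f b) →
                S f ≡ f 0ℤ xor ⊕.sum h (λ k → f (+ suc k) xor f (- + suc k))
  S-symmetric f f≈ = begin
    S f ≡⟨ cong (λ n → ⊕.sum n (λ i → f (+ i))) p≡ ⟩
    f 0ℤ xor ⊕.sum (h ℕ.+ h) g ≡⟨ cong (f 0ℤ xor_) (⊕.sum-split h h g) ⟩
    f 0ℤ xor (⊕.sum h g xor ⊕.sum h (λ i → g (h ℕ.+ i))) ≡⟨ cong (λ z → f 0ℤ xor (⊕.sum h g xor z)) (trans (⊕.sum-reverse h _) (⊕.sum-cong h reflect)) ⟩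
    f 0ℤ xor (⊕.sum h g xor ⊕.sum h (λ k → f (- + suc k))) ≡⟨ cong (f 0ℤ xor_) (sym (⊕.sum-∙ h g _)) ⟩
    f 0ℤ xor ⊕.sum h (λ k → g k xor f (- + suc k)) ∎
    where
    open ≡-Reasoning
    g : ℕ → Bool
    g i = f (+ suc i)

    reflect : ∀ k → k < h → g (h ℕ.+ (h ℕ.∸ suc k)) ≡ f (- + suc k)
    reflect k k<h = f≈ (combination₁ 1ℤ p≈0 (trans (lem (+ suc (h ℕ.+ (h ℕ.∸ suc k))) (+ suc k))
        (cong (λ m → 1ℤ * (+ m - 0ℤ)) (trans (cong suc (trans (ℕP.+-assoc h (h ℕ.∸ suc k) (suc k)) (cong (h ℕ.+_) (ℕP.m∸n+n≡m k<h)))) (sym p≡)))))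
      where
      lem : ∀ a b → a - - b ≡ 1ℤ * (a + b - 0ℤ)
      lem = solve-∀

  -- Characters of quotients

  Q⇒≉0 : ∀ {a} → Q a ≡ true → a ≉ 0ℤ
  Q⇒≉0 q z = true≢false q (Q-0 z)

  Q⇒R : ∀ {a} → Q a ≡ true → R a ≡ false
  Q⇒R q = trans (sym (BP.not-involutive _)) (cong not (trans (sym (Q-notR (Q⇒≉0 q))) q))

  R⇒Q : ∀ {a} → a ≉ 0ℤ → R a ≡ false → Q a ≡ true
  R⇒Q n r = trans (Q-notR n) (cong not r)

  R⇒≉0 : ∀ {a} → R a ≡ true → a ≉ 0ℤ
  R⇒≉0 r z = true≢false r (R-0 z)

  -- The symbol of a quotient w / a, with the quotient given by the equation a y = w instead of a
  -- division.
  R-ratio : ∀ a y {w} → a * y ≈ w → w ≉ 0ℤ → (y ≉ 0ℤ) × (R y ≡ R w xor R a)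
  R-ratio a y {w} e n = y≉0 , xor-move (trans (sym (R-* a≉0 y≉0)) (R-cong e))
    where
    ay≉0 : a * y ≉ 0ℤ
    ay≉0 = nonzero-cong (≈-sym e) n
    a≉0 : a ≉ 0ℤ
    a≉0 = factorˡ≉0 {a} {y} ay≉0
    y≉0 : y ≉ 0ℤ
    y≉0 = factorʳ≉0 {a} {y} ay≉0

  R-neg : ∀ {a} → a ≉ 0ℤ → R (- a) ≡ R -1ℤ xor R a
  R-neg {a} n = trans (R-cong (≡⇒≈ (sym (ℤP.-1*i≡-i a)))) (R-* -1≉0 n)

  R-square-* : ∀ c a → c ≉ 0ℤ → R (c * c * a) ≡ R a
  R-square-* c a n with zero? a
  ... | inj₁ z = trans (R-0 (combination₁ (c * c) z (lem (c * c) a))) (sym (R-0 z))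
    where
    lem : ∀ c a → c * a - 0ℤ ≡ c * (a - 0ℤ)
    lem = solve-∀
  ... | inj₂ a≉0 = trans (R-* (*-nonzero {c} {c} n n) a≉0) (cong (_xor R a) (R-square c))

  swing : ℤ → ℤ → ℤ
  swing c a = c * inv a

  swing-cong : ∀ c {a b} → a ≈ b → swing c a ≈ swing c b
  swing-cong c e = *-cong {c} ≈-refl (inv-cong e)

  *-swing : ∀ c {a} → a ≉ 0ℤ → a * swing c a ≈ c
  *-swing c {a} n = combination₁ c (*-inv n) (lem a c (inv a))
    where
    lem : ∀ a c i → a * (c * i) - c ≡ c * (a * i - 1ℤ)
    lem = solve-∀

  swing-swing : ∀ c → c ≉ 0ℤ → ∀ a → swing c (swing c a) ≈ a
  swing-swing c c≉0 a with zero? a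
  ... | inj₁ z = ≈-trans (swing-cong c (swing-0 z)) (≈-trans (swing-0 ≈-refl) (≈-sym z))
    where
    swing-0 : ∀ {a} → a ≈ 0ℤ → swing c a ≈ 0ℤ
    swing-0 z = ≡⇒≈ (trans (cong (c *_) (inv-0 z)) (ℤP.*-zeroʳ c))
  ... | inj₂ a≉0 = cancelˡ (swing c a) sw≉0 (≈-trans (*-swing c sw≉0) (≈-trans (≈-sym (*-swing c a≉0)) (≡⇒≈ (ℤP.*-comm a (swing c a)))))
    where
    sw≉0 : swing c a ≉ 0ℤ
    sw≉0 = *-nonzero {c} {inv a} c≉0 (inv≉0 a≉0)

  -- Counting x, x + 1, x + 5 by translations

  is : Bool → ℤ → Bool
  is true  = R
  is false = Q

  is-cong : ∀ b {x y} → x ≈ y → is b x ≡ is b y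
  is-cong true  = R-cong
  is-cong false = Q-cong

  is-0 : ∀ b {x} → x ≈ 0ℤ → is b x ≡ false
  is-0 true  = R-0
  is-0 false = Q-0

  is-nonzero : ∀ b {x} → x ≉ 0ℤ → is b x ≡ not (R x xor b)
  is-nonzero true  {x} n = trans (sym (BP.not-involutive (R x))) (cong not (BP.xor-comm true (R x)))
  is-nonzero false {x} n = trans (Q-notR n) (cong not (sym (BP.xor-identityʳ (R x))))

  N : Bool → Bool → Bool → Bool
  N b₁ b₂ b₃ = S (λ x → is b₁ x ∧ (is b₂ (x + 1ℤ) ∧ is b₃ (x + + 5)))

  N′ : Bool × Bool × Bool → Bool
  N′ (b₁ , b₂ , b₃) = N b₁ b₂ b₃

  squares : ℤ → Bool
  squares x = Q x ∧ (Q (x + 1ℤ) ∧ Q (x + + 5))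

  squares-cong : ∀ {x y} → x ≈ y → squares x ≡ squares y
  squares-cong e = cong₂ _∧_ (Q-cong e) (cong₂ _∧_ (Q-cong (+-cong e ≈-refl)) (Q-cong (+-cong e ≈-refl)))

  squares-true : ∀ x → squares x ≡ true → Q x ≡ true × Q (x + 1ℤ) ≡ true × Q (x + + 5) ≡ true
  squares-true x e = let a , bc = ∧-true e ; b , c = ∧-true bc in a , b , c

  4≉0 : + 4 ≉ 0ℤ
  4≉0 = *-nonzero {+ 2} {+ 2} 2≉0 2≉0

  20≉0 : + 20 ≉ 0ℤ
  20≉0 = *-nonzero {+ 4} {+ 5} 4≉0 5≉0

  -4≉0 : - + 4 ≉ 0ℤ
  -4≉0 = neg≉0 {+ 4} 4≉0

  combination₃ : ∀ {a b c d c′ d′ c″ d″} e e′ e″ → c ≈ d → c′ ≈ d′ → c″ ≈ d″ →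
                 a - b ≡ e * (c - d) + e′ * (c′ - d′) + e″ * (c″ - d″) → a ≈ b
  combination₃ {a} {b} {c} {d} {c′} {d′} {c″} {d″} e e′ e″ x y z q =
    combination₂ {c = e * (c - d) + e′ * (c′ - d′)} {d = 0ℤ} 1ℤ e″
      (combination₂ e e′ x y (lem (e * (c - d) + e′ * (c′ - d′)))) z (trans q (lem′ (e * (c - d) + e′ * (c′ - d′)) (e″ * (c″ - d″))))
    where
    lem : ∀ w → w - 0ℤ ≡ w
    lem = solve-∀
    lem′ : ∀ w v → w + v ≡ 1ℤ * (w - 0ℤ) + v
    lem′ = solve-∀

  Q-ratio : ∀ a y {w} → a * y ≈ w → Q a ≡ true → w ≉ 0ℤ → R w ≡ false → Q y ≡ true
  Q-ratio a y e qa n rw = let y≉0 , ry = R-ratio a y e n in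
    R⇒Q y≉0 (trans ry (cong₂ _xor_ rw (Q⇒R qa)))

  two-roots : ∀ {x y} r r′ → r ≉ r′ → (x ≈ y → (x ≈ r) ⊎ (x ≈ r′)) → (x ≈ r → x ≈ y) → (x ≈ r′ → x ≈ y) →
              eqb x y ≡ eqb x r xor eqb x r′
  two-roots {x} {y} r r′ r≉r′ f g g′ with eq? x r | eq? x r′
  ... | inj₁ e | inj₁ e′ = ⊥-elim (r≉r′ (≈-trans (≈-sym e) e′))
  ... | inj₁ e | inj₂ n′ = trans (eqb-intro (g e)) (sym (cong₂ _xor_ (eqb-intro e) (eqb-false n′)))
  ... | inj₂ n | inj₁ e′ = trans (eqb-intro (g′ e′)) (sym (cong₂ _xor_ (eqb-false n) (eqb-intro e′)))
  ... | inj₂ n | inj₂ n′ = trans (eqb-false ([ n , n′ ]′ ∘ f)) (sym (cong₂ _xor_ (eqb-false n) (eqb-false n′)))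

  -- Uses the translation by the 2-torsion point (-1 , 0), whose fixed points are -1 ± 2 √-1.
  N-minus-one-square : R -1ℤ ≡ false → N false false false ≡ R (+ 5)
  N-minus-one-square R-1 = conclude (sq-true { -1ℤ} (proj₂ (∧-true {not (Z -1ℤ)} (R⇒Q -1≉0 R-1))))
    where
    π : ℤ → ℤ
    -- Translation by (r , 0) sends x to r + (r - r′)(r - r″) / (x - r), where r′ and r″ are the
    -- other roots; for r = -1 the numerator is (-1)(4).
    π x = swing (- + 4) (x + 1ℤ) - 1ℤ

    π-cong : ∀ {a b} → a ≈ b → π a ≈ π b
    π-cong e = sub-cong (swing-cong (- + 4) (+-cong e ≈-refl)) ≈-refl

    back : ∀ y → y - 1ℤ + 1ℤ ≡ y
    back = solve-∀

    ππ : ∀ x → π (π x) ≈ x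
    ππ x = ≈-trans (sub-cong (≈-trans (swing-cong (- + 4) (≡⇒≈ (back _))) (swing-swing (- + 4) -4≉0 (x + 1ℤ))) ≈-refl)
                   (≡⇒≈ (lem x))
      where
      lem : ∀ x → x + 1ℤ - 1ℤ ≡ x
      lem = solve-∀

    preserved : ∀ x → squares x ≡ true → squares (π x) ≡ true
    preserved x f = let q , q₁ , q₅ = squares-true x f in go q q₁ q₅
      where
      y : ℤ
      y = swing (- + 4) (x + 1ℤ)
      go : Q x ≡ true → Q (x + 1ℤ) ≡ true → Q (x + + 5) ≡ true → squares (π x) ≡ true
      go q q₁ q₅ = ∧-intro
          (Q-ratio (x + 1ℤ) (y - 1ℤ) (combination₁ 1ℤ xy (lem₀ x y)) q₁ (neg≉0 (Q⇒≉0 q₅))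
            (trans (R-neg (Q⇒≉0 q₅)) (cong₂ _xor_ R-1 (Q⇒R q₅))))
          (∧-intro
            (Q-ratio (x + 1ℤ) (y - 1ℤ + 1ℤ) (combination₁ 1ℤ xy (lem₁ x y)) q₁ -4≉0
              (trans (R-square-* (+ 2) -1ℤ 2≉0) R-1))
            (Q-ratio (x + 1ℤ) (y - 1ℤ + + 5) (combination₁ 1ℤ xy (lem₅ x y)) q₁ (*-nonzero {+ 4} {x} 4≉0 (Q⇒≉0 q))
              (trans (R-square-* (+ 2) x 2≉0) (Q⇒R q))))
        where
        xy : (x + 1ℤ) * y ≈ - + 4
        xy = *-swing (- + 4) (Q⇒≉0 q₁)
        lem₀ : ∀ x y → (x + 1ℤ) * (y - 1ℤ) - - (x + + 5) ≡ 1ℤ * ((x + 1ℤ) * y - - + 4)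
        lem₀ = solve-∀
        lem₁ : ∀ x y → (x + 1ℤ) * (y - 1ℤ + 1ℤ) - - + 4 ≡ 1ℤ * ((x + 1ℤ) * y - - + 4)
        lem₁ = solve-∀
        lem₅ : ∀ x y → (x + 1ℤ) * (y - 1ℤ + + 5) - + 4 * x ≡ 1ℤ * ((x + 1ℤ) * y - - + 4)
        lem₅ = solve-∀

    module _ (i : ℤ) (i² : i * i ≈ -1ℤ) where
      point : ℤ
      point = -1ℤ + + 2 * i

      point-norm : (-1ℤ + + 2 * i) * (-1ℤ - + 2 * i) ≈ + 5
      point-norm = combination₁ (- + 4) i² (lem i)
        where
        lem : ∀ i → (-1ℤ + + 2 * i) * (-1ℤ - + 2 * i) - + 5 ≡ - + 4 * (i * i - -1ℤ)
        lem = solve-∀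

      point≉0 : point ≉ 0ℤ
      point≉0 = factorˡ≉0 {point} { -1ℤ - + 2 * i} (nonzero-cong (≈-sym point-norm) 5≉0)

      i≉0 : i ≉ 0ℤ
      i≉0 = factorˡ≉0 {i} {i} (nonzero-cong (≈-sym i²) -1≉0)

      -- At x = -1 + 2 i the number x + 1 = 2 i is (1 + i)², and x (x + 5) is (1 + 3 i)², so x and x
      -- + 5 have the same symbol. The two fixed points together then contribute the symbol of their
      -- product, which is 5.
      squares-point : squares point ≡ not (R point)
      squares-point = trans (cong₂ _∧_ (Q-notR point≉0) (cong₂ _∧_ Q₁ Q₅)) (BP.∧-idem (not (R point)))
        where
        Q₁ : Q (point + 1ℤ) ≡ true
        Q₁ = Q-intro (1ℤ + i) (nonzero-cong (≡⇒≈ (lem′ i)) (*-nonzero {+ 2} {i} 2≉0 i≉0)) (combination₁ 1ℤ i² (lem i))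
          where
          lem : ∀ i → (1ℤ + i) * (1ℤ + i) - (-1ℤ + + 2 * i + 1ℤ) ≡ 1ℤ * (i * i - -1ℤ)
          lem = solve-∀
          lem′ : ∀ i → + 2 * i ≡ -1ℤ + + 2 * i + 1ℤ
          lem′ = solve-∀
        point₅≉0 : point + + 5 ≉ 0ℤ
        point₅≉0 = factorˡ≉0 {point + + 5} {+ 4 - + 2 * i} (nonzero-cong (≈-sym (combination₁ (- + 4) i² (lem i))) 20≉0)
          where
          lem : ∀ i → (-1ℤ + + 2 * i + + 5) * (+ 4 - + 2 * i) - + 20 ≡ - + 4 * (i * i - -1ℤ)
          lem = solve-∀
        product : point * (point + + 5) ≈ (1ℤ + + 3 * i) * (1ℤ + + 3 * i)
        product = combination₁ (- + 5) i² (lem i)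
          where
          lem : ∀ i → (-1ℤ + + 2 * i) * (-1ℤ + + 2 * i + + 5) - (1ℤ + + 3 * i) * (1ℤ + + 3 * i) ≡ - + 5 * (i * i - -1ℤ)
          lem = solve-∀
        Q₅ : Q (point + + 5) ≡ not (R point)
        Q₅ = trans (Q-notR point₅≉0) (cong not
          (trans (proj₂ (R-ratio point (point + + 5) product (nonzero-cong product (*-nonzero {point} {point + + 5} point≉0 point₅≉0))))
            (cong (_xor R point) (R-square (1ℤ + + 3 * i)))))

      point-fixed : ∀ x → x + 1ℤ ≉ 0ℤ → x ≈ point → x ≈ π x
      point-fixed x n e = ≈-trans (≡⇒≈ (sym (lem x))) (sub-cong (cancelˡ (x + 1ℤ) n
          (≈-trans (combination₂ (x + 1ℤ + + 2 * i) (+ 4) e i² (lem′ x i)) (≈-sym (*-swing (- + 4) n)))) ≈-refl)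
        where
        lem : ∀ x → x + 1ℤ - 1ℤ ≡ x
        lem = solve-∀
        lem′ : ∀ x i → (x + 1ℤ) * (x + 1ℤ) - - + 4 ≡ (x + 1ℤ + + 2 * i) * (x - (-1ℤ + + 2 * i)) + + 4 * (i * i - -1ℤ)
        lem′ = solve-∀

    conclude : (∃ λ i → i * i ≈ -1ℤ) → N false false false ≡ R (+ 5)
    conclude (i , i²) = begin
      S squares                                ≡⟨ S-involution π-cong squares-cong ππ preserved ⟩
      S (λ x → eqb x (π x) ∧ squares x)        ≡⟨ S-two-points (point i i²) (point (- i) j²) squares-cong roots ⟩
      squares (point i i²) xor squares (point (- i) j²) ≡⟨ cong₂ _xor_ (squares-point i i²) (squares-point (- i) j²) ⟩
      not (R (point i i²)) xor not (R (point (- i) j²)) ≡⟨ not-xor-not (R (point i i²)) (R (point (- i) j²)) ⟩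
      R (point i i²) xor R (point (- i) j²)            ≡⟨ sym (R-* (point≉0 i i²) (point≉0 (- i) j²)) ⟩
      R (point i i² * point (- i) j²)                  ≡⟨ R-cong (≈-trans (≡⇒≈ (cong (point i i² *_) (lem i))) (point-norm i i²)) ⟩
      R (+ 5) ∎
      where
      open ≡-Reasoning
      j² : (- i) * (- i) ≈ -1ℤ
      j² = ≈-trans (≡⇒≈ (lem i)) i²
        where
        lem : ∀ i → (- i) * (- i) ≡ i * i
        lem = solve-∀
      lem : ∀ i → -1ℤ + + 2 * (- i) ≡ -1ℤ - + 2 * i
      lem = solve-∀
      not-xor-not : ∀ a b → not a xor not b ≡ a xor b
      not-xor-not true  b = refl
      not-xor-not false b = BP.not-involutive b
      roots : ∀ x → squares x ≡ true → eqb x (π x) ≡ eqb x (point i i²) xor eqb x (point (- i) j²)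
      roots x f = two-roots (point i i²) (point (- i) j²) distinct split (point-fixed i i² x n) (point-fixed (- i) j² x n)
        where
        n : x + 1ℤ ≉ 0ℤ
        n = Q⇒≉0 (proj₁ (proj₂ (squares-true x f)))
        distinct : point i i² ≉ point (- i) j²
        distinct e = *-nonzero {+ 4} {i} 4≉0 (i≉0 i i²) (combination₁ 1ℤ e (lem′ i))
          where
          lem′ : ∀ i → + 4 * i - 0ℤ ≡ 1ℤ * ((-1ℤ + + 2 * i) - (-1ℤ + + 2 * (- i)))
          lem′ = solve-∀
        split : x ≈ π x → (x ≈ point i i²) ⊎ (x ≈ point (- i) j²)
        split e = [ (λ e′ → inj₁ (combination₁ 1ℤ e′ (lem₁ x i))) , (λ e′ → inj₂ (combination₁ 1ℤ e′ (lem₂ x i))) ]′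
            (square-eq {x + 1ℤ} {+ 2 * i} (combination₃ (x + 1ℤ) 1ℤ (- + 4) e (*-swing (- + 4) n) i² (lem₃ x i (swing (- + 4) (x + 1ℤ)))))
          where
          lem₁ : ∀ x i → x - (-1ℤ + + 2 * i) ≡ 1ℤ * (x + 1ℤ - + 2 * i)
          lem₁ = solve-∀
          lem₂ : ∀ x i → x - (-1ℤ + + 2 * (- i)) ≡ 1ℤ * (x + 1ℤ - - (+ 2 * i))
          lem₂ = solve-∀
          lem₃ : ∀ x i y → (x + 1ℤ) * (x + 1ℤ) - + 2 * i * (+ 2 * i) ≡
            (x + 1ℤ) * (x - (y - 1ℤ)) + 1ℤ * ((x + 1ℤ) * y - - + 4) + - + 4 * (i * i - -1ℤ)
          lem₃ = solve-∀

  -- Uses the translation by the 2-torsion point (0 , 0), whose fixed points are ± √5.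
  N-five-square : R -1ℤ ≡ true → R (+ 5) ≡ false → ∀ b → (∀ t → t * t ≈ 1ℤ - t → R (- + 3 + -1ℤ * t) ≡ b) →
                  N false false false ≡ R (+ 2) xor b
  N-five-square R-1 R5 b root-bit =
      let r₀ , r₀² = sq-true {+ 5} (proj₂ (∧-true {not (Z (+ 5))} (R⇒Q 5≉0 R5))) in choose r₀ r₀² (decide (R r₀))
    where
    π : ℤ → ℤ
    π = swing (+ 5)

    preserved : ∀ x → squares x ≡ true → squares (π x) ≡ true
    preserved x f = let q , q₁ , q₅ = squares-true x f in go q q₁ q₅
      where
      go : Q x ≡ true → Q (x + 1ℤ) ≡ true → Q (x + + 5) ≡ true → squares (π x) ≡ true
      go q q₁ q₅ = ∧-intro (Q-ratio x (π x) xy q 5≉0 R5)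
          (∧-intro (Q-ratio x (π x + 1ℤ) (combination₁ 1ℤ xy (lem₁ x (π x))) q (Q⇒≉0 q₅) (Q⇒R q₅))
                   (Q-ratio x (π x + + 5) (combination₁ 1ℤ xy (lem₅ x (π x))) q (*-nonzero {+ 5} {x + 1ℤ} 5≉0 (Q⇒≉0 q₁))
                     (trans (R-* 5≉0 (Q⇒≉0 q₁)) (cong₂ _xor_ R5 (Q⇒R q₁)))))
        where
        xy : x * π x ≈ + 5
        xy = *-swing (+ 5) (Q⇒≉0 q)
        lem₁ : ∀ x y → x * (y + 1ℤ) - (x + + 5) ≡ 1ℤ * (x * y - + 5)
        lem₁ = solve-∀
        lem₅ : ∀ x y → x * (y + + 5) - + 5 * (x + 1ℤ) ≡ 1ℤ * (x * y - + 5)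
        lem₅ = solve-∀

    -- Of the fixed points ± r only the square r can count. As r (r + 1) = r + 5 and r is a square,
    -- r + 1 and r + 5 have the same symbol, so r counts if r + 5 is a square. With t = (r - 1) / 2,
    -- a root of t² = 1 - t, the number r + 5 is - 2 (- 3 - t), whose symbol `root-bit` supplies.
    with-root : ∀ r → r * r ≈ + 5 → R r ≡ false → N false false false ≡ R (+ 2) xor b
    with-root r r² Rr = begin
      S squares                         ≡⟨ S-involution (swing-cong (+ 5)) squares-cong (swing-swing (+ 5) 5≉0) preserved ⟩
      S (λ x → eqb x (π x) ∧ squares x) ≡⟨ S-two-points r (- r) squares-cong roots ⟩
      squares r xor squares (- r)       ≡⟨ cong₂ _xor_ at-r at-minus-r ⟩
      not (R (r + + 5)) xor false       ≡⟨ BP.xor-identityʳ _ ⟩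
      not (R (r + + 5))                 ≡⟨ cong not R-r+5 ⟩
      not ((true xor R (+ 2)) xor b)    ≡⟨ simplify (R (+ 2)) b ⟩
      R (+ 2) xor b ∎
      where
      open ≡-Reasoning
      simplify : ∀ x y → not ((true xor x) xor y) ≡ x xor y
      simplify true  y = refl
      simplify false y = BP.not-involutive y

      r≉0 : r ≉ 0ℤ
      r≉0 = factorˡ≉0 {r} {r} (nonzero-cong (≈-sym r²) 5≉0)

      Qr : Q r ≡ true
      Qr = R⇒Q r≉0 Rr

      r+5≉0 : r + + 5 ≉ 0ℤ
      r+5≉0 = factorˡ≉0 {r + + 5} {+ 5 - r} (nonzero-cong (≈-sym (combination₁ -1ℤ r² (lem r))) 20≉0)
        where
        lem : ∀ r → (r + + 5) * (+ 5 - r) - + 20 ≡ -1ℤ * (r * r - + 5)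
        lem = solve-∀

      at-r : squares r ≡ not (R (r + + 5))
      at-r = trans (cong₂ _∧_ Qr (cong₂ _∧_ Q₁ (Q-notR r+5≉0))) (BP.∧-idem _)
        where
        ratio : (r + 1ℤ ≉ 0ℤ) × (R (r + 1ℤ) ≡ R (r + + 5) xor R r)
        ratio = R-ratio r (r + 1ℤ) (combination₁ 1ℤ r² (lem r)) r+5≉0
          where
          lem : ∀ r → r * (r + 1ℤ) - (r + + 5) ≡ 1ℤ * (r * r - + 5)
          lem = solve-∀
        Q₁ : Q (r + 1ℤ) ≡ not (R (r + + 5))
        Q₁ = trans (Q-notR (proj₁ ratio)) (cong not (trans (proj₂ ratio) (trans (cong (R (r + + 5) xor_) Rr) (BP.xor-identityʳ _))))

      at-minus-r : squares (- r) ≡ false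
      at-minus-r = cong (_∧ (Q (- r + 1ℤ) ∧ Q (- r + + 5)))
        (trans (Q-notR (neg≉0 r≉0)) (cong not (trans (R-neg r≉0) (cong₂ _xor_ R-1 Rr))))

      t : ℤ
      t = (r - 1ℤ) * inv (+ 2)

      2t : + 2 * t ≈ r - 1ℤ
      2t = combination₁ (r - 1ℤ) (*-inv 2≉0) (lem r (inv (+ 2)))
        where
        lem : ∀ r i → + 2 * ((r - 1ℤ) * i) - (r - 1ℤ) ≡ (r - 1ℤ) * (+ 2 * i - 1ℤ)
        lem = solve-∀

      t² : t * t ≈ 1ℤ - t
      t² = cancelˡ (+ 4) 4≉0 (combination₂ (+ 2 * t + r + 1ℤ) 1ℤ 2t r² (lem t r))
        where
        lem : ∀ t r → + 4 * (t * t) - + 4 * (1ℤ - t) ≡ (+ 2 * t + r + 1ℤ) * (+ 2 * t - (r - 1ℤ)) + 1ℤ * (r * r - + 5)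
        lem = solve-∀

      R-r+5 : R (r + + 5) ≡ (true xor R (+ 2)) xor b
      R-r+5 = trans (R-cong r+5≈) (trans (R-* -2≉0 w≉0) (cong₂ _xor_ (trans (R-neg {+ 2} 2≉0) (cong (_xor R (+ 2)) R-1)) (root-bit t t²)))
        where
        -2≉0 : - + 2 ≉ 0ℤ
        -2≉0 = neg≉0 {+ 2} 2≉0
        r+5≈ : r + + 5 ≈ - + 2 * (- + 3 + -1ℤ * t)
        r+5≈ = combination₁ -1ℤ 2t (lem r t)
          where
          lem : ∀ r t → r + + 5 - - + 2 * (- + 3 + -1ℤ * t) ≡ -1ℤ * (+ 2 * t - (r - 1ℤ))
          lem = solve-∀
        w≉0 : - + 3 + -1ℤ * t ≉ 0ℤ
        w≉0 = factorʳ≉0 { - + 2} { - + 3 + -1ℤ * t} (nonzero-cong r+5≈ r+5≉0)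

      roots : ∀ x → squares x ≡ true → eqb x (π x) ≡ eqb x r xor eqb x (- r)
      roots x f = two-roots r (- r)
          (λ e → *-nonzero {+ 2} {r} 2≉0 r≉0 (combination₁ 1ℤ e (lem r)))
          (λ e → square-eq (combination₃ x 1ℤ -1ℤ e xy r² (lem′ x (π x) r)))
          (λ e → fixed (combination₂ (x + r) 1ℤ e r² (lem″ x r)))
          (λ e → fixed (combination₂ (x - r) 1ℤ e r² (lem‴ x r)))
        where
        n : x ≉ 0ℤ
        n = Q⇒≉0 (proj₁ (squares-true x f))
        xy : x * π x ≈ + 5
        xy = *-swing (+ 5) n
        fixed : x * x ≈ + 5 → x ≈ π x
        fixed e = cancelˡ x n (≈-trans e (≈-sym xy))
        lem : ∀ r → + 2 * r - 0ℤ ≡ 1ℤ * (r - - r)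
        lem = solve-∀
        lem′ : ∀ x y r → x * x - r * r ≡ x * (x - y) + 1ℤ * (x * y - + 5) + -1ℤ * (r * r - + 5)
        lem′ = solve-∀
        lem″ : ∀ x r → x * x - + 5 ≡ (x + r) * (x - r) + 1ℤ * (r * r - + 5)
        lem″ = solve-∀
        lem‴ : ∀ x r → x * x - + 5 ≡ (x - r) * (x - - r) + 1ℤ * (r * r - + 5)
        lem‴ = solve-∀

    choose : ∀ r → r * r ≈ + 5 → (R r ≡ true) ⊎ (R r ≡ false) → N false false false ≡ R (+ 2) xor b
    choose r r² (inj₂ Rr) = with-root r r² Rr
    -- Since -1 is a nonsquare, the opposite root of 5 is the square one.
    choose r r² (inj₁ Rr) = with-root (- r) (≈-trans (≡⇒≈ (lem r)) r²) (trans (R-neg (R⇒≉0 Rr)) (cong₂ _xor_ R-1 Rr))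
      where
      lem : ∀ r → (- r) * (- r) ≡ r * r
      lem = solve-∀

  -- Differences t - 1/t of squares, and the Lucas number

  square-into : ∀ t → low t ≡ true → Q (t * t) ≡ true
  square-into t l = Q-intro t (*-nonzero {t} {t} (low≉0 l) (low≉0 l)) ≈-refl

  square-onto : ∀ d → Q d ≡ true → ∃ λ t → low t ≡ true × t * t ≈ d
  square-onto d q = let x , e = proj₂ (Q-true q) in
      absr x , low-absr (factorˡ≉0 {x} {x} (nonzero-cong (≈-sym e) (Q⇒≉0 q))) , ≈-trans (sign x (absr-± x)) e
    where
    sign : ∀ x {y} → (y ≈ x) ⊎ (y ≈ - x) → y * y ≈ x * x
    sign x (inj₁ e) = *-cong e e
    sign x (inj₂ e) = ≈-trans (*-cong e e) (≡⇒≈ (lem x))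
      where
      lem : ∀ x → - x * - x ≡ x * x
      lem = solve-∀

  square-injective : ∀ t t′ → low t ≡ true → low t′ ≡ true → t * t ≈ t′ * t′ → t ≈ t′
  square-injective t t′ l l′ e = low-unique l l′ (square-eq e)

  S-squares : ∀ {g : ℤ → Bool} → (∀ {a b} → a ≈ b → g a ≡ g b) →
              ⊕.sum h (λ k → g (+ suc k * + suc k)) ≡ S (λ x → Q x ∧ g x)
  S-squares {g} g≈ = trans (sym (Half.sum-low _xor_ false xor-isCM (λ j → g (j * j))))
      (trans (S-cong (λ j → ▸-∧ (low j) (g (j * j))))
        (S-bij low-cong Q-cong (λ e → *-cong e e) g≈
          square-into square-onto square-injective))

  difference : ℤ → ℤ
  difference t = t - inv t

  difference-cong : ∀ {a b} → a ≈ b → difference a ≈ difference b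
  difference-cong e = sub-cong e (inv-cong e)

  module _ (R-1 : R -1ℤ ≡ true) where

    -- d² + 4 is the discriminant of X² - d X - 1, whose roots are the solutions t of t - 1/t = d.
    discriminant : ℤ → Bool
    discriminant d = Q (d * d + + 4)

    discriminant-cong : ∀ {a b} → a ≈ b → discriminant a ≡ discriminant b
    discriminant-cong e = Q-cong (+-cong (*-cong e e) ≈-refl)

    square≉-1 : ∀ {a} → R a ≡ false → a ≉ -1ℤ
    square≉-1 r e = true≢false R-1 (trans (sym (R-cong e)) r)

    difference-injective : ∀ t t′ → Q t ≡ true → Q t′ ≡ true → difference t ≈ difference t′ → t ≈ t′
    difference-injective t t′ q q′ e =
      [ sub≈0⁻ , (λ z → ⊥-elim (square≉-1 {t * t′} (trans (R-* (Q⇒≉0 q) (Q⇒≉0 q′)) (cong₂ _xor_ (Q⇒R q) (Q⇒R q′)))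
                                   (combination₁ 1ℤ z (lem′ t t′)))) ]′
      (*-zero {t - t′} {t * t′ + 1ℤ}
        (combination₃ (t * t′) t′ (- t) e (*-inv (Q⇒≉0 q)) (*-inv (Q⇒≉0 q′)) (lem t t′ (inv t) (inv t′))))
      where
      lem : ∀ t t′ i i′ → (t - t′) * (t * t′ + 1ℤ) - 0ℤ ≡
            t * t′ * ((t - i) - (t′ - i′)) + t′ * (t * i - 1ℤ) + - t * (t′ * i′ - 1ℤ)
      lem = solve-∀
      lem′ : ∀ t t′ → t * t′ - -1ℤ ≡ 1ℤ * (t * t′ + 1ℤ - 0ℤ)
      lem′ = solve-∀

    discriminant-difference : ∀ t → Q t ≡ true → discriminant (difference t) ≡ true
    discriminant-difference t q = Q-intro (t + inv t) (nonzero-cong square (*-nonzero {t + inv t} {t + inv t} n n)) square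
      where
      t*i : t * inv t ≈ 1ℤ
      t*i = *-inv (Q⇒≉0 q)
      square : (t + inv t) * (t + inv t) ≈ difference t * difference t + + 4
      square = combination₁ (+ 4) t*i (lem t (inv t))
        where
        lem : ∀ t i → (t + i) * (t + i) - ((t - i) * (t - i) + + 4) ≡ + 4 * (t * i - 1ℤ)
        lem = solve-∀
      n : t + inv t ≉ 0ℤ
      n z = square≉-1 {t * t} (R-square t) (combination₂ t -1ℤ z t*i (lem t (inv t)))
        where
        lem : ∀ t i → t * t - -1ℤ ≡ t * (t + i - 0ℤ) + -1ℤ * (t * i - 1ℤ)
        lem = solve-∀

    -- The two solutions of t - 1/t = d have product -1. As -1 is a nonsquare, exactly one of them
    -- is a square, so the squares t correspond one to one to the d with nonzero square
    -- discriminant.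
    S-difference : ∀ {g : ℤ → Bool} → (∀ {a b} → a ≈ b → g a ≡ g b) →
                   S (λ t → Q t ∧ g (difference t)) ≡ S (λ d → discriminant d ∧ g d)
    S-difference g≈ = S-bij Q-cong discriminant-cong difference-cong g≈ discriminant-difference onto
        (λ t t′ q q′ e → difference-injective t t′ q q′ e)
      where
      ½ : ℤ
      ½ = inv (+ 2)
      onto : ∀ d → discriminant d ≡ true → ∃ λ t → Q t ≡ true × difference t ≈ d
      onto d q = let v , v² = proj₂ (Q-true {d * d + + 4} q) in choose v v²
        where
        module _ (v : ℤ) (v² : v * v ≈ d * d + + 4) where
          t : ℤ
          t = (d + v) * ½
          t·t′ : t * ((v - d) * ½) ≈ 1ℤ
          t·t′ = cancelˡ (+ 4) 4≉0 (combination₂ ((v * v - d * d) * (+ 2 * ½ + 1ℤ)) 1ℤ (*-inv 2≉0) v² (lem d v ½))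
            where
            lem : ∀ d v i → + 4 * ((d + v) * i * ((v - d) * i)) - + 4 * 1ℤ ≡
                  (v * v - d * d) * (+ 2 * i + 1ℤ) * (+ 2 * i - 1ℤ) + 1ℤ * (v * v - (d * d + + 4))
            lem = solve-∀
          t≉0 : t ≉ 0ℤ
          t≉0 = factorˡ≉0 {t} {(v - d) * ½} (nonzero-cong (≈-sym t·t′) 1≉0)
          difference-t : difference t ≈ d
          difference-t = combination₂ -1ℤ d (≈-sym (inv-unique {t} {(v - d) * ½} t·t′)) (*-inv 2≉0) (lem d v ½ (inv t))
            where
            lem : ∀ d v i j → (d + v) * i - j - d ≡ -1ℤ * (j - (v - d) * i) + d * (+ 2 * i - 1ℤ)
            lem = solve-∀
        choose : ∀ v → v * v ≈ d * d + + 4 → ∃ λ t → Q t ≡ true × difference t ≈ d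
        choose v v² = by (decide (R (t v v²)))
          where
          -v² : - v * - v ≈ d * d + + 4
          -v² = ≈-trans (≡⇒≈ (lem v)) v²
            where
            lem : ∀ v → - v * - v ≡ v * v
            lem = solve-∀
          product : t v v² * t (- v) -v² ≈ -1ℤ
          product = combination₁ -1ℤ (t·t′ v v²) (lem d v ½)
            where
            lem : ∀ d v i → (d + v) * i * ((d + - v) * i) - -1ℤ ≡ -1ℤ * ((d + v) * i * ((v - d) * i) - 1ℤ)
            lem = solve-∀
          by : (R (t v v²) ≡ true) ⊎ (R (t v v²) ≡ false) → ∃ λ t → Q t ≡ true × difference t ≈ d
          by (inj₂ r) = t v v² , R⇒Q (t≉0 v v²) r , difference-t v v²
          by (inj₁ r) = t (- v) -v² , R⇒Q (t≉0 (- v) -v²)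
            (trans (proj₂ (R-ratio (t v v²) (t (- v) -v²) product -1≉0)) (cong₂ _xor_ R-1 r)) , difference-t (- v) -v²

    difference-parity : Bool
    difference-parity = S (λ t → Q t ∧ R (difference t - 1ℤ))

    -- After `S-difference`, d is paired with - d. The factor d² + 4 is common, and the symbols of d
    -- - 1 and - d - 1 combine to that of 1 - d², so a sum over the squares X = d² appears; X = x +
    -- 1 makes it the count of three squares, because R (- x) = Q x here. Two terms stand apart: d =
    -- 0 contributes the outer `not`, and for the pair d = ± 1, where 1 - d² vanishes, d = -1 leaves
    -- Q 5 ∧ R (- 2).
    difference-parity≡ : difference-parity ≡ not (N false false false xor (Q (+ 5) ∧ R (- + 2)))
    difference-parity≡ = begin
      difference-parity ≡⟨ S-difference {λ d → R (d - 1ℤ)} (λ e → R-cong (sub-cong e ≈-refl)) ⟩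
      S F ≡⟨ S-symmetric F (λ e → cong₂ _∧_ (discriminant-cong e) (R-cong (sub-cong e ≈-refl))) ⟩
      F 0ℤ xor ⊕.sum h (λ k → F (+ suc k) xor F (- + suc k)) ≡⟨ cong₂ _xor_ F0 (⊕.sum-cong h pointwise) ⟩
      true xor ⊕.sum h (λ k → g (+ suc k * + suc k) xor (eqb (+ suc k) 1ℤ ∧ c)) ≡⟨ cong not (⊕.sum-∙ h (λ k → g (+ suc k * + suc k)) (λ k → eqb (+ suc k) 1ℤ ∧ c)) ⟩
      not (⊕.sum h (λ k → g (+ suc k * + suc k)) xor ⊕.sum h (λ k → eqb (+ suc k) 1ℤ ∧ c)) ≡⟨ cong not (cong₂ _xor_ first second) ⟩
      not (N false false false xor c) ∎
      where
      open ≡-Reasoning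
      F g : ℤ → Bool
      F d = discriminant d ∧ R (d - 1ℤ)
      g X = Q (X + + 4) ∧ R (1ℤ - X)
      c : Bool
      c = Q (+ 5) ∧ R (- + 2)

      g-cong : ∀ {a b} → a ≈ b → g a ≡ g b
      g-cong e = cong₂ _∧_ (Q-cong (+-cong e ≈-refl)) (R-cong (sub-cong {1ℤ} ≈-refl e))

      F0 : F 0ℤ ≡ true
      F0 = ∧-intro (Q-intro (+ 2) 4≉0 ≈-refl) R-1

      pointwise : ∀ k → k < h → F (+ suc k) xor F (- + suc k) ≡ g (+ suc k * + suc k) xor (eqb (+ suc k) 1ℤ ∧ c)
      pointwise k k<h = trans (cong (F d xor_) (cong (_∧ R (- d - 1ℤ)) (Q-cong (≡⇒≈ (lem d))))) (by (eq? d 1ℤ))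
        where
        d : ℤ
        d = + suc k
        lem : ∀ d → - d * - d + + 4 ≡ d * d + + 4
        lem = solve-∀
        by : (d ≈ 1ℤ) ⊎ (d ≉ 1ℤ) → F d xor (discriminant d ∧ R (- d - 1ℤ)) ≡ g (d * d) xor (eqb d 1ℤ ∧ c)
        by (inj₁ e) = cong₂ _xor_
          (trans (cong (discriminant d ∧_) (R-0 (combination₁ 1ℤ e (lem₁ d))))
            (trans (BP.∧-zeroʳ (discriminant d)) (sym (trans (cong (Q (d * d + + 4) ∧_) (R-0 (combination₁ (- d - 1ℤ) e (lem₂ d)))) (BP.∧-zeroʳ (Q (d * d + + 4)))))))
          (trans (cong₂ _∧_ (Q-cong (+-cong {c = + 4} (*-cong e e) ≈-refl)) (R-cong (sub-cong {c = 1ℤ} (neg-cong e) ≈-refl)))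
            (sym (cong (_∧ c) (eqb-intro e))))
          where
          lem₁ : ∀ d → d - 1ℤ - 0ℤ ≡ 1ℤ * (d - 1ℤ)
          lem₁ = solve-∀
          lem₂ : ∀ d → 1ℤ - d * d - 0ℤ ≡ (- d - 1ℤ) * (d - 1ℤ)
          lem₂ = solve-∀
        by (inj₂ n) = trans (sym (∧-distrib-xor (discriminant d) (R (d - 1ℤ)) (R (- d - 1ℤ))))
          (trans (cong (discriminant d ∧_) (trans (sym (R-* (n ∘ sub≈0⁻) n′)) (R-cong (≡⇒≈ (lem₁ d)))))
            (trans (sym (BP.xor-identityʳ _)) (cong (g (d * d) xor_) (sym (cong (_∧ c) (eqb-false n))))))
          where
          lem₁ : ∀ d → (d - 1ℤ) * (- d - 1ℤ) ≡ 1ℤ - d * d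
          lem₁ = solve-∀
          lem₂ : ∀ d → d - - 1ℤ ≡ -1ℤ * (- d - 1ℤ - 0ℤ)
          lem₂ = solve-∀
          n′ : - d - 1ℤ ≉ 0ℤ
          n′ z = n (low-unique (low-nat k<h) (low-nat 0<h) (inj₂ (combination₁ -1ℤ z (lem₂ d))))

      first : ⊕.sum h (λ k → g (+ suc k * + suc k)) ≡ N false false false
      first = trans (S-squares g-cong) (trans (sym (S-perm {λ x → x + 1ℤ} {G} (λ e → +-cong e ≈-refl)
                (λ e → cong₂ _∧_ (Q-cong e) (g-cong e)) (λ x → x - 1ℤ) (λ x → ≡⇒≈ (lem x))
                (λ {a} {b} e → combination₁ 1ℤ e (lem₁ a b)))) (S-cong shift))
        where
        G : ℤ → Bool
        G X = Q X ∧ g X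
        lem : ∀ x → x - 1ℤ + 1ℤ ≡ x
        lem = solve-∀
        lem₁ : ∀ a b → a - b ≡ 1ℤ * (a + 1ℤ - (b + 1ℤ))
        lem₁ = solve-∀
        shift : ∀ x → G (x + 1ℤ) ≡ squares x
        shift x = trans (cong (Q (x + 1ℤ) ∧_) (cong₂ _∧_ (Q-cong (≡⇒≈ (lem₂ x))) (trans (R-cong (≡⇒≈ (lem₃ x))) (negative x (zero? x)))))
                        (rotate (Q (x + 1ℤ)) (Q (x + + 5)) (Q x))
          where
          lem₂ : ∀ x → x + 1ℤ + + 4 ≡ x + + 5
          lem₂ = solve-∀
          lem₃ : ∀ x → 1ℤ - (x + 1ℤ) ≡ - x
          lem₃ = solve-∀
          negative : ∀ x → (x ≈ 0ℤ) ⊎ (x ≉ 0ℤ) → R (- x) ≡ Q x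
          negative x (inj₁ z) = trans (R-0 (neg-cong z)) (sym (Q-0 z))
          negative x (inj₂ n) = trans (R-neg n) (trans (cong (_xor R x) R-1) (sym (Q-notR n)))
          rotate : ∀ a b c → a ∧ (b ∧ c) ≡ c ∧ (a ∧ b)
          rotate a b c = trans (sym (BP.∧-assoc a b c)) (BP.∧-comm (a ∧ b) c)

      second : ⊕.sum h (λ k → eqb (+ suc k) 1ℤ ∧ c) ≡ c
      second = trans (⊕.sum-single h 0 {λ k → eqb (+ suc k) 1ℤ ∧ c} 0<h λ k k<h k≢0 → cong (_∧ c) (eqb-false λ e →
                 k≢0 (ℕP.suc-injective (residue-unique (ℕP.≤-<-trans k<h h<p) 1<p e))))
               (cong (_∧ c) (eqb-intro {1ℤ} ≈-refl))

    R-∏ : ∀ n {f} → (∀ i → i < n → f i ≉ 0ℤ) → R (∏.sum n f) ≡ ⊕.sum n (λ i → R (f i))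
    R-∏ zero    e = R-square 1ℤ
    R-∏ (suc n) {f} e = trans (R-* (e 0 (s≤s z≤n)) (∏-nonzero n λ i i<n → e (suc i) (s≤s i<n)))
      (cong (R (f 0) xor_) (R-∏ n λ i i<n → e (suc i) (s≤s i<n)))

    R-^ : ∀ a n → a ≉ 0ℤ → R (a ^ n) ≡ odd n ∧ R a
    R-^ a zero    _  = R-square 1ℤ
    R-^ a (suc n) a≉0 = trans (R-* a≉0 (^≉0 n)) (trans (cong (R a xor_) (R-^ a n a≉0)) (lem (R a) (odd n)))
      where
      ^≉0 : ∀ n → a ^ n ≉ 0ℤ
      ^≉0 zero    = 1≉0
      ^≉0 (suc n) = *-nonzero {a} {a ^ n} a≉0 (^≉0 n)
      lem : ∀ a b → a xor (b ∧ a) ≡ not b ∧ a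
      lem true  true  = refl
      lem true  false = refl
      lem false true  = refl
      lem false false = refl

    eval-cong : ∀ cs {x y} → x ≈ y → eval cs x ≈ eval cs y
    eval-cong []       e = ≈-refl
    eval-cong (c ∷ cs) e = +-cong {c} ≈-refl (*-cong e (eval-cong cs e))

    eval-lucas-roots : ∀ {t t′} → t * t′ ≈ -1ℤ → ∀ n → eval (lucas n) (t + t′) ≈ t ^ suc n + t′ ^ suc n
    eval-lucas-roots {t} {t′} tt′ 0 = ≡⇒≈ (lem t t′)
      where
      lem : ∀ t t′ → 0ℤ + (t + t′) * 1ℤ ≡ t * 1ℤ + t′ * 1ℤ
      lem = solve-∀
    eval-lucas-roots {t} {t′} tt′ 1 = combination₁ (+ 2) tt′ (lem t t′)
      where
      lem : ∀ t t′ → + 2 + (t + t′) * (0ℤ + (t + t′) * 1ℤ) - (t * (t * 1ℤ) + t′ * (t′ * 1ℤ)) ≡ + 2 * (t * t′ - -1ℤ)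
      lem = solve-∀
    eval-lucas-roots {t} {t′} tt′ (suc (suc n)) = ≈-trans (≡⇒≈ (eval-lucas n (t + t′)))
        (≈-trans (+-cong (*-cong {t + t′} ≈-refl (eval-lucas-roots {t} {t′} tt′ (suc n))) (eval-lucas-roots {t} {t′} tt′ n))
          (combination₁ (t ^ suc n + t′ ^ suc n) tt′ (lem t t′ (t ^ suc n) (t′ ^ suc n))))
      where
      lem : ∀ t t′ x y → (t + t′) * (t * x + t′ * y) + (x + y) - (t * (t * x) + t′ * (t′ * y)) ≡ (x + y) * (t * t′ - -1ℤ)
      lem = solve-∀

    -- At 1 the polynomial belongs to the pair φ, φ̄ with sum 1 and product -1; here this is checked
    -- through the common recurrence.
    eval-lucas-trace : ∀ n → eval (lucas n) 1ℤ ≡ trace (φ̄ ^₁ suc n)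
    eval-lucas-trace 0             = refl
    eval-lucas-trace 1             = refl
    eval-lucas-trace (suc (suc n)) = trans (eval-lucas n 1ℤ)
        (trans (cong₂ (λ a b → 1ℤ * a + b) (eval-lucas-trace (suc n)) (eval-lucas-trace n)) (step (φ̄ ^₁ suc n)))
      where
      step : ∀ x → 1ℤ * trace (φ̄ E₁.* x) + trace x ≡ trace (φ̄ E₁.* (φ̄ E₁.* x))
      step (a , b) = lem a b
        where
        lem : ∀ a b → 1ℤ * (+ 2 * (1ℤ * a + 1ℤ * b * 1ℤ) - (1ℤ * b + 1ℤ * a + 1ℤ * b * -1ℤ)) + (+ 2 * a - b) ≡
          + 2 * (1ℤ * (1ℤ * a + 1ℤ * b * 1ℤ) + 1ℤ * (1ℤ * b + 1ℤ * a + 1ℤ * b * -1ℤ) * 1ℤ) -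
          (1ℤ * (1ℤ * b + 1ℤ * a + 1ℤ * b * -1ℤ) + 1ℤ * (1ℤ * a + 1ℤ * b * 1ℤ) + 1ℤ * (1ℤ * b + 1ℤ * a + 1ℤ * b * -1ℤ) * -1ℤ)
        lem = solve-∀

    root : ℕ → ℤ
    root k = difference (+ suc k * + suc k)

    -- For a square t the number - 1/t is a nonsquare, so t^h + (- 1/t)^h = 1 - 1 = 0. Thus the
    -- Lucas polynomial of degree h has the h distinct roots t - 1/t, and its value at 1 is the
    -- product of the 1 - root. No root is 1, since 1 has discriminant 5, a nonsquare. Reversing the
    -- sign of all h factors gives the `not`, because h is odd.
    nonresidue-five : R (+ 5) ≡ true → difference-parity ≡ not (R (eval (lucas h₁) 1ℤ))
    nonresidue-five R5 = begin
      difference-parity ≡⟨ sym (S-squares {λ t → R (difference t - 1ℤ)} (λ e → R-cong (sub-cong (difference-cong e) ≈-refl))) ⟩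
      ⊕.sum h (λ k → R (root k - 1ℤ)) ≡⟨ ⊕.sum-cong h negate ⟩
      ⊕.sum h (λ k → true xor R (1ℤ - root k)) ≡⟨ ⊕.sum-∙ h (λ _ → true) (λ k → R (1ℤ - root k)) ⟩
      ⊕.sum h (λ _ → true) xor ⊕.sum h (λ k → R (1ℤ - root k)) ≡⟨ cong₂ _xor_ (trans (⊕-const h) (trans (sym R-minus-one) R-1)) (sym (R-∏ h nonzero)) ⟩
      not (R (∏.sum h (λ k → 1ℤ - root k))) ≡⟨ cong not (R-cong (≈-sym (vieta h (lucas h₁) root (trans (length-lucas h₁) h≡) vanish distinct 1ℤ))) ⟩
      not (R (eval (lucas h₁) 1ℤ)) ∎
      where
      open ≡-Reasoning
      suc≉0 : ∀ k → k < h → + suc k ≉ 0ℤ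
      suc≉0 k k<h = nat≉0 (s≤s z≤n) (ℕP.≤-<-trans k<h h<p)

      Qk : ∀ k → k < h → Q (+ suc k * + suc k) ≡ true
      Qk k k<h = Q-intro (+ suc k) (*-nonzero {+ suc k} {+ suc k} (suc≉0 k k<h) (suc≉0 k k<h)) ≈-refl

      nonzero : ∀ k → k < h → 1ℤ - root k ≉ 0ℤ
      nonzero k k<h z = true≢false R5 (Q⇒R (trans (sym (discriminant-cong {root k} {1ℤ} (combination₁ -1ℤ z (lem (root k)))))
          (discriminant-difference (+ suc k * + suc k) (Qk k k<h))))
        where
        lem : ∀ r → r - 1ℤ ≡ -1ℤ * (1ℤ - r - 0ℤ)
        lem = solve-∀

      negate : ∀ k → k < h → R (root k - 1ℤ) ≡ true xor R (1ℤ - root k)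
      negate k k<h = trans (R-cong (≡⇒≈ (lem (root k)))) (trans (R-neg (nonzero k k<h)) (cong (_xor R (1ℤ - root k)) R-1))
        where
        lem : ∀ r → r - 1ℤ ≡ - (1ℤ - r)
        lem = solve-∀

      vanish : ∀ k → k < h → eval (lucas h₁) (root k) ≈ 0ℤ
      vanish k k<h = ≈-trans (eval-lucas-roots {t} { - inv t} tt′ h₁)
          (≈-trans (+-cong (power t t≉0 (Q⇒R (Qk k k<h))) (power (- inv t) t′≉0 Rt′)) (≡⇒≈ refl))
        where
        t : ℤ
        t = + suc k * + suc k
        t≉0 : t ≉ 0ℤ
        t≉0 = Q⇒≉0 (Qk k k<h)
        tt′ : t * - inv t ≈ -1ℤ
        tt′ = combination₁ -1ℤ (*-inv t≉0) (lem t (inv t))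
          where
          lem : ∀ t i → t * - i - -1ℤ ≡ -1ℤ * (t * i - 1ℤ)
          lem = solve-∀
        t′≉0 : - inv t ≉ 0ℤ
        t′≉0 = proj₁ (R-ratio t (- inv t) tt′ -1≉0)
        Rt′ : R (- inv t) ≡ true
        Rt′ = trans (proj₂ (R-ratio t (- inv t) tt′ -1≉0)) (cong₂ _xor_ R-1 (Q⇒R (Qk k k<h)))
        power : ∀ a {b} → a ≉ 0ℤ → R a ≡ b → a ^ suc h₁ ≈ sgn b
        power a n r = ≈-trans (≡⇒≈ (cong (a ^_) h≡)) (≈-trans (euler n) (≡⇒≈ (cong sgn r)))

      distinct : ∀ i j → i < j → j < h → root i ≉ root j
      distinct i j i<j j<h e = ℕP.<⇒≢ i<j (ℕP.suc-injective (residue-unique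
          (ℕP.≤-<-trans i<h h<p) (ℕP.≤-<-trans j<h h<p)
          (low-unique (low-nat i<h) (low-nat j<h) (square-eq (difference-injective _ _ (Qk i i<h) (Qk j j<h) e)))))
        where
        i<h : i < h
        i<h = ℕP.<-trans i<j j<h

    -- The correction term in `difference-parity≡` vanishes with Q 5, so the count is the symbol of
    -- the Lucas number V. `trace-power` gives 5^k V = ± 5, and 5^k contributes the parity of k.
    N-five-nonsquare : R (+ 5) ≡ true → ∀ u q k → p ≡ toNat u ℕ.+ q ℕ.* 10 → suc h ≡ 2 ℕ.* k →
                       N false false false ≡ odd k xor isThree u
    N-five-nonsquare R5 u q k eq h≡2k = trans N≡V (by u relation (trans (sym R5) (R-5 u q eq)))
      where
      V : ℤ
      V = eval (lucas h₁) 1ℤ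

      N≡V : N false false false ≡ R V
      N≡V = trans (sym (BP.xor-identityʳ _)) (BP.not-injective (trans (sym (trans difference-parity≡
              (cong (λ z → not (N false false false xor (z ∧ R (- + 2)))) (trans (Q-notR 5≉0) (cong not R5)))))
              (nonresidue-five R5)))

      relation : (+ 5) ^ k * V ≈ - trace (φ E₁.* (factor u E₁.* Δ))
      relation = ≈-trans (≡⇒≈ (cong ((+ 5) ^ k *_) (trans (eval-lucas-trace h₁) (cong (λ n → trace (φ̄ ^₁ n)) h≡))))
        (trace-power u q k eq h≡2k)

      R-V : ∀ {w} → (+ 5) ^ k * V ≈ w → w ≉ 0ℤ → ∀ b → R w ≡ b → R V ≡ odd k xor b
      R-V e n b r = trans (proj₂ (R-ratio ((+ 5) ^ k) V e n))
        (trans (cong₂ _xor_ r (trans (R-^ (+ 5) k 5≉0) (trans (cong (odd k ∧_) R5) (BP.∧-identityʳ (odd k))))) (BP.xor-comm b (odd k)))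

      by : ∀ u → (+ 5) ^ k * V ≈ - trace (φ E₁.* (factor u E₁.* Δ)) → true ≡ five-bit u →
           R V ≡ odd k xor isThree u
      -- The negated trace computes to 5 for `u3` and to -5 for `u7`; their bits are true and false
      -- because -1 and 5 are both nonsquares.
      by u3 e _ = R-V e 5≉0 true R5
      by u7 e _ = R-V e (neg≉0 5≉0) false (trans (R-neg 5≉0) (cong₂ _xor_ R-1 R5))

  -- Quadratic forms over the triangle i < j

  Tri : (ℤ → ℤ → ℤ) → Bool
  Tri f = triangle h (λ i j → R (f (+ suc i) (+ suc j)))

  -- The numbers c + 2, c + 4, …, c + 2n and c + 1, c + 2, …, c + n agree modulo p up to sign.
  slice : ∀ (G : ℤ → Bool) → (∀ {a b} → a ≈ b → G a ≡ G b) → (∀ a → G (- a) ≡ G a) →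
          ∀ n c → h ≡ c ℕ.+ n →
          ⊕.sum n (λ k → G (+ c + + 2 * + suc k)) ≡ ⊕.sum n (λ k → G (+ c + + suc k))
  slice G G≈ G- zero    c h≡ = refl
  slice G G≈ G- (suc n) c h≡ = begin
    ⊕.sum (suc n) (λ k → G (+ c + + 2 * + suc k)) ≡⟨ ⊕.sum-snoc n (λ k → G (+ c + + 2 * + suc k)) ⟩
    ⊕.sum n (λ k → G (+ c + + 2 * + suc k)) xor G (+ c + + 2 * + suc n) ≡⟨ BP.xor-comm _ (G (+ c + + 2 * + suc n)) ⟩
    -- With h = c + n + 1 the largest number c + 2 (n + 1) is p - (c + 1). The others, read
    -- backwards, are p minus the numbers (c + 1) + 2, (c + 1) + 4, ..., which is the situation for
    -- c + 1.
    G (+ c + + 2 * + suc n) xor ⊕.sum n (λ k → G (+ c + + 2 * + suc k)) ≡⟨ cong₂ _xor_ (reflect (+ suc n) (+ 1) p-1) (trans (⊕.sum-reverse n (λ k → G (+ c + + 2 * + suc k))) (⊕.sum-cong n reflected)) ⟩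
    G (+ c + + 1) xor ⊕.sum n (λ k → G (+ suc c + + 2 * + suc k)) ≡⟨ cong (G (+ c + + 1) xor_) (slice G G≈ G- n (suc c) (trans h≡ (ℕP.+-suc c n))) ⟩
    G (+ c + + 1) xor ⊕.sum n (λ k → G (+ suc c + + suc k)) ≡⟨ cong (G (+ c + + 1) xor_) (⊕.sum-cong n λ k _ → cong G (cong +_ (sym (ℕP.+-suc c (suc k))))) ⟩
    ⊕.sum (suc n) (λ k → G (+ c + + suc k)) ∎
    where
    open ≡-Reasoning
    p-2c : + p ≡ + 2 * (+ c + + suc n) + + 1
    p-2c = trans (cong +_ (trans p≡ (cong (λ m → suc (m ℕ.+ m)) h≡))) (lem (+ (c ℕ.+ suc n)))
      where
      lem : ∀ m → 1ℤ + (m + m) ≡ + 2 * m + + 1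
      lem = solve-∀

    reflect : ∀ x y → + c + + 2 * x + (+ c + y) ≡ + p → G (+ c + + 2 * x) ≡ G (+ c + y)
    reflect x y e = trans (sym (G- _)) (G≈ (combination₁ -1ℤ p≈0 (trans (lem (+ c + + 2 * x) (+ c + y)) (cong (λ q → -1ℤ * (q - 0ℤ)) e))))
      where
      lem : ∀ a b → - a - b ≡ -1ℤ * (a + b - 0ℤ)
      lem = solve-∀

    p-1 : + c + + 2 * + suc n + (+ c + + 1) ≡ + p
    p-1 = trans (lem (+ c) (+ suc n)) (sym p-2c)
      where
      lem : ∀ c m → c + + 2 * m + (c + + 1) ≡ + 2 * (c + m) + + 1
      lem = solve-∀

    reflected : ∀ k → k < n → G (+ c + + 2 * + suc (n ℕ.∸ suc k)) ≡ G (+ suc c + + 2 * + suc k)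
    reflected k k<n = trans (reflect (+ suc (n ℕ.∸ suc k)) (1ℤ + + 2 * + suc k)
        (trans (lem (+ c) (+ suc (n ℕ.∸ suc k)) (+ suc k)) (trans (cong (λ m → + 2 * (+ c + + m) + + 1)
          (cong suc (ℕP.m∸n+n≡m k<n))) (sym p-2c))))
      (cong G (lem′ (+ c) (+ 2 * + suc k)))
      where
      lem : ∀ c m k → c + + 2 * m + (c + (+ 1 + + 2 * k)) ≡ + 2 * (c + (m + k)) + + 1
      lem = solve-∀
      lem′ : ∀ c m → c + (1ℤ + m) ≡ 1ℤ + c + m
      lem′ = solve-∀

  -- For fixed i, evenness in j and `slice` with c = i let j run through i + 2, i + 4, ... instead
  -- of i + 1, i + 2, .... Writing j = i + 2 k, a = i + k, b = k, one gets i = a - b and j = a + b,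
  -- and the pairs (b , a) fill the triangle b < a ≤ h.
  Tri-rotate : ∀ f g → (∀ i {j j′} → j ≈ j′ → f i j ≈ f i j′) → (∀ i j → f i (- j) ≡ f i j) →
               (∀ a b → f (a - b) (a + b) ≡ g b a) → Tri f ≡ Tri g
  Tri-rotate f g f≈ f- fg = begin
    Tri f ≡⟨ triangle≡rows h _ ⟩
    rows h (λ i j → R (f (+ suc i) (+ suc j))) ≡⟨ ⊕.sum-cong h row ⟩
    rows h (λ i j → R (g (+ suc (j ℕ.∸ suc i)) (+ suc j))) ≡⟨ sym (triangle≡rows h _) ⟩
    triangle h (λ i j → R (g (+ suc (j ℕ.∸ suc i)) (+ suc j))) ≡⟨ sym (triangle-reverse h _) ⟩
    Tri g ∎
    where
    open ≡-Reasoning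
    row : ∀ i → i < h → ⊕.sum (h ℕ.∸ suc i) (λ k → R (f (+ suc i) (+ suc (suc i ℕ.+ k)))) ≡
                        ⊕.sum (h ℕ.∸ suc i) (λ k → R (g (+ suc (suc i ℕ.+ k ℕ.∸ suc i)) (+ suc (suc i ℕ.+ k))))
    row i i<h = trans (⊕.sum-cong (h ℕ.∸ suc i) λ k _ → cong (λ m → R (f (+ suc i) (+ m))) (sym (ℕP.+-suc (suc i) k)))
      (trans (sym (slice (λ j → R (f (+ suc i) j)) (λ e → R-cong (f≈ (+ suc i) e)) (λ j → cong R (f- (+ suc i) j))
               (h ℕ.∸ suc i) (suc i) (sym (ℕP.m+[n∸m]≡n i<h))))
        (⊕.sum-cong (h ℕ.∸ suc i) λ k _ → cong R (trans (cong₂ f (lem (+ suc i) (+ suc k)) (lem′ (+ suc i) (+ suc k)))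
          (trans (fg (+ suc i + + suc k) (+ suc k)) (cong₂ g (cong (λ m → + suc m) (sym (ℕP.m+n∸m≡n (suc i) k)))
            (cong +_ (ℕP.+-suc (suc i) k)))))))
      where
      lem : ∀ i k → i ≡ i + k - k
      lem = solve-∀
      lem′ : ∀ i k → i + + 2 * k ≡ i + k + k
      lem′ = solve-∀

  -- For fixed j the map i ↦ j - i permutes 1, ..., j - 1.
  Tri-reflect : ∀ f g → (∀ i j → f (j - i) j ≡ g i j) → Tri f ≡ Tri g
  Tri-reflect f g fg = trans (triangle-reverse h _) (triangle-cong h λ i j i<j j<h →
      cong R (trans (cong (λ x → f x (+ suc j)) (difference-nat i j i<j)) (fg (+ suc i) (+ suc j))))
    where
    difference-nat : ∀ i j → i < j → + suc (j ℕ.∸ suc i) ≡ + suc j - + suc i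
    difference-nat i j i<j = sym (trans (ℤP.m-n≡m⊖n (suc j) (suc i)) (trans (ℤP.⊖-≥ (s≤s (ℕP.<⇒≤ i<j)))
      (cong +_ (ℕP.+-∸-assoc 1 i<j))))

  ∧-sum : ∀ b n f → b ∧ ⊕.sum n f ≡ ⊕.sum n (λ i → b ∧ f i)
  ∧-sum true  n f = refl
  ∧-sum false n f = sym (⊕.sum-ε n λ _ _ → refl)

  S-low : ∀ (f : ℤ → Bool) → S (λ x → low x ∧ f x) ≡ ⊕.sum h (λ k → f (+ suc k))
  S-low f = trans (S-cong λ x → sym (▸-∧ (low x) (f x))) (Half.sum-low _xor_ false xor-isCM f)

  S-scale : ∀ {f : ℤ → Bool} c → c ≉ 0ℤ → (∀ {a b} → a ≈ b → f a ≡ f b) → S (λ t → f (t * c)) ≡ S f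
  S-scale {f} c c≉0 f≈ = S-perm {λ t → t * c} {f} (λ e → *-cong e ≈-refl) f≈ (λ d → d * inv c)
    (λ d → combination₁ d (*-inv c≉0) (lem c d (inv c)))
    (λ {t} {t′} e → cancelˡ c c≉0 (≈-trans (≡⇒≈ (ℤP.*-comm c t)) (≈-trans e (≡⇒≈ (ℤP.*-comm t′ c)))))
    where
    lem : ∀ c d i → d * i * c - d ≡ d * (c * i - 1ℤ)
    lem = solve-∀

  suc≉0 : ∀ k → k < h → + suc k ≉ 0ℤ
  suc≉0 k k<h = nat≉0 (s≤s z≤n) (ℕP.≤-<-trans k<h h<p)

  -- Parity of the number of pairs in [1 , h]² with ratio t.
  A : ℤ → Bool
  A t = ⊕.sum h (λ j → low (t * + suc j))

  -- The multiples of t in the lower half are h minus those counted by Gauss's exponent, and the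
  -- parity of h is the bit of -1.
  A≡ : ∀ {t} → t ≉ 0ℤ → A t ≡ R -1ℤ xor R t
  A≡ {t} t≉0 = trans (⊕.sum-cong h λ j j<h → low-hi (*-nonzero {t} {+ suc j} t≉0 (suc≉0 j j<h)))
    (trans (⊕.sum-∙ h (λ _ → true) (λ j → hi (t * + suc j))) (cong₂ _xor_ (trans (⊕-const h) (sym R-minus-one)) (sym (R-γ t≉0))))

  A-0 : ∀ {t} → t ≈ 0ℤ → A t ≡ false
  A-0 {t} z = ⊕.sum-ε h λ j _ → trans (low-cong (≈-trans (*-cong z (≈-refl {+ suc j})) (≡⇒≈ (ℤP.*-zeroˡ (+ suc j))))) (cong (λ r → not (r ≡ᵇ 0) ∧ not (hi 0ℤ)) red-0)

  S-ratio : ∀ (θ : ℤ → Bool) (b : ℤ → ℤ → Bool) →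
            ⊕.sum h (λ j → S (λ t → θ t ∧ b t (+ suc j))) ≡ S (λ t → θ t ∧ ⊕.sum h (λ j → b t (+ suc j)))
  S-ratio θ b = trans (⊕.sum-swap h p (λ j i → θ (+ i) ∧ b (+ i) (+ suc j)))
    (S-cong λ t → sym (∧-sum (θ t) h (λ j → b t (+ suc j))))

  below : ℤ → ℤ → Bool
  below t J = low (t * J) ∧ lt (t * J) J

  B : ℤ → Bool
  B t = ⊕.sum h (λ j → below t (+ suc j))

  B-cong : ∀ {a b} → a ≈ b → B a ≡ B b
  B-cong e = ⊕.sum-cong h λ j _ → cong₂ _∧_ (low-cong (*-cong e ≈-refl)) (lt-cong (*-cong e ≈-refl) ≈-refl)

  lt-irrefl : ∀ {a b} → a ≈ b → lt a b ≡ false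
  lt-irrefl {a} {b} e = trans (lt-cong e ≈-refl) (<ᵇ-intro-false {red b} ℕP.≤-refl)

  -- `B t` counts the pairs i < j of ratio t. Exchanging i and j turns `B (inv t)` into the count of
  -- the pairs i > j of ratio t, and i = j is impossible for t ≠ 1, so together they are the pairs
  -- counted by `A t`.
  B-inv : ∀ {t} → t ≉ 0ℤ → t ≉ 1ℤ → B t xor B (inv t) ≡ R -1ℤ xor R t
  B-inv {t} t≉0 t≉1 = trans (cong (B t xor_) flipped)
    (trans (sym (⊕.sum-∙ h (λ j → below t (+ suc j)) (λ j → low (t * + suc j) ∧ lt (+ suc j) (t * + suc j))))
      (trans (⊕.sum-cong h pointwise) (A≡ t≉0)))
    where
    flipped : B (inv t) ≡ ⊕.sum h (λ j → low (t * + suc j) ∧ lt (+ suc j) (t * + suc j))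
    flipped = begin
      B (inv t) ≡⟨ sym (S-low (below (inv t))) ⟩
      S H ≡⟨ sym (S-scale {H} t t≉0 (λ e → cong₂ _∧_ (low-cong e) (cong₂ _∧_ (low-cong (*-cong {inv t} ≈-refl e)) (lt-cong (*-cong {inv t} ≈-refl e) e)))) ⟩
      S (λ m → H (m * t)) ≡⟨ S-cong swap ⟩
      S (λ m → low m ∧ (low (t * m) ∧ lt m (t * m))) ≡⟨ S-low (λ m → low (t * m) ∧ lt m (t * m)) ⟩
      ⊕.sum h (λ j → low (t * + suc j) ∧ lt (+ suc j) (t * + suc j)) ∎
      where
      open ≡-Reasoning
      H : ℤ → Bool
      H k = low k ∧ below (inv t) k
      ∧-rotate : ∀ a b c → a ∧ (b ∧ c) ≡ b ∧ (a ∧ c)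
      ∧-rotate true  true  c = refl
      ∧-rotate true  false c = refl
      ∧-rotate false true  c = refl
      ∧-rotate false false c = refl
      swap : ∀ m → H (m * t) ≡ low m ∧ (low (t * m) ∧ lt m (t * m))
      swap m = trans (cong₂ _∧_ (low-cong (≡⇒≈ (ℤP.*-comm m t))) (cong₂ _∧_ (low-cong e) (lt-cong e (≡⇒≈ (ℤP.*-comm m t)))))
                     (∧-rotate (low (t * m)) (low m) (lt m (t * m)))
        where
        e : inv t * (m * t) ≈ m
        e = combination₁ m (*-inv t≉0) (lem t m (inv t))
          where
          lem : ∀ t m i → i * (m * t) - m ≡ m * (t * i - 1ℤ)
          lem = solve-∀
    pointwise : ∀ j → j < h → below t (+ suc j) xor (low (t * + suc j) ∧ lt (+ suc j) (t * + suc j)) ≡ low (t * + suc j)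
    pointwise j j<h = trans (sym (∧-distrib-xor (low x) (lt x J) (lt J x))) (trans (cong (low x ∧_) one) (BP.∧-identityʳ (low x)))
      where
      J x : ℤ
      J = + suc j
      x = t * J
      one : lt x J xor lt J x ≡ true
      one = trans (sym (BP.xor-identityʳ _)) (trans (cong ((lt x J xor lt J x) xor_) (sym (eqb-false {x} {J} λ e →
          t≉1 (cancelˡ J (suc≉0 j j<h) (≈-trans (≡⇒≈ (ℤP.*-comm J t)) (≈-trans e (≡⇒≈ (sym (ℤP.*-identityʳ J)))))))))
        (trichotomy x J))

  B-fixed : ∀ {t} → t ≈ inv t → B t ≡ false
  B-fixed {t} e = ⊕.sum-ε h λ j j<h → vanish j j<h (zero? t)
    where
    vanish : ∀ j → j < h → (t ≈ 0ℤ) ⊎ (t ≉ 0ℤ) → below t (+ suc j) ≡ false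
    vanish j j<h (inj₁ z) = cong (_∧ lt (t * + suc j) (+ suc j)) (BP.¬-not λ l → low≉0 l
      (≈-trans (*-cong z (≈-refl {+ suc j})) (≡⇒≈ (ℤP.*-zeroˡ (+ suc j)))))
    vanish j j<h (inj₂ n) = [ one , minus-one ]′ (square-eq {t} {1ℤ} (≈-trans (*-cong {t} ≈-refl e) (*-inv n)))
      where
      one : t ≈ 1ℤ → below t (+ suc j) ≡ false
      one e = trans (cong (low (t * + suc j) ∧_) (lt-irrefl (≈-trans (*-cong e (≈-refl {+ suc j})) (≡⇒≈ (ℤP.*-identityˡ (+ suc j)))))) (BP.∧-zeroʳ _)
      minus-one : t ≈ - 1ℤ → below t (+ suc j) ≡ false
      minus-one e = cong (_∧ lt (t * + suc j) (+ suc j)) (trans (low-cong (≈-trans (*-cong e (≈-refl {+ suc j})) (≡⇒≈ (ℤP.-1*i≡-i (+ suc j)))))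
        (trans (low-neg (suc≉0 j j<h)) (trans (sym (BP.not-involutive _)) (cong not (trans (sym (low-hi (suc≉0 j j<h))) (low-nat j<h))))))

  module _ (α β : ℤ) where

    form : ℤ → ℤ → ℤ
    form i j = α * (i * i + j * j) + β * (i * j)

    ψ : ℤ → Bool
    ψ t = R (α * (t * t + 1ℤ) + β * t)

    ψ-cong : ∀ {a b} → a ≈ b → ψ a ≡ ψ b
    ψ-cong e = R-cong (+-cong (*-cong {α} ≈-refl (+-cong (*-cong e e) ≈-refl)) (*-cong {β} ≈-refl e))

    form-cong : ∀ {a b} j → a ≈ b → form a j ≈ form b j
    form-cong {a} {b} j e = +-cong (*-cong {α} ≈-refl (+-cong (*-cong e e) ≈-refl)) (*-cong {β} ≈-refl (*-cong e (≈-refl {j})))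

    -- With i = t j the form is j² (α (t² + 1) + β t), so its symbol depends on t alone and can be
    -- taken out of the count of the pairs of ratio t.
    Tri-ratio : Tri form ≡ S (λ t → ψ t ∧ B t)
    Tri-ratio = trans (⊕.sum-cong h inner) (S-ratio ψ below)
      where
      open ≡-Reasoning
      inner : ∀ j → j < h → ⊕.sum j (λ i → R (form (+ suc i) (+ suc j))) ≡ S (λ t → ψ t ∧ below t (+ suc j))
      inner j j<h = begin
        ⊕.sum j (λ i → R (form (+ suc i) J)) ≡⟨ sym (<ᵇ-sum h j (λ i → R (form (+ suc i) J)) (ℕP.<⇒≤ j<h)) ⟩
        ⊕.sum h (λ k → (k <ᵇ j) ∧ R (form (+ suc k) J)) ≡⟨ ⊕.sum-cong h (λ k k<h → cong (_∧ R (form (+ suc k) J)) (sym (lt-nat k k<h))) ⟩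
        ⊕.sum h (λ k → lt (+ suc k) J ∧ R (form (+ suc k) J)) ≡⟨ sym (S-low (λ x → lt x J ∧ R (form x J))) ⟩
        S H ≡⟨ sym (S-scale {H} J (suc≉0 j j<h) (λ e → cong₂ _∧_ (low-cong e) (cong₂ _∧_ (lt-cong e ≈-refl) (R-cong (form-cong J e))))) ⟩
        S (λ t → H (t * J)) ≡⟨ S-cong pointwise ⟩
        S (λ t → ψ t ∧ below t J) ∎
        where
        J : ℤ
        J = + suc j
        H : ℤ → Bool
        H x = low x ∧ (lt x J ∧ R (form x J))
        lt-nat : ∀ k → k < h → lt (+ suc k) J ≡ (k <ᵇ j)
        lt-nat k k<h = cong₂ _<ᵇ_ (red-small (ℕP.≤-<-trans k<h h<p)) (red-small (ℕP.≤-<-trans j<h h<p))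
        pointwise : ∀ t → H (t * J) ≡ ψ t ∧ below t J
        pointwise t = trans (sym (BP.∧-assoc (low (t * J)) (lt (t * J) J) (R (form (t * J) J))))
            (trans (BP.∧-comm (below t J) (R (form (t * J) J))) (cong (_∧ below t J)
              (trans (R-cong (≡⇒≈ (lem α β t J))) (R-square-* J (α * (t * t + 1ℤ) + β * t) (suc≉0 j j<h)))))
          where
          lem : ∀ α β t J → α * (t * J * (t * J) + J * J) + β * (t * J * J) ≡ J * J * (α * (t * t + 1ℤ) + β * t)
          lem = solve-∀

    -- Only one of t and 1/t is kept: the pairs (i , j) and (j , i) have inverse ratios.
    Tri-half : Tri form ≡ S (λ t → lt t (inv t) ∧ (ψ t ∧ (R -1ℤ xor R t)))
    Tri-half = begin
      Tri form ≡⟨ Tri-ratio ⟩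
      S F ≡⟨ S-cong (λ t → split (lt t (inv t)) (lt (inv t) t) (eqb t (inv t)) (F t) (trichotomy t (inv t)) (λ e → trans (cong (ψ t ∧_) (B-fixed (eqb-true e))) (BP.∧-zeroʳ (ψ t)))) ⟩
      S (λ t → up t xor down t) ≡⟨ S-xor up down ⟩
      S up xor S down ≡⟨ cong (S up xor_) (sym (S-perm {inv} {down} inv-cong down-cong inv inv-inv (λ e → ≈-trans (≈-sym (inv-inv _)) (≈-trans (inv-cong e) (inv-inv _))))) ⟩
      S up xor S (λ t → down (inv t)) ≡⟨ sym (S-xor up (λ t → down (inv t))) ⟩
      S (λ t → up t xor down (inv t)) ≡⟨ S-cong merge ⟩
      S (λ t → lt t (inv t) ∧ (ψ t ∧ (R -1ℤ xor R t))) ∎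
      where
      open ≡-Reasoning
      F up down : ℤ → Bool
      F    t = ψ t ∧ B t
      up   t = lt t (inv t) ∧ F t
      down t = lt (inv t) t ∧ F t

      F-cong : ∀ {a b} → a ≈ b → F a ≡ F b
      F-cong e = cong₂ _∧_ (ψ-cong e) (B-cong e)

      down-cong : ∀ {a b} → a ≈ b → down a ≡ down b
      down-cong e = cong₂ _∧_ (lt-cong (inv-cong e) e) (F-cong e)

      split : ∀ a b c d → (a xor b) xor c ≡ true → (c ≡ true → d ≡ false) → d ≡ (a ∧ d) xor (b ∧ d)
      split true  true  true  d _ z rewrite z refl = refl
      split true  false false true  _ _ = refl
      split true  false false false _ _ = refl
      split false true  false true  _ _ = refl
      split false true  false false _ _ = refl
      split false false true  d _ z rewrite z refl = refl

      ψ-inv : ∀ {t} → t ≉ 0ℤ → ψ (inv t) ≡ ψ t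
      ψ-inv {t} n = trans (sym (R-square-* t (α * (inv t * inv t + 1ℤ) + β * inv t) n))
          (R-cong (combination₁ (α * (t * inv t + 1ℤ) + β * t) (*-inv n) (lem α β t (inv t))))
        where
        lem : ∀ α β t i → t * t * (α * (i * i + 1ℤ) + β * i) - (α * (t * t + 1ℤ) + β * t) ≡ (α * (t * i + 1ℤ) + β * t) * (t * i - 1ℤ)
        lem = solve-∀

      merge : ∀ t → up t xor down (inv t) ≡ lt t (inv t) ∧ (ψ t ∧ (R -1ℤ xor R t))
      merge t = trans (cong (λ z → up t xor (z ∧ F (inv t))) (lt-cong (inv-inv t) ≈-refl))
          (trans (sym (∧-distrib-xor (lt t (inv t)) (F t) (F (inv t)))) (under (lt t (inv t)) refl))
        where
        under : ∀ b → lt t (inv t) ≡ b → b ∧ (F t xor F (inv t)) ≡ b ∧ (ψ t ∧ (R -1ℤ xor R t))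
        under false _ = refl
        under true  l = trans (cong (λ z → F t xor (z ∧ B (inv t))) (ψ-inv t≉0))
            (trans (sym (∧-distrib-xor (ψ t) (B t) (B (inv t)))) (cong (ψ t ∧_) (B-inv t≉0 t≉1)))
          where
          t≉0 : t ≉ 0ℤ
          t≉0 z = true≢false l (lt-irrefl (≈-trans z (≡⇒≈ (sym (inv-0 z)))))
          t≉1 : t ≉ 1ℤ
          t≉1 e = true≢false l (lt-irrefl (inv-unique {t} {t} (*-cong e e)))

    -- For w = t + 1/t the unordered pairs of distinct t, 1/t correspond to the w with w² - 4 a
    -- nonzero square. Since t (w - 2) = (t - 1)², t has the symbol of w - 2, and α (t² + 1) + β t
    -- is t (α w + β). The three conditions on t therefore prescribe the symbols of w - 2, w + 2 and
    -- α w + β.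
    Tri-trace : Tri form ≡ S (λ w → is (not (R -1ℤ)) (w - + 2) ∧ (is (not (R -1ℤ)) (w + + 2) ∧ is (R -1ℤ) (α * w + β)))
    Tri-trace = begin
      Tri form ≡⟨ Tri-half ⟩
      S (λ t → lt t (inv t) ∧ (ψ t ∧ (R -1ℤ xor R t))) ≡⟨ S-cong (λ t → under t (lt t (inv t)) refl) ⟩
      S (λ t → lt t (inv t) ∧ G (t + inv t)) ≡⟨ S-bij {λ t → lt t (inv t)} {disc} {λ t → t + inv t} {G}
          (λ e → lt-cong e (inv-cong e)) disc-cong (λ e → +-cong e (inv-cong e)) G-cong into onto inj ⟩
      S (λ w → disc w ∧ G w) ≡⟨ S-cong (λ w → pointwise w (zero? (w - + 2)) (zero? (w + + 2)) (zero? (α * w + β))) ⟩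
      S (λ w → is (not (R -1ℤ)) (w - + 2) ∧ (is (not (R -1ℤ)) (w + + 2) ∧ is (R -1ℤ) (α * w + β))) ∎
      where
      open ≡-Reasoning
      disc G : ℤ → Bool
      disc w = Q ((w - + 2) * (w + + 2))
      G w = (not (Z (α * w + β)) ∧ (R (w - + 2) xor R (α * w + β))) ∧ (R -1ℤ xor R (w - + 2))

      lin-cong : ∀ {a b} → a ≈ b → α * a + β ≈ α * b + β
      lin-cong e = +-cong (*-cong {α} ≈-refl e) (≈-refl {β})

      disc-cong : ∀ {a b} → a ≈ b → disc a ≡ disc b
      disc-cong e = Q-cong (*-cong (sub-cong e ≈-refl) (+-cong e ≈-refl))

      G-cong : ∀ {a b} → a ≈ b → G a ≡ G b
      G-cong e = cong₂ _∧_ (cong₂ _∧_ (cong not (Z-cong (lin-cong e))) (cong₂ _xor_ (R-cong (sub-cong e ≈-refl)) (R-cong (lin-cong e))))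
                           (cong (R -1ℤ xor_) (R-cong (sub-cong e ≈-refl)))

      module _ {t : ℤ} (l : lt t (inv t) ≡ true) where
        t≉0 : t ≉ 0ℤ
        t≉0 z = true≢false l (lt-irrefl (≈-trans z (≡⇒≈ (sym (inv-0 z)))))
        t²≉1 : t * t ≉ 1ℤ
        t²≉1 e = true≢false l (lt-irrefl (inv-unique {t} {t} e))
        ti : t * inv t ≈ 1ℤ
        ti = *-inv t≉0
        minus : t * (t + inv t - + 2) ≈ (t - 1ℤ) * (t - 1ℤ)
        minus = combination₁ 1ℤ ti (lem t (inv t))
          where
          lem : ∀ t i → t * (t + i - + 2) - (t - 1ℤ) * (t - 1ℤ) ≡ 1ℤ * (t * i - 1ℤ)
          lem = solve-∀
        t-1≉0 : t - 1ℤ ≉ 0ℤ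
        t-1≉0 z = t²≉1 (*-cong (sub≈0⁻ {t} {1ℤ} z) (sub≈0⁻ {t} {1ℤ} z))
        R-minus : R (t + inv t - + 2) ≡ R t
        R-minus = trans (proj₂ (R-ratio t (t + inv t - + 2) minus (*-nonzero {t - 1ℤ} {t - 1ℤ} t-1≉0 t-1≉0)))
                        (cong (_xor R t) (R-square (t - 1ℤ)))

      under : ∀ t b → lt t (inv t) ≡ b → b ∧ (ψ t ∧ (R -1ℤ xor R t)) ≡ b ∧ G (t + inv t)
      under t false _ = refl
      under t true  l = cong₂ _∧_ (value (zero? (α * (t + inv t) + β))) (cong (R -1ℤ xor_) (sym (R-minus l)))
        where
        w : ℤ
        w = α * (t + inv t) + β
        t*w : t * w ≈ α * (t * t + 1ℤ) + β * t
        t*w = combination₁ α (ti l) (lem α β t (inv t))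
          where
          lem : ∀ α β t i → t * (α * (t + i) + β) - (α * (t * t + 1ℤ) + β * t) ≡ α * (t * i - 1ℤ)
          lem = solve-∀
        value : (w ≈ 0ℤ) ⊎ (w ≉ 0ℤ) → ψ t ≡ not (Z w) ∧ (R (t + inv t - + 2) xor R w)
        value (inj₁ z) = trans (R-0 (≈-trans (≈-sym t*w) (≈-trans (*-cong {t} ≈-refl z) (≡⇒≈ (ℤP.*-zeroʳ t)))))
          (sym (cong (λ b → not b ∧ (R (t + inv t - + 2) xor R w)) (Z-intro z)))
        value (inj₂ n) = trans (R-cong (≈-sym t*w)) (trans (R-* (t≉0 l) n)
          (trans (cong (_xor R w) (sym (R-minus l))) (sym (cong (λ b → not b ∧ (R (t + inv t - + 2) xor R w)) (Z-intro-false n)))))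

      into : ∀ t → lt t (inv t) ≡ true → disc (t + inv t) ≡ true
      into t l = Q-intro (t - inv t) (nonzero-cong square (*-nonzero {t - inv t} {t - inv t} n n)) square
        where
        square : (t - inv t) * (t - inv t) ≈ (t + inv t - + 2) * (t + inv t + + 2)
        square = combination₁ (- + 4) (ti l) (lem t (inv t))
          where
          lem : ∀ t i → (t - i) * (t - i) - (t + i - + 2) * (t + i + + 2) ≡ - + 4 * (t * i - 1ℤ)
          lem = solve-∀
        n : t - inv t ≉ 0ℤ
        n z = true≢false l (lt-irrefl (sub≈0⁻ z))

      inj : ∀ t t′ → lt t (inv t) ≡ true → lt t′ (inv t′) ≡ true → t + inv t ≈ t′ + inv t′ → t ≈ t′
      inj t t′ l l′ e = [ sub≈0⁻ , (λ z → ⊥-elim (crossed (combination₁ 1ℤ z (lem′ t t′)))) ]′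
          (*-zero {t - t′} {t * t′ - 1ℤ} (combination₃ (t * t′) (- t′) t e (ti l) (ti l′) (lem t t′ (inv t) (inv t′))))
        where
        lem : ∀ t t′ i i′ → (t - t′) * (t * t′ - 1ℤ) - 0ℤ ≡ t * t′ * ((t + i) - (t′ + i′)) + - t′ * (t * i - 1ℤ) + t * (t′ * i′ - 1ℤ)
        lem = solve-∀
        lem′ : ∀ t t′ → t * t′ - 1ℤ ≡ 1ℤ * (t * t′ - 1ℤ - 0ℤ)
        lem′ = solve-∀
        crossed : t * t′ ≉ 1ℤ
        crossed tt′ = ℕP.<-asym (<ᵇ-true {red t} l) (subst₂ _<_ (red-cong (inv-unique {t} {t′} tt′)) (red-cong (≈-sym (inv-unique {t′} {t} (≈-trans (≡⇒≈ (ℤP.*-comm t′ t)) tt′)))) (<ᵇ-true {red t′} l′))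

      onto : ∀ w → disc w ≡ true → ∃ λ t → lt t (inv t) ≡ true × t + inv t ≈ w
      onto w q = let v , v² = proj₂ (Q-true {(w - + 2) * (w + + 2)} q) in choose v v²
        where
        i₂ : ℤ
        i₂ = inv (+ 2)
        choose : ∀ v → v * v ≈ (w - + 2) * (w + + 2) → ∃ λ t → lt t (inv t) ≡ true × t + inv t ≈ w
        choose v v² = by (decide (lt t t′))
          where
          t t′ : ℤ
          t  = (w + v) * i₂
          t′ = (w - v) * i₂
          tt′ : t * t′ ≈ 1ℤ
          tt′ = cancelˡ (+ 4) 4≉0 (combination₂ ((w * w - v * v) * (+ 2 * i₂ + 1ℤ)) -1ℤ (*-inv 2≉0) v² (lem w v i₂))
            where
            lem : ∀ w v i → + 4 * ((w + v) * i * ((w - v) * i)) - + 4 * 1ℤ ≡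
                  (w * w - v * v) * (+ 2 * i + 1ℤ) * (+ 2 * i - 1ℤ) + -1ℤ * (v * v - (w - + 2) * (w + + 2))
            lem = solve-∀
          sum-t : t + t′ ≈ w
          sum-t = combination₁ w (*-inv 2≉0) (lem w v i₂)
            where
            lem : ∀ w v i → (w + v) * i + (w - v) * i - w ≡ w * (+ 2 * i - 1ℤ)
            lem = solve-∀
          t′≈ : t′ ≈ inv t
          t′≈ = inv-unique {t} {t′} tt′
          t≈ : t ≈ inv t′
          t≈ = inv-unique {t′} {t} (≈-trans (≡⇒≈ (ℤP.*-comm t′ t)) tt′)
          t≉t′ : t ≉ t′
          t≉t′ e = Q⇒≉0 q (≈-trans (≈-sym v²) (*-cong v≈0 v≈0))
            where
            v≈0 : v ≈ 0ℤ
            v≈0 = combination₂ 1ℤ (- v) e (*-inv 2≉0) (lem w v i₂)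
              where
              lem : ∀ w v i → v - 0ℤ ≡ 1ℤ * ((w + v) * i - (w - v) * i) + - v * (+ 2 * i - 1ℤ)
              lem = solve-∀
          by : (lt t t′ ≡ true) ⊎ (lt t t′ ≡ false) → ∃ λ t → lt t (inv t) ≡ true × t + inv t ≈ w
          by (inj₁ l) = t , trans (sym (lt-cong {t} ≈-refl t′≈)) l , ≈-trans (+-cong {t} ≈-refl (≈-sym t′≈)) sum-t
          by (inj₂ l) = t′ , trans (sym (lt-cong {t′} ≈-refl t≈)) l′ , ≈-trans (+-cong {t′} ≈-refl (≈-sym t≈)) (≈-trans (≡⇒≈ (ℤP.+-comm t′ t)) sum-t)
            where
            l′ : lt t′ t ≡ true
            l′ = trans (sym (BP.xor-identityʳ _)) (trans (cong₂ (λ a b → (a xor lt t′ t) xor b) (sym l) (sym (eqb-false t≉t′))) (trichotomy t t′))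

      pointwise : ∀ w → (w - + 2 ≈ 0ℤ) ⊎ (w - + 2 ≉ 0ℤ) → (w + + 2 ≈ 0ℤ) ⊎ (w + + 2 ≉ 0ℤ) → (α * w + β ≈ 0ℤ) ⊎ (α * w + β ≉ 0ℤ) →
                  disc w ∧ G w ≡ is (not (R -1ℤ)) (w - + 2) ∧ (is (not (R -1ℤ)) (w + + 2) ∧ is (R -1ℤ) (α * w + β))
      pointwise w (inj₁ z) _ _ = trans (cong (_∧ G w) (Q-0 (≈-trans (*-cong z (≈-refl {w + + 2})) (≡⇒≈ (ℤP.*-zeroˡ (w + + 2))))))
        (sym (cong (_∧ (is (not (R -1ℤ)) (w + + 2) ∧ is (R -1ℤ) (α * w + β))) (is-0 (not (R -1ℤ)) z)))
      pointwise w _ (inj₁ z) _ = trans (cong (_∧ G w) (Q-0 (≈-trans (*-cong (≈-refl {w - + 2}) z) (≡⇒≈ (ℤP.*-zeroʳ (w - + 2))))))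
        (sym (trans (cong (λ b → is (not (R -1ℤ)) (w - + 2) ∧ (b ∧ is (R -1ℤ) (α * w + β))) (is-0 (not (R -1ℤ)) z)) (BP.∧-zeroʳ _)))
      pointwise w _ _ (inj₁ z) = trans (cong (λ b → disc w ∧ ((not b ∧ (R (w - + 2) xor R (α * w + β))) ∧ (R -1ℤ xor R (w - + 2)))) (Z-intro z))
        (trans (BP.∧-zeroʳ (disc w)) (sym (trans (cong (λ b → is (not (R -1ℤ)) (w - + 2) ∧ (is (not (R -1ℤ)) (w + + 2) ∧ b)) (is-0 (R -1ℤ) z))
          (trans (cong (is (not (R -1ℤ)) (w - + 2) ∧_) (BP.∧-zeroʳ _)) (BP.∧-zeroʳ _)))))
      pointwise w (inj₂ n) (inj₂ n′) (inj₂ n″) = trans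
        (cong₂ _∧_ (trans (Q-notR (*-nonzero {w - + 2} {w + + 2} n n′)) (cong not (R-* n n′)))
          (cong (λ b → (not b ∧ (R (w - + 2) xor R (α * w + β))) ∧ (R -1ℤ xor R (w - + 2))) (Z-intro-false n″)))
        (trans (logic (R (w - + 2)) (R (w + + 2)) (R (α * w + β)) (R -1ℤ))
          (sym (cong₂ _∧_ (is-nonzero (not (R -1ℤ)) n) (cong₂ _∧_ (is-nonzero (not (R -1ℤ)) n′) (is-nonzero (R -1ℤ) n″)))))
        where
        logic : ∀ a b c e → not (a xor b) ∧ ((a xor c) ∧ (e xor a)) ≡ not (a xor not e) ∧ (not (b xor not e) ∧ not (c xor e))
        logic true  true  true  true  = refl
        logic true  true  true  false = refl
        logic true  true  false true  = refl
        logic true  true  false false = refl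
        logic true  false true  true  = refl
        logic true  false true  false = refl
        logic true  false false true  = refl
        logic true  false false false = refl
        logic false true  true  true  = refl
        logic false true  true  false = refl
        logic false true  false true  = refl
        logic false true  false false = refl
        logic false false true  true  = refl
        logic false false true  false = refl
        logic false false false true  = refl
        logic false false false false = refl

  -- The given products as parities

  half≡ : half p ≡ h
  half≡ = trans (cong (λ n → (n ℕ.∸ 1) ℕ./ 2) p≡) (half-double h)

  legProd-sgn : ∀ f ps → legProd f p ps ≡ sgn (xorList (λ (i , j) → R (f (+ i) (+ j))) ps)
  legProd-sgn f []             = refl
  legProd-sgn f ((i , j) ∷ ps) = trans (cong₂ _*_ (term (f (+ i) (+ j))) (legProd-sgn f ps)) (sym (sgn-xor (R (f (+ i) (+ j))) _))
    where
    bits : ∀ z s → (if z then + 1 else (if z then + 0 else (if s then + 1 else -1ℤ))) ≡ sgn (not z ∧ not s)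
    bits true  s     = refl
    bits false true  = refl
    bits false false = refl
    term : ∀ a → (if divb p a then + 1 else legendre a p) ≡ sgn (R a)
    term a = trans (bits (divb p a) (isSquareMod p a)) (cong₂ (λ z s → sgn (not z ∧ not s)) (Z-divb a) (sq-isSquareMod a))

  legProd-pairsLt : ∀ f → legProd f p (pairsLt p) ≡ sgn (Tri f)
  legProd-pairsLt f = trans (legProd-sgn f (pairsLt p)) (cong sgn (begin
    xorList g (pairsLt p) ≡⟨ xorList-concatMap g (λ j → map (λ i → i , j) (range1 (j ℕ.∸ 1))) (range1 (half p)) ⟩
    xorList (λ j → xorList g (map (λ i → i , j) (range1 (j ℕ.∸ 1)))) (range1 (half p)) ≡⟨ xorList-cong (range1 (half p)) (λ j → trans (xorList-map g (λ i → i , j) (range1 (j ℕ.∸ 1))) (xorList-range1 (λ i → g (i , j)) (j ℕ.∸ 1))) ⟩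
    xorList (λ j → ⊕.sum (j ℕ.∸ 1) (λ i → g (suc i , j))) (range1 (half p)) ≡⟨ xorList-range1 (λ j → ⊕.sum (j ℕ.∸ 1) (λ i → g (suc i , j))) (half p) ⟩
    ⊕.sum (half p) (λ j → ⊕.sum j (λ i → g (suc i , suc j))) ≡⟨ cong (λ n → ⊕.sum n (λ j → ⊕.sum j (λ i → g (suc i , suc j)))) half≡ ⟩
    Tri f ∎))
    where
    open ≡-Reasoning
    g : ℕ × ℕ → Bool
    g (i , j) = R (f (+ i) (+ j))

  Square : (ℤ → ℤ → ℤ) → Bool
  Square f = ⊕.sum h (λ i → ⊕.sum h (λ j → R (f (+ suc i) (+ suc j))))

  legProd-pairsAll : ∀ f → legProd f p (pairsAll p) ≡ sgn (Square f)
  legProd-pairsAll f = trans (legProd-sgn f (pairsAll p)) (cong sgn (begin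
    xorList g (pairsAll p) ≡⟨ xorList-concatMap g (λ i → map (λ j → i , j) (range1 (half p))) (range1 (half p)) ⟩
    xorList (λ i → xorList g (map (λ j → i , j) (range1 (half p)))) (range1 (half p)) ≡⟨ xorList-cong (range1 (half p)) (λ i → trans (xorList-map g (λ j → i , j) (range1 (half p))) (xorList-range1 (λ j → g (i , j)) (half p))) ⟩
    xorList (λ i → ⊕.sum (half p) (λ j → g (i , suc j))) (range1 (half p)) ≡⟨ xorList-range1 (λ i → ⊕.sum (half p) (λ j → g (i , suc j))) (half p) ⟩
    ⊕.sum (half p) (λ i → ⊕.sum (half p) (λ j → g (suc i , suc j))) ≡⟨ cong (λ n → ⊕.sum n (λ i → ⊕.sum n (λ j → g (suc i , suc j)))) half≡ ⟩
    Square f ∎))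
    where
    open ≡-Reasoning
    g : ℕ × ℕ → Bool
    g (i , j) = R (f (+ i) (+ j))

  -- Affine substitutions that lead to x, x + 1, x + 5

  e s : Bool
  e = R -1ℤ
  s = R (+ 5)

  R-one : R 1ℤ ≡ false
  R-one = R-square 1ℤ

  R-four : R (+ 4) ≡ false
  R-four = R-square (+ 2)

  R-minus-four : R (- + 4) ≡ e
  R-minus-four = R-square-* (+ 2) -1ℤ 2≉0

  is-scale : ∀ b c d {r y z} → c ≉ 0ℤ → d ≉ 0ℤ → R c xor R d ≡ r → c * y ≈ d * z → is b y ≡ is (b xor r) z
  is-scale b c d {r} {y} {z} c≉0 d≉0 r≡ cy≈dz = by (zero? z)
    where
    logic : ∀ b rc rd ry rz → rc xor ry ≡ rd xor rz → not (ry xor b) ≡ not (rz xor (b xor (rc xor rd)))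
    logic b     true  true  true  true  _ = cong not (cong (true xor_) (sym (BP.xor-identityʳ b)))
    logic b     true  true  false false _ = cong not (sym (BP.xor-identityʳ b))
    logic true  true  false true  false _ = refl
    logic false true  false true  false _ = refl
    logic true  true  false false true  _ = refl
    logic false true  false false true  _ = refl
    logic true  false true  true  false _ = refl
    logic false false true  true  false _ = refl
    logic true  false true  false true  _ = refl
    logic false false true  false true  _ = refl
    logic b     false false true  true  _ = cong not (cong (true xor_) (sym (BP.xor-identityʳ b)))
    logic b     false false false false _ = cong not (sym (BP.xor-identityʳ b))
    by : (z ≈ 0ℤ) ⊎ (z ≉ 0ℤ) → is b y ≡ is (b xor r) z
    by (inj₁ z≈0) = trans (is-0 b (cancelˡ c c≉0 (≈-trans cy≈dz (≈-trans (*-cong (≈-refl {d}) z≈0) (≡⇒≈ (trans (ℤP.*-zeroʳ d) (sym (ℤP.*-zeroʳ c))))))))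
                          (sym (is-0 (b xor r) z≈0))
    by (inj₂ z≉0) = trans (is-nonzero b y≉0) (trans (logic b (R c) (R d) (R y) (R z) (trans (sym (R-* c≉0 y≉0)) (trans (R-cong cy≈dz) (R-* d≉0 z≉0))))
                          (trans (cong (λ q → not (R z xor (b xor q))) r≡) (sym (is-nonzero (b xor r) z≉0))))
      where
      y≉0 : y ≉ 0ℤ
      y≉0 = factorʳ≉0 {c} {y} (nonzero-cong (≈-sym cy≈dz) (*-nonzero {d} {z} d≉0 z≉0))

  affine : ℤ → ℤ → ℤ → ℤ → ℤ
  affine c d k x = (d * x + k) * inv c

  affine-eq : ∀ c d k → c ≉ 0ℤ → ∀ x → c * affine c d k x ≈ d * x + k
  affine-eq c d k n x = combination₁ (d * x + k) (*-inv n) (lem c (d * x + k) (inv c))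
    where
    lem : ∀ c y i → c * (y * i) - y ≡ y * (c * i - 1ℤ)
    lem = solve-∀

  S-affine : ∀ c d k → c ≉ 0ℤ → d ≉ 0ℤ → ∀ {g : ℤ → Bool} → (∀ {a b} → a ≈ b → g a ≡ g b) → S (λ x → g (affine c d k x)) ≡ S g
  S-affine c d k c≉0 d≉0 g≈ = S-perm (affine-cong) g≈ (λ w → (c * w - k) * inv d)
      (λ w → cancelˡ c c≉0 (≈-trans (affine-eq c d k c≉0 _) (combination₁ (c * w - k) (*-inv d≉0) (lem c d k w (inv d)))))
      (λ {t} {t′} e → cancelˡ d d≉0 (combination₃ 1ℤ 1ℤ -1ℤ (*-cong (≈-refl {c}) e) (≈-sym (affine-eq c d k c≉0 t)) (≈-sym (affine-eq c d k c≉0 t′))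
                        (lem′ c d k t t′ (affine c d k t) (affine c d k t′))))
    where
    affine-cong : ∀ {a b} → a ≈ b → affine c d k a ≈ affine c d k b
    affine-cong e = *-cong (+-cong (*-cong (≈-refl {d}) e) (≈-refl {k})) (≈-refl {inv c})
    lem : ∀ c d k w i → d * ((c * w - k) * i) + k - c * w ≡ (c * w - k) * (d * i - 1ℤ)
    lem = solve-∀
    lem′ : ∀ c d k t t′ a a′ → d * t - d * t′ ≡ 1ℤ * (c * a - c * a′) + 1ℤ * (d * t + k - c * a) + -1ℤ * (d * t′ + k - c * a′)
    lem′ = solve-∀

  module _ (α β c d k : ℤ) (c≉0 : c ≉ 0ℤ) (d≉0 : d ≉ 0ℤ) where
    private
      w : ℤ → ℤ
      w = affine c d k

    Tri-affine : Tri (form α β) ≡ S (λ x → is (not e) (w x - + 2) ∧ (is (not e) (w x + + 2) ∧ is e (α * w x + β)))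
    Tri-affine = trans (Tri-trace α β) (sym (S-affine c d k c≉0 d≉0 {λ w → is (not e) (w - + 2) ∧ (is (not e) (w + + 2) ∧ is e (α * w + β))} (λ q → cong₂ _∧_ (is-cong (not e) (sub-cong q ≈-refl))
      (cong₂ _∧_ (is-cong (not e) (+-cong q ≈-refl)) (is-cong e (+-cong (*-cong (≈-refl {α}) q) (≈-refl {β})))))))

    -- Multiplying c w = d x + k by m and adding c′ v gives c′ (u w + v) = d′ (x + z), hence a known
    -- change of symbol. The three integer equations are separated so that `refl` proves them for
    -- numerical coefficients.
    scale : ∀ b c′ d′ {r} u v z m → c′ ≉ 0ℤ → d′ ≉ 0ℤ → R c′ xor R d′ ≡ r →
            c′ * u ≡ m * c → m * d ≡ d′ → m * k + c′ * v ≡ d′ * z → ∀ x → is b (u * w x + v) ≡ is (b xor r) (x + z)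
    scale b c′ d′ u v z m c′≉0 d′≉0 r≡ cu md mk′ x = is-scale b c′ d′ c′≉0 d′≉0 r≡
        (≈-trans (≡⇒≈ (trans (lem c′ u v (w x)) (cong (λ q → q * w x + c′ * v) cu)))
          (≈-trans (combination₁ m (affine-eq c d k c≉0 x) (lem′ m c (w x) (d * x + k) (c′ * v)))
            (≡⇒≈ (trans (lem″ m d x k (c′ * v)) (trans (cong₂ (λ q q′ → q * x + q′) md mk′) (sym (ℤP.*-distribˡ-+ d′ x z)))))))
      where
      lem : ∀ c u v w → c * (u * w + v) ≡ c * u * w + c * v
      lem = solve-∀
      lem′ : ∀ m c w y z → m * c * w + z - (m * y + z) ≡ m * (c * w - y)
      lem′ = solve-∀
      lem″ : ∀ m d x k y → m * (d * x + k) + y ≡ m * d * x + (m * k + y)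
      lem″ = solve-∀

    scale-monic : ∀ b c′ d′ {r} v z m → c′ ≉ 0ℤ → d′ ≉ 0ℤ → R c′ xor R d′ ≡ r →
                  c′ * 1ℤ ≡ m * c → m * d ≡ d′ → m * k + c′ * v ≡ d′ * z → ∀ x → is b (w x + v) ≡ is (b xor r) (x + z)
    scale-monic b c′ d′ v z m c′≉0 d′≉0 r≡ cu md mk′ x =
      trans (is-cong b (≡⇒≈ (cong (_+ v) (sym (ℤP.*-identityˡ (w x)))))) (scale b c′ d′ 1ℤ v z m c′≉0 d′≉0 r≡ cu md mk′ x)

  Tri-cong : ∀ {f g} → (∀ i j → f i j ≡ g i j) → Tri f ≡ Tri g
  Tri-cong {f} {g} q = triangle-cong h λ i j _ _ → cong R (q (+ suc i) (+ suc j))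

  at-zero : ∀ b x → is b (x + 0ℤ) ≡ is b x
  at-zero b x = is-cong b (≡⇒≈ (ℤP.+-identityʳ x))

  ∧-reverse : ∀ a b c → a ∧ (b ∧ c) ≡ c ∧ (b ∧ a)
  ∧-reverse a b c = trans (BP.∧-comm a (b ∧ c)) (trans (cong (_∧ a) (BP.∧-comm b c)) (BP.∧-assoc c b a))

  ∧-rotate : ∀ a b c → a ∧ (b ∧ c) ≡ b ∧ (c ∧ a)
  ∧-rotate a b c = trans (BP.∧-comm a (b ∧ c)) (BP.∧-assoc b c a)

  ∧-swap : ∀ a b c → a ∧ (b ∧ c) ≡ a ∧ (c ∧ b)
  ∧-swap a b c = cong (a ∧_) (BP.∧-comm b c)

  -- The substitution w = - x - 3 sends the roots 2, -2 and -3 of w - 2, w + 2 and α (w + 3) to -5,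
  -- -1 and 0. For the opposite sign of β, w = x + 3 is used.
  Tri-form-3 : ∀ α → α ≉ 0ℤ → Tri (form α (α * + 3)) ≡ N (e xor R (- α)) (not e xor e) (not e xor e)
  Tri-form-3 α α≉0 = trans (Tri-affine α (α * + 3) 1ℤ -1ℤ (- + 3) 1≉0 -1≉0) (S-cong λ x → trans
      (cong₂ _∧_ (m (not e) 1ℤ -1ℤ (- + 2) (+ 5) 1ℤ 1≉0 -1≉0 r refl refl refl x)
        (cong₂ _∧_ (m (not e) 1ℤ -1ℤ (+ 2) (+ 1) 1ℤ 1≉0 -1≉0 r refl refl refl x)
          (trans (scale α (α * + 3) 1ℤ -1ℤ (- + 3) 1≉0 -1≉0 e 1ℤ (- α) α (α * + 3) 0ℤ α 1≉0 (neg≉0 α≉0)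
                   (cong (_xor R (- α)) R-one) (ℤP.*-comm 1ℤ α) (lem α) (lem′ α) x) (at-zero (e xor R (- α)) x))))
      (∧-reverse (is (not e xor e) (x + + 5)) (is (not e xor e) (x + + 1)) (is (e xor R (- α)) x)))
    where
    m = scale-monic α (α * + 3) 1ℤ -1ℤ (- + 3) 1≉0 -1≉0
    r : R 1ℤ xor R -1ℤ ≡ e
    r = cong (_xor e) R-one
    lem : ∀ α → α * -1ℤ ≡ - α
    lem = solve-∀
    lem′ : ∀ α → α * - + 3 + 1ℤ * (α * + 3) ≡ - α * 0ℤ
    lem′ = solve-∀

  Tri-form-minus-3 : ∀ α → α ≉ 0ℤ → Tri (form α (α * - + 3)) ≡ N (e xor R α) (not e xor false) (not e xor false)
  Tri-form-minus-3 α α≉0 = trans (Tri-affine α (α * - + 3) 1ℤ 1ℤ (+ 3) 1≉0 1≉0) (S-cong λ x → trans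
      (cong₂ _∧_ (m (not e) 1ℤ 1ℤ (- + 2) (+ 1) 1ℤ 1≉0 1≉0 r refl refl refl x)
        (cong₂ _∧_ (m (not e) 1ℤ 1ℤ (+ 2) (+ 5) 1ℤ 1≉0 1≉0 r refl refl refl x)
          (trans (scale α (α * - + 3) 1ℤ 1ℤ (+ 3) 1≉0 1≉0 e 1ℤ α α (α * - + 3) 0ℤ α 1≉0 α≉0
                   (cong (_xor R α) R-one) (ℤP.*-comm 1ℤ α) (ℤP.*-identityʳ α) (lem α) x) (at-zero (e xor R α) x))))
      (trans (∧-rotate (is (not e xor false) (x + + 1)) (is (not e xor false) (x + + 5)) (is (e xor R α) x))
             (∧-rotate (is (not e xor false) (x + + 5)) (is (e xor R α) x) (is (not e xor false) (x + + 1)))))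
    where
    m = scale-monic α (α * - + 3) 1ℤ 1ℤ (+ 3) 1≉0 1≉0
    r : R 1ℤ xor R 1ℤ ≡ false
    r = cong₂ _xor_ R-one R-one
    lem : ∀ α → α * + 3 + 1ℤ * (α * - + 3) ≡ α * 0ℤ
    lem = solve-∀

  -- The roots 2, -2 and 6/5 go to 0, -5 and -1 under w = (4 x + 10) / 5. For the opposite sign of
  -- β, w is replaced by - w.
  Tri-form-5-minus-6 : Tri (form (+ 5) (- + 6)) ≡ N (not e xor (s xor false)) (e xor false) (not e xor (s xor false))
  Tri-form-5-minus-6 = trans (Tri-affine (+ 5) (- + 6) (+ 5) (+ 4) (+ 10) 5≉0 4≉0) (S-cong λ x → trans
      (cong₂ _∧_ (trans (m (not e) (+ 5) (+ 4) (- + 2) 0ℤ 1ℤ 5≉0 4≉0 r refl refl refl x) (at-zero (not e xor (s xor false)) x))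
        (cong₂ _∧_ (m (not e) (+ 5) (+ 4) (+ 2) (+ 5) 1ℤ 5≉0 4≉0 r refl refl refl x)
          (scale (+ 5) (- + 6) (+ 5) (+ 4) (+ 10) 5≉0 4≉0 e 1ℤ (+ 4) (+ 5) (- + 6) (+ 1) 1ℤ 1≉0 4≉0 (cong₂ _xor_ R-one R-four) refl refl refl x)))
      (∧-swap (is (not e xor (s xor false)) x) (is (not e xor (s xor false)) (x + + 5)) (is (e xor false) (x + + 1))))
    where
    m = scale-monic (+ 5) (- + 6) (+ 5) (+ 4) (+ 10) 5≉0 4≉0
    r : R (+ 5) xor R (+ 4) ≡ s xor false
    r = cong (s xor_) R-four

  Tri-form-5-6 : Tri (form (+ 5) (+ 6)) ≡ N (not e xor (s xor e)) (e xor e) (not e xor (s xor e))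
  Tri-form-5-6 = trans (Tri-affine (+ 5) (+ 6) (+ 5) (- + 4) (- + 10) 5≉0 -4≉0) (S-cong λ x → trans
      (cong₂ _∧_ (m (not e) (+ 5) (- + 4) (- + 2) (+ 5) 1ℤ 5≉0 -4≉0 r refl refl refl x)
        (cong₂ _∧_ (trans (m (not e) (+ 5) (- + 4) (+ 2) 0ℤ 1ℤ 5≉0 -4≉0 r refl refl refl x) (at-zero (not e xor (s xor e)) x))
          (scale (+ 5) (+ 6) (+ 5) (- + 4) (- + 10) 5≉0 -4≉0 e 1ℤ (- + 4) (+ 5) (+ 6) (+ 1) 1ℤ 1≉0 -4≉0 (cong₂ _xor_ R-one R-minus-four) refl refl refl x)))
      (∧-rotate (is (not e xor (s xor e)) (x + + 5)) (is (not e xor (s xor e)) x) (is (e xor e) (x + + 1))))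
    where
    m = scale-monic (+ 5) (+ 6) (+ 5) (- + 4) (- + 10) 5≉0 -4≉0
    r : R (+ 5) xor R (- + 4) ≡ s xor e
    r = cong (s xor_) R-minus-four

  -- The product over all pairs

  Square-ratio : Square (λ i j → i * i - i * j - j * j) ≡ S (λ t → R (t * t - t - 1ℤ) ∧ A t)
  Square-ratio = begin
    ⊕.sum h (λ i → ⊕.sum h (λ j → R (q (+ suc i) (+ suc j)))) ≡⟨ ⊕.sum-swap h h (λ i j → R (q (+ suc i) (+ suc j))) ⟩
    ⊕.sum h (λ j → ⊕.sum h (λ i → R (q (+ suc i) (+ suc j)))) ≡⟨ ⊕.sum-cong h inner ⟩
    ⊕.sum h (λ j → S (λ t → R (t * t - t - 1ℤ) ∧ low (t * + suc j))) ≡⟨ S-ratio (λ t → R (t * t - t - 1ℤ)) (λ t J → low (t * J)) ⟩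
    S (λ t → R (t * t - t - 1ℤ) ∧ A t) ∎
    where
    open ≡-Reasoning
    q : ℤ → ℤ → ℤ
    q i j = i * i - i * j - j * j
    inner : ∀ j → j < h → ⊕.sum h (λ i → R (q (+ suc i) (+ suc j))) ≡ S (λ t → R (t * t - t - 1ℤ) ∧ low (t * + suc j))
    inner j j<h = trans (sym (S-low (λ x → R (q x (+ suc j))))) (trans (sym (S-scale {H} (+ suc j) (suc≉0 j j<h)
        (λ e → cong₂ _∧_ (low-cong e) (R-cong (sub-cong (sub-cong (*-cong e e) (*-cong e (≈-refl {+ suc j}))) (≈-refl {+ suc j * + suc j}))))))
        (S-cong λ t → trans (BP.∧-comm (low (t * + suc j)) (R (q (t * + suc j) (+ suc j)))) (cong (_∧ low (t * + suc j))
          (trans (R-cong (≡⇒≈ (lem t (+ suc j)))) (R-square-* (+ suc j) (t * t - t - 1ℤ) (suc≉0 j j<h))))))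
      where
      H : ℤ → Bool
      H x = low x ∧ R (q x (+ suc j))
      lem : ∀ t J → t * J * (t * J) - t * J * J - J * J ≡ J * J * (t * t - t - 1ℤ)
      lem = solve-∀

  -- If -1 is a nonsquare, `A` singles out the nonzero squares t, and for these t² - t - 1 = t (t -
  -- 1/t - 1) has the symbol of t - 1/t - 1.
  Square-nonresidue : (e≡ : e ≡ true) → Square (λ i j → i * i - i * j - j * j) ≡ difference-parity e≡
  Square-nonresidue e≡ = trans Square-ratio (S-cong λ t → pointwise t (zero? t))
    where
    pointwise : ∀ t → (t ≈ 0ℤ) ⊎ (t ≉ 0ℤ) → R (t * t - t - 1ℤ) ∧ A t ≡ Q t ∧ R (difference t - 1ℤ)
    pointwise t (inj₁ z) = trans (cong (R (t * t - t - 1ℤ) ∧_) (A-0 z)) (trans (BP.∧-zeroʳ _) (sym (cong (_∧ R (difference t - 1ℤ)) (Q-0 z))))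
    pointwise t (inj₂ n) = trans (cong (R (t * t - t - 1ℤ) ∧_) (trans (A≡ n) (trans (cong (_xor R t) e≡) (sym (Q-notR n)))))
        (trans (BP.∧-comm _ (Q t)) (under (Q t) refl))
      where
      under : ∀ b → Q t ≡ b → b ∧ R (t * t - t - 1ℤ) ≡ b ∧ R (difference t - 1ℤ)
      under false _ = refl
      under true  qt = let x , x² = proj₂ (Q-true {t} qt) in
        trans (R-cong (combination₂ (- (difference t - 1ℤ)) 1ℤ x² (*-inv n) (lem t x (inv t))))
              (R-square-* x (difference t - 1ℤ) (factorˡ≉0 {x} {x} (nonzero-cong (≈-sym x²) n)))
        where
        lem : ∀ t x i → t * t - t - 1ℤ - x * x * (t - i - 1ℤ) ≡ - (t - i - 1ℤ) * (x * x - t) + 1ℤ * (t * i - 1ℤ)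
        lem = solve-∀

  -- Now `A` singles out the nonsquares, and t ↦ - 1/t preserves the summand because -1 is a square.
  -- The fixed points ± i, with i² = -1, contribute R i ∧ R (2 ± i), since t² - t - 1 = - (2 + t)
  -- there. The product (2 + i)(2 - i) is 5, and 2 i = (1 + i)² gives i the symbol of 2.
  Square-residue : e ≡ false → Square (λ i j → i * i - i * j - j * j) ≡ R (+ 2) ∧ s
  Square-residue e≡ = trans Square-ratio (trans (S-cong λ t → pointwise t (zero? t)) (conclude (sq-true { -1ℤ} (proj₂ (∧-true {not (Z -1ℤ)} (R⇒Q -1≉0 e≡))))))
    where
    f : ℤ → Bool
    f t = R t ∧ R (t * t - t - 1ℤ)

    f-cong : ∀ {a b} → a ≈ b → f a ≡ f b
    f-cong q = cong₂ _∧_ (R-cong q) (R-cong (sub-cong (sub-cong (*-cong q q) q) ≈-refl))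

    pointwise : ∀ t → (t ≈ 0ℤ) ⊎ (t ≉ 0ℤ) → R (t * t - t - 1ℤ) ∧ A t ≡ f t
    pointwise t (inj₁ z) = trans (cong (R (t * t - t - 1ℤ) ∧_) (A-0 z)) (trans (BP.∧-zeroʳ _) (sym (cong (_∧ R (t * t - t - 1ℤ)) (R-0 z))))
    pointwise t (inj₂ n) = trans (cong (R (t * t - t - 1ℤ) ∧_) (trans (A≡ n) (cong (_xor R t) e≡))) (BP.∧-comm _ (R t))

    preserved : ∀ t → f t ≡ true → f (swing -1ℤ t) ≡ true
    preserved t ft = ∧-intro (trans (proj₂ (R-ratio t y ty -1≉0)) (cong₂ _xor_ e≡ rt))
        (trans (sym (R-square-* t (y * y - y - 1ℤ) t≉0)) (trans (R-cong (combination₁ (t * y - 1ℤ - t) ty (lem t y)))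
          (trans (R-neg (R⇒≉0 rq)) (cong₂ _xor_ e≡ rq))))
      where
      rt : R t ≡ true
      rt = proj₁ (∧-true ft)
      rq : R (t * t - t - 1ℤ) ≡ true
      rq = proj₂ (∧-true {R t} ft)
      t≉0 : t ≉ 0ℤ
      t≉0 = R⇒≉0 rt
      y : ℤ
      y = swing -1ℤ t
      ty : t * y ≈ -1ℤ
      ty = *-swing -1ℤ t≉0
      lem : ∀ t y → t * t * (y * y - y - 1ℤ) - - (t * t - t - 1ℤ) ≡ (t * y - 1ℤ - t) * (t * y - -1ℤ)
      lem = solve-∀

    conclude : (∃ λ i → i * i ≈ -1ℤ) → S f ≡ R (+ 2) ∧ s
    conclude (i , i²) = begin
      S f ≡⟨ S-involution {swing -1ℤ} (swing-cong -1ℤ) f-cong (swing-swing -1ℤ -1≉0) preserved ⟩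
      S (λ t → eqb t (swing -1ℤ t) ∧ f t) ≡⟨ S-two-points i (- i) f-cong roots ⟩
      f i xor f (- i) ≡⟨ cong₂ _xor_ (f-root i i²) (trans (f-root (- i) j²) (cong₂ _∧_ (trans (R-neg i≉0) (cong (_xor R i) e≡)) (R-cong (≡⇒≈ (lem₁ i))))) ⟩
      (R i ∧ R (+ 2 + i)) xor (R i ∧ R (+ 2 - i)) ≡⟨ sym (∧-distrib-xor (R i) (R (+ 2 + i)) (R (+ 2 - i))) ⟩
      R i ∧ (R (+ 2 + i) xor R (+ 2 - i)) ≡⟨ cong₂ _∧_ R-i (trans (sym (R-* (factorˡ≉0 {+ 2 + i} {+ 2 - i} five≉0) (factorʳ≉0 {+ 2 + i} {+ 2 - i} five≉0))) (R-cong norm-five)) ⟩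
      R (+ 2) ∧ s ∎
      where
      open ≡-Reasoning
      i≉0 : i ≉ 0ℤ
      i≉0 = factorˡ≉0 {i} {i} (nonzero-cong (≈-sym i²) -1≉0)
      j² : (- i) * (- i) ≈ -1ℤ
      j² = ≈-trans (≡⇒≈ (lem i)) i²
        where
        lem : ∀ i → (- i) * (- i) ≡ i * i
        lem = solve-∀
      lem₁ : ∀ i → + 2 + - i ≡ + 2 - i
      lem₁ i = refl
      norm-five : (+ 2 + i) * (+ 2 - i) ≈ + 5
      norm-five = combination₁ -1ℤ i² (lem i)
        where
        lem : ∀ i → (+ 2 + i) * (+ 2 - i) - + 5 ≡ -1ℤ * (i * i - -1ℤ)
        lem = solve-∀
      five≉0 : (+ 2 + i) * (+ 2 - i) ≉ 0ℤ
      five≉0 = nonzero-cong (≈-sym norm-five) 5≉0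
      R-i : R i ≡ R (+ 2)
      R-i = trans (proj₂ (R-ratio (+ 2) i (combination₁ -1ℤ i² (lem i)) (nonzero-cong (combination₁ -1ℤ i² (lem i)) (*-nonzero {+ 2} {i} 2≉0 i≉0))))
                  (cong (_xor R (+ 2)) (R-square (1ℤ + i)))
        where
        lem : ∀ i → + 2 * i - (1ℤ + i) * (1ℤ + i) ≡ -1ℤ * (i * i - -1ℤ)
        lem = solve-∀
      f-root : ∀ i → i * i ≈ -1ℤ → f i ≡ R i ∧ R (+ 2 + i)
      f-root i i² = cong (R i ∧_) (trans (R-cong (combination₁ 1ℤ i² (lem i))) (negate (zero? (+ 2 + i))))
        where
        lem : ∀ i → i * i - i - 1ℤ - - (+ 2 + i) ≡ 1ℤ * (i * i - -1ℤ)
        lem = solve-∀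
        negate : (+ 2 + i ≈ 0ℤ) ⊎ (+ 2 + i ≉ 0ℤ) → R (- (+ 2 + i)) ≡ R (+ 2 + i)
        negate (inj₁ z) = trans (R-0 (neg-cong z)) (sym (R-0 z))
        negate (inj₂ n) = trans (R-neg n) (cong (_xor R (+ 2 + i)) e≡)
      roots : ∀ t → f t ≡ true → eqb t (swing -1ℤ t) ≡ eqb t i xor eqb t (- i)
      roots t ft = two-roots i (- i)
          (λ q → *-nonzero {+ 2} {i} 2≉0 i≉0 (combination₁ 1ℤ q (lem i)))
          (λ q → square-eq (combination₃ t 1ℤ -1ℤ q ty i² (lem′ t (swing -1ℤ t) i)))
          (λ q → fixed (≈-trans (*-cong q q) i²))
          (λ q → fixed (≈-trans (*-cong q q) j²))
        where
        t≉0 : t ≉ 0ℤ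
        t≉0 = R⇒≉0 (proj₁ (∧-true ft))
        ty : t * swing -1ℤ t ≈ -1ℤ
        ty = *-swing -1ℤ t≉0
        fixed : t * t ≈ -1ℤ → t ≈ swing -1ℤ t
        fixed q = cancelˡ t t≉0 (≈-trans q (≈-sym ty))
        lem : ∀ i → + 2 * i - 0ℤ ≡ 1ℤ * (i - - i)
        lem = solve-∀
        lem′ : ∀ t y i → t * t - i * i ≡ t * (t - y) + 1ℤ * (t * y - -1ℤ) + -1ℤ * (i * i - -1ℤ)
        lem′ = solve-∀

  -- Character sums

  module ZS = ModSums _+_ 0ℤ ℤP.+-0-isCommutativeMonoid

  Σℤ : (ℤ → ℤ) → ℤ
  Σℤ = ZS.S

  Σ-cong : ∀ {f g : ℤ → ℤ} → (∀ x → f x ≡ g x) → Σℤ f ≡ Σℤ g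
  Σ-cong e = ∑.sum-cong p λ i _ → e (+ i)

  Σ-+ : ∀ f g → Σℤ (λ x → f x + g x) ≡ Σℤ f + Σℤ g
  Σ-+ f g = ∑.sum-∙ p (λ i → f (+ i)) (λ i → g (+ i))

  Σ-* : ∀ c f → Σℤ (λ x → c * f x) ≡ c * Σℤ f
  Σ-* c f = sym (*-∑ p c (λ i → f (+ i)))

  Σ-point : ∀ r c → Σℤ (λ x → ⟦ eqb x r ⟧ * c) ≡ c
  Σ-point r c = trans (∑.sum-single p (red r) {λ i → ⟦ eqb (+ i) r ⟧ * c} (red-< r) λ i i<p i≢ →
      cong (λ b → ⟦ b ⟧ * c) (eqb-false λ e → i≢ (trans (sym (red-small i<p)) (red-cong e))))
    (trans (cong (λ b → ⟦ b ⟧ * c) (eqb-intro (red-≈ r))) (ℤP.*-identityˡ c))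

  χ : ℤ → ℤ
  χ a = legendre a p

  χ-bits : ∀ a → χ a ≡ (if Z a then + 0 else (if sq a then + 1 else -1ℤ))
  χ-bits a = cong₂ (λ z s → if z then + 0 else (if s then + 1 else -1ℤ)) (Z-divb a) (sq-isSquareMod a)

  χ-cong : ∀ {a b} → a ≈ b → χ a ≡ χ b
  χ-cong {a} {b} e = trans (χ-bits a) (trans (cong₂ (λ z s → if z then + 0 else (if s then + 1 else -1ℤ)) (Z-cong e) (sq-cong e)) (sym (χ-bits b)))

  χ-0 : ∀ {a} → a ≈ 0ℤ → χ a ≡ 0ℤ
  χ-0 {a} z = trans (χ-bits a) (cong (λ b → if b then + 0 else (if sq a then + 1 else -1ℤ)) (Z-intro z))

  χ-nonzero : ∀ {a} → a ≉ 0ℤ → χ a ≡ sgn (R a)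
  χ-nonzero {a} n = trans (χ-bits a) (trans (cong (λ b → if b then + 0 else (if sq a then + 1 else -1ℤ)) (Z-intro-false n))
      (trans (lem (sq a)) (cong (λ b → sgn (not b ∧ not (sq a))) (sym (Z-intro-false n)))))
    where
    lem : ∀ s → (if s then + 1 else -1ℤ) ≡ sgn (not s)
    lem true  = refl
    lem false = refl

  χ-* : ∀ a b → χ (a * b) ≡ χ a * χ b
  χ-* a b = by (zero? a) (zero? b)
    where
    by : (a ≈ 0ℤ) ⊎ (a ≉ 0ℤ) → (b ≈ 0ℤ) ⊎ (b ≉ 0ℤ) → χ (a * b) ≡ χ a * χ b
    by (inj₁ z) _ = trans (χ-0 (≈-trans (*-cong z (≈-refl {b})) (≡⇒≈ (ℤP.*-zeroˡ b))))
      (sym (trans (cong (_* χ b) (χ-0 z)) (ℤP.*-zeroˡ (χ b))))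
    by _ (inj₁ z) = trans (χ-0 (≈-trans (*-cong (≈-refl {a}) z) (≡⇒≈ (ℤP.*-zeroʳ a))))
      (sym (trans (cong (χ a *_) (χ-0 z)) (ℤP.*-zeroʳ (χ a))))
    by (inj₂ m) (inj₂ n) = trans (χ-nonzero (*-nonzero {a} {b} m n)) (trans (cong sgn (R-* m n))
      (trans (sgn-xor (R a) (R b)) (sym (cong₂ _*_ (χ-nonzero m) (χ-nonzero n)))))

  χ-square-* : ∀ c a → c ≉ 0ℤ → χ (c * c * a) ≡ χ a
  χ-square-* c a n = trans (χ-* (c * c) a) (trans (cong (_* χ a) (trans (χ-* c c) (trans (cong₂ _*_ (χ-nonzero n) (χ-nonzero n)) (sgn-square (R c))))) (ℤP.*-identityˡ (χ a)))

  -- Squaring maps 1, ..., h bijectively to the nonzero squares, so h of the 2 h units are squares.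
  Σχ : Σℤ χ ≡ 0ℤ
  Σχ = begin
    Σℤ χ ≡⟨ Σ-cong pointwise ⟩
    Σℤ (λ x → + 2 * (Q x ZS.▸ 1ℤ) + -1ℤ * ⟦ not (Z x) ⟧) ≡⟨ trans (Σ-+ (λ x → + 2 * (Q x ZS.▸ 1ℤ)) (λ x → -1ℤ * ⟦ not (Z x) ⟧)) (cong₂ _+_ (Σ-* (+ 2) (λ x → Q x ZS.▸ 1ℤ)) (Σ-* -1ℤ (λ x → ⟦ not (Z x) ⟧))) ⟩
    + 2 * Σℤ (λ x → Q x ZS.▸ 1ℤ) + -1ℤ * Σℤ (λ x → ⟦ not (Z x) ⟧) ≡⟨ cong₂ (λ a b → + 2 * a + -1ℤ * b) residues units ⟩
    + 2 * (+ h * 1ℤ) + -1ℤ * (0ℤ + + (h ℕ.+ h) * 1ℤ) ≡⟨ lem (+ h) ⟩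
    0ℤ ∎
    where
    open ≡-Reasoning
    lem : ∀ h → + 2 * (h * 1ℤ) + -1ℤ * (0ℤ + (h + h) * 1ℤ) ≡ 0ℤ
    lem = solve-∀
    pointwise : ∀ x → χ x ≡ + 2 * (Q x ZS.▸ 1ℤ) + -1ℤ * ⟦ not (Z x) ⟧
    pointwise x = trans (χ-bits x) (bits (Z x) (sq x))
      where
      bits : ∀ z s → (if z then + 0 else (if s then + 1 else -1ℤ)) ≡ + 2 * ((not z ∧ s) ZS.▸ 1ℤ) + -1ℤ * ⟦ not z ⟧
      bits true  s     = refl
      bits false true  = refl
      bits false false = refl
    residues : Σℤ (λ x → Q x ZS.▸ 1ℤ) ≡ + h * 1ℤ
    residues = trans (sym (ZS.S-bij {low} {Q} {λ t → t * t} {λ _ → 1ℤ} low-cong Q-cong (λ e → *-cong e e) (λ _ → refl) square-into square-onto square-injective))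
      (trans (Half.sum-low _+_ 0ℤ ℤP.+-0-isCommutativeMonoid (λ _ → 1ℤ)) (∑-const h 1ℤ))
    units : Σℤ (λ x → ⟦ not (Z x) ⟧) ≡ 0ℤ + + (h ℕ.+ h) * 1ℤ
    units = trans (cong (λ n → ∑.sum n (λ i → ⟦ not (Z (+ i)) ⟧)) p≡) (cong₂ _+_ (cong (λ b → ⟦ not b ⟧) (Z-intro {0ℤ} ≈-refl))
      (trans (∑.sum-cong (h ℕ.+ h) λ i i<2h → cong (λ b → ⟦ not b ⟧) (Z-intro-false (nat≉0 (s≤s z≤n) (subst (suc i <_) (sym p≡) (s≤s i<2h)))))
             (∑-const (h ℕ.+ h) 1ℤ)))

  Σ-shift : ∀ c {f : ℤ → ℤ} → (∀ {a b} → a ≈ b → f a ≡ f b) → Σℤ (λ x → f (x + c)) ≡ Σℤ f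
  Σ-shift c f≈ = ZS.S-perm {λ x → x + c} (λ e → +-cong e ≈-refl) f≈ (λ x → x - c) (λ x → ≡⇒≈ (lem x c))
      (λ {a} {b} e → combination₁ 1ℤ e (lem′ a b c))
    where
    lem : ∀ x c → x - c + c ≡ x
    lem = solve-∀
    lem′ : ∀ a b c → a - b ≡ 1ℤ * (a + c - (b + c))
    lem′ = solve-∀

  -- For x ≠ 0, x (x + c) = x² (1 + c/x), and c/x permutes the residues, so the sum becomes that of
  -- a single character. At x = 0 the left side is 0 but the permuted term is χ 1 = 1; the point
  -- term -1 corrects this and is all that remains.
  Σχχ : ∀ c → c ≉ 0ℤ → Σℤ (λ x → χ x * χ (x + c)) ≡ -1ℤ
  Σχχ c c≉0 = begin
    Σℤ (λ x → χ x * χ (x + c)) ≡⟨ Σ-cong (λ x → pointwise x (zero? x)) ⟩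
    Σℤ (λ x → χ (swing c x + 1ℤ) + ⟦ eqb x 0ℤ ⟧ * -1ℤ) ≡⟨ Σ-+ (λ x → χ (swing c x + 1ℤ)) (λ x → ⟦ eqb x 0ℤ ⟧ * -1ℤ) ⟩
    Σℤ (λ x → χ (swing c x + 1ℤ)) + Σℤ (λ x → ⟦ eqb x 0ℤ ⟧ * -1ℤ) ≡⟨ cong₂ _+_ (trans (ZS.S-perm {swing c} {λ y → χ (y + 1ℤ)} (swing-cong c) (λ e → χ-cong (+-cong e ≈-refl)) (swing c) (swing-swing c c≉0)
        (λ {a} {b} e → ≈-trans (≈-sym (swing-swing c c≉0 a)) (≈-trans (swing-cong c e) (swing-swing c c≉0 b)))) (trans (Σ-shift 1ℤ χ-cong) Σχ)) (Σ-point 0ℤ -1ℤ) ⟩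
    0ℤ + -1ℤ ≡⟨⟩
    -1ℤ ∎
    where
    open ≡-Reasoning
    pointwise : ∀ x → (x ≈ 0ℤ) ⊎ (x ≉ 0ℤ) → χ x * χ (x + c) ≡ χ (swing c x + 1ℤ) + ⟦ eqb x 0ℤ ⟧ * -1ℤ
    pointwise x (inj₁ z) = trans (trans (cong (_* χ (x + c)) (χ-0 z)) (ℤP.*-zeroˡ (χ (x + c))))
      (sym (cong₂ (λ a b → a + ⟦ b ⟧ * -1ℤ) (trans (χ-cong {swing c x + 1ℤ} {1ℤ} (≡⇒≈ (trans (cong (λ i → c * i + 1ℤ) (inv-0 z)) (cong (_+ 1ℤ) (ℤP.*-zeroʳ c))))) (trans (χ-nonzero 1≉0) (cong sgn R-one))) (eqb-intro z)))
    pointwise x (inj₂ n) = trans (sym (χ-* x (x + c))) (trans (χ-cong (combination₁ (- x) (*-swing c n) (lem x c (swing c x))))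
        (trans (χ-square-* x (swing c x + 1ℤ) n) (sym (trans (cong (λ b → χ (swing c x + 1ℤ) + ⟦ b ⟧ * -1ℤ) (eqb-false n)) (ℤP.+-identityʳ _)))))
      where
      lem : ∀ x c y → x * (x + c) - x * x * (y + 1ℤ) ≡ - x * (x * y - c)
      lem = solve-∀

  F : ℤ
  F = Σℤ (λ x → χ x * χ (x + 1ℤ) * χ (x + + 5))

  module _ (b₁ b₂ b₃ : Bool) where

    pattern′ : ℤ → Bool
    pattern′ x = is b₁ x ∧ (is b₂ (x + 1ℤ) ∧ is b₃ (x + + 5))

    count : ℤ
    count = Σℤ (λ x → ⟦ pattern′ x ⟧)

    count-parity : ∃ λ m → count ≡ ⟦ N b₁ b₂ b₃ ⟧ + + 2 * m
    count-parity = ∑-parity p (λ i → pattern′ (+ i))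

    u : Bool → ℤ → ℤ
    u b a = 1ℤ + sgn b * χ a

    u-cong : ∀ b {x y} → x ≈ y → u b x ≡ u b y
    u-cong b e = cong (λ z → 1ℤ + sgn b * z) (χ-cong e)

    u-0 : ∀ b {x} → x ≈ 0ℤ → u b x ≡ 1ℤ
    u-0 b z = trans (cong (λ y → 1ℤ + sgn b * y) (χ-0 z)) (cong (λ y → 1ℤ + y) (ℤP.*-zeroʳ (sgn b)))

    u-weight : ∀ b {x r} → x ≉ 0ℤ → R x ≡ r → u b x ≡ weight b r
    u-weight b n e = cong (λ z → 1ℤ + sgn b * z) (trans (χ-nonzero n) (cong sgn e))

    u-is : ∀ b {x} → x ≉ 0ℤ → u b x ≡ + 2 * ⟦ is b x ⟧
    u-is b {x} n = trans (u-weight b n refl) (trans (lem b (R x)) (cong (λ z → + 2 * ⟦ z ⟧) (sym (is-nonzero b n))))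
      where
      lem : ∀ b r → weight b r ≡ + 2 * ⟦ not (r xor b) ⟧
      lem true  true  = refl
      lem true  false = refl
      lem false true  = refl
      lem false false = refl

    c₀ c₁ c₂ : ℤ
    c₀ = u b₂ 1ℤ * u b₃ (+ 5)
    c₁ = u b₁ -1ℤ * u b₃ (+ 4)
    c₂ = u b₁ (- + 5) * u b₂ (- + 4)

    roots : ℤ → ℤ
    roots x = ⟦ eqb x 0ℤ ⟧ * c₀ + (⟦ eqb x -1ℤ ⟧ * c₁ + ⟦ eqb x (- + 5) ⟧ * c₂)

    -- Each factor is 2 or 0 according to its symbol if its argument is not zero, so away from 0,
    -- -1, -5 the product is 8 or 0. At each of these three points one factor is 1, and the other
    -- two give the constant attached to that point.
    local : ∀ x → u b₁ x * (u b₂ (x + 1ℤ) * u b₃ (x + + 5)) ≡ + 8 * ⟦ pattern′ x ⟧ + roots x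
    local x = by (zero? x) (zero? (x + 1ℤ)) (zero? (x + + 5))
      where
      minus : ∀ {c} → x + c ≈ 0ℤ → x ≈ - c
      minus {c} z = combination₁ 1ℤ z (lem x c)
        where
        lem : ∀ x c → x - - c ≡ 1ℤ * (x + c - 0ℤ)
        lem = solve-∀
      plus : ∀ {c} → x ≈ - c → x + c ≈ 0ℤ
      plus {c} z = combination₁ 1ℤ z (lem x c)
        where
        lem : ∀ x c → x + c - 0ℤ ≡ 1ℤ * (x - - c)
        lem = solve-∀
      indicators : ∀ {q a b c} → pattern′ x ≡ q → eqb x 0ℤ ≡ a → eqb x -1ℤ ≡ b → eqb x (- + 5) ≡ c →
                   + 8 * ⟦ q ⟧ + (⟦ a ⟧ * c₀ + (⟦ b ⟧ * c₁ + ⟦ c ⟧ * c₂)) ≡ + 8 * ⟦ pattern′ x ⟧ + roots x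
      indicators refl refl refl refl = refl
      5≉ : - + 5 ≉ 0ℤ
      5≉ = neg≉0 {+ 5} 5≉0
      by : (x ≈ 0ℤ) ⊎ (x ≉ 0ℤ) → (x + 1ℤ ≈ 0ℤ) ⊎ (x + 1ℤ ≉ 0ℤ) → (x + + 5 ≈ 0ℤ) ⊎ (x + + 5 ≉ 0ℤ) →
           u b₁ x * (u b₂ (x + 1ℤ) * u b₃ (x + + 5)) ≡ + 8 * ⟦ pattern′ x ⟧ + roots x
      by (inj₁ z) _ _ = trans
          (cong₂ _*_ (u-0 b₁ z) (cong₂ _*_ (u-cong b₂ (+-cong z (≈-refl {1ℤ}))) (u-cong b₃ (+-cong z (≈-refl {+ 5})))))
          (trans (lem c₀ c₁ c₂) (indicators (cong (_∧ (is b₂ (x + 1ℤ) ∧ is b₃ (x + + 5))) (is-0 b₁ z)) (eqb-intro z)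
            (eqb-false λ e → -1≉0 (≈-trans (≈-sym e) z)) (eqb-false λ e → 5≉ (≈-trans (≈-sym e) z))))
        where
        lem : ∀ a b c → 1ℤ * a ≡ + 8 * 0ℤ + (1ℤ * a + (0ℤ * b + 0ℤ * c))
        lem = solve-∀
      by (inj₂ n) (inj₁ z) _ = trans
          (cong₂ _*_ (u-cong b₁ (minus z)) (cong₂ _*_ (u-0 b₂ z) (u-cong b₃ (+-cong (minus z) (≈-refl {+ 5})))))
          (trans (lem (u b₁ -1ℤ) (u b₃ (+ 4)) c₀ c₂) (indicators (trans (cong (λ q → is b₁ x ∧ (q ∧ is b₃ (x + + 5))) (is-0 b₂ z)) (BP.∧-zeroʳ (is b₁ x)))
            (eqb-false n) (eqb-intro (minus z)) (eqb-false λ e → 4≉0 (combination₁ 1ℤ (≈-trans (≈-sym (minus z)) e) refl))))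
        where
        lem : ∀ a b c d → a * (1ℤ * b) ≡ + 8 * 0ℤ + (0ℤ * c + (1ℤ * (a * b) + 0ℤ * d))
        lem = solve-∀
      by (inj₂ n) (inj₂ n′) (inj₁ z) = trans
          (cong₂ _*_ (u-cong b₁ (minus z)) (cong₂ _*_ (u-cong b₂ (+-cong (minus z) (≈-refl {1ℤ}))) (u-0 b₃ z)))
          (trans (lem (u b₁ (- + 5)) (u b₂ (- + 4)) c₀ c₁) (indicators
            (trans (cong (λ q → is b₁ x ∧ (is b₂ (x + 1ℤ) ∧ q)) (is-0 b₃ z)) (trans (cong (is b₁ x ∧_) (BP.∧-zeroʳ (is b₂ (x + 1ℤ)))) (BP.∧-zeroʳ (is b₁ x))))
            (eqb-false n) (eqb-false (n′ ∘ plus)) (eqb-intro (minus z))))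
        where
        lem : ∀ a b c d → a * (b * 1ℤ) ≡ + 8 * 0ℤ + (0ℤ * c + (0ℤ * d + 1ℤ * (a * b)))
        lem = solve-∀
      by (inj₂ n) (inj₂ n′) (inj₂ n″) = trans
          (trans (cong₂ _*_ (u-is b₁ n) (cong₂ _*_ (u-is b₂ n′) (u-is b₃ n″))) (product (is b₁ x) (is b₂ (x + 1ℤ)) (is b₃ (x + + 5))))
          (trans (lem (+ 8 * ⟦ pattern′ x ⟧) c₀ c₁ c₂) (indicators refl (eqb-false n) (eqb-false (n′ ∘ plus)) (eqb-false (n″ ∘ plus))))
        where
        lem : ∀ q a b c → q ≡ q + (0ℤ * a + (0ℤ * b + 0ℤ * c))
        lem = solve-∀
        product : ∀ a b c → + 2 * ⟦ a ⟧ * (+ 2 * ⟦ b ⟧ * (+ 2 * ⟦ c ⟧)) ≡ + 8 * ⟦ a ∧ (b ∧ c) ⟧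
        product true  true  true  = refl
        product true  true  false = refl
        product true  false true  = refl
        product true  false false = refl
        product false b     c     = refl

    constants : c₀ + (c₁ + c₂) ≡ K b₁ b₂ b₃ e s
    constants = cong₂ _+_ (cong₂ _*_ (u-weight b₂ 1≉0 R-one) (u-weight b₃ 5≉0 refl))
      (cong₂ _+_ (cong₂ _*_ (u-weight b₁ -1≉0 refl) (u-weight b₃ 4≉0 R-four))
                 (cong₂ _*_ (u-weight b₁ (neg≉0 {+ 5} 5≉0) (R-neg 5≉0)) (u-weight b₂ -4≉0 R-minus-four)))

    -- Summing `local` over x after multiplying out: the constant term gives p, single characters
    -- sum to 0, products of two to -1, and the product of all three is F.
    count-F : + 8 * count + K b₁ b₂ b₃ e s ≡ + p - L b₁ b₂ b₃ + sgn b₁ * (sgn b₂ * sgn b₃) * F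
    count-F = begin
      + 8 * count + K b₁ b₂ b₃ e s ≡⟨ cong₂ _+_ (sym (Σ-* (+ 8) (λ x → ⟦ pattern′ x ⟧))) (sym (trans Σ-roots constants)) ⟩
      Σℤ (λ x → + 8 * ⟦ pattern′ x ⟧) + Σℤ roots ≡⟨ sym (Σ-+ (λ x → + 8 * ⟦ pattern′ x ⟧) roots) ⟩
      Σℤ (λ x → + 8 * ⟦ pattern′ x ⟧ + roots x) ≡⟨ Σ-cong (λ x → sym (local x)) ⟩
      Σℤ (λ x → u b₁ x * (u b₂ (x + 1ℤ) * u b₃ (x + + 5))) ≡⟨ Σ-cong (λ x → expand σ₁ σ₂ σ₃ (χ x) (χ (x + 1ℤ)) (χ (x + + 5))) ⟩
      Σℤ (λ x → 1ℤ * 1ℤ + (σ₁ * χ x + (σ₂ * χ (x + 1ℤ) + (σ₃ * χ (x + + 5) + (σ₁ * σ₂ * (χ x * χ (x + 1ℤ)) +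
        (σ₁ * σ₃ * (χ x * χ (x + + 5)) + (σ₂ * σ₃ * (χ (x + 1ℤ) * χ (x + + 5)) + σ₁ * (σ₂ * σ₃) * (χ x * χ (x + 1ℤ) * χ (x + + 5)))))))))
        ≡⟨ trans (Σ-*+ 1ℤ (λ _ → 1ℤ) g₁) (cong₂ _+_ (cong (1ℤ *_) (∑-const p 1ℤ))
          (term σ₁ χ g₂ Σχ (term σ₂ (λ x → χ (x + 1ℤ)) g₃ (trans (Σ-shift 1ℤ χ-cong) Σχ)
            (term σ₃ (λ x → χ (x + + 5)) g₄ (trans (Σ-shift (+ 5) χ-cong) Σχ)
            (term (σ₁ * σ₂) (λ x → χ x * χ (x + 1ℤ)) g₅ (Σχχ 1ℤ 1≉0) (term (σ₁ * σ₃) (λ x → χ x * χ (x + + 5)) g₆ (Σχχ (+ 5) 5≉0)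
              (term (σ₂ * σ₃) (λ x → χ (x + 1ℤ) * χ (x + + 5)) g₇ shifted
              (Σ-* (σ₁ * (σ₂ * σ₃)) (λ x → χ x * χ (x + 1ℤ) * χ (x + + 5)))))))))) ⟩
      1ℤ * (+ p * 1ℤ) + (σ₁ * 0ℤ + (σ₂ * 0ℤ + (σ₃ * 0ℤ + (σ₁ * σ₂ * -1ℤ + (σ₁ * σ₃ * -1ℤ + (σ₂ * σ₃ * -1ℤ + σ₁ * (σ₂ * σ₃) * F)))))) ≡⟨ collect σ₁ σ₂ σ₃ (+ p) F ⟩
      + p - L b₁ b₂ b₃ + sgn b₁ * (sgn b₂ * sgn b₃) * F ∎
      where
      open ≡-Reasoning
      σ₁ σ₂ σ₃ : ℤ
      σ₁ = sgn b₁
      σ₂ = sgn b₂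
      σ₃ = sgn b₃
      Σ-roots : Σℤ roots ≡ c₀ + (c₁ + c₂)
      Σ-roots = trans (Σ-+ (λ x → ⟦ eqb x 0ℤ ⟧ * c₀) (λ x → ⟦ eqb x -1ℤ ⟧ * c₁ + ⟦ eqb x (- + 5) ⟧ * c₂))
        (cong₂ _+_ (Σ-point 0ℤ c₀) (trans (Σ-+ (λ x → ⟦ eqb x -1ℤ ⟧ * c₁) (λ x → ⟦ eqb x (- + 5) ⟧ * c₂))
          (cong₂ _+_ (Σ-point -1ℤ c₁) (Σ-point (- + 5) c₂))))
      Σ-*+ : ∀ k f g → Σℤ (λ x → k * f x + g x) ≡ k * Σℤ f + Σℤ g
      Σ-*+ k f g = trans (Σ-+ (λ x → k * f x) g) (cong (_+ Σℤ g) (Σ-* k f))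
      term : ∀ k f g {a b} → Σℤ f ≡ a → Σℤ g ≡ b → Σℤ (λ x → k * f x + g x) ≡ k * a + b
      term k f g e e′ = trans (Σ-*+ k f g) (cong₂ (λ a b → k * a + b) e e′)
      g₁ g₂ g₃ g₄ g₅ g₆ g₇ : ℤ → ℤ
      g₇ x = σ₁ * (σ₂ * σ₃) * (χ x * χ (x + 1ℤ) * χ (x + + 5))
      g₆ x = σ₂ * σ₃ * (χ (x + 1ℤ) * χ (x + + 5)) + g₇ x
      g₅ x = σ₁ * σ₃ * (χ x * χ (x + + 5)) + g₆ x
      g₄ x = σ₁ * σ₂ * (χ x * χ (x + 1ℤ)) + g₅ x
      g₃ x = σ₃ * χ (x + + 5) + g₄ x
      g₂ x = σ₂ * χ (x + 1ℤ) + g₃ x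
      g₁ x = σ₁ * χ x + g₂ x
      shifted : Σℤ (λ x → χ (x + 1ℤ) * χ (x + + 5)) ≡ -1ℤ
      shifted = trans (Σ-cong (λ x → cong (λ y → χ (x + 1ℤ) * χ y) (lem x)))
          (trans (Σ-shift 1ℤ {λ y → χ y * χ (y + + 4)} (λ q → cong₂ _*_ (χ-cong q) (χ-cong (+-cong q (≈-refl {+ 4}))))) (Σχχ (+ 4) 4≉0))
        where
        lem : ∀ x → x + + 5 ≡ x + 1ℤ + + 4
        lem = solve-∀
      expand : ∀ s t v a b c → (1ℤ + s * a) * ((1ℤ + t * b) * (1ℤ + v * c)) ≡
        1ℤ * 1ℤ + (s * a + (t * b + (v * c + (s * t * (a * b) + (s * v * (a * c) + (t * v * (b * c) + s * (t * v) * (a * b * c)))))))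
      expand = solve-∀
      collect : ∀ s t v q f → 1ℤ * (q * 1ℤ) + (s * 0ℤ + (t * 0ℤ + (v * 0ℤ + (s * t * -1ℤ + (s * v * -1ℤ + (t * v * -1ℤ + s * (t * v) * f)))))) ≡
        q - (s * t + (s * v + t * v)) + s * (t * v) * f
      collect = solve-∀

  -- Substituting den y = A x + B turns y (y + 1) (y + num / den) into a multiple of x (x + 1) (x + 5).
  Fp01-affine : ∀ n A B → + ↧ₙ n ≉ 0ℤ → A ≉ 0ℤ →
                (∀ x → (A * x + B) * ((A * x + B + + ↧ₙ n) * (A * x + B + ↥ n)) ≡ A * A * (A * (x * (x + 1ℤ) * (x + + 5)))) →
                Fp01 p n ≡ sgn (R (+ ↧ₙ n) xor R A) * F
  Fp01-affine n A B den≉0 A≉0 identity = begin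
    Fp01 p n ≡⟨ sumℤ-range1 (λ y → χ (+ y * (+ y + + 1) * (+ y + w))) p ⟩
    -- `Fp01` runs over 1, ..., p but `Σℤ` over 0, ..., p - 1; the shift is absorbed because the
    -- summand depends only on the class of y.
    ∑.sum p (λ i → cubic (+ suc i)) ≡⟨ ∑.sum-cong p (λ i _ → cong cubic (ℤP.+-comm 1ℤ (+ i))) ⟩
    Σℤ (λ x → cubic (x + 1ℤ)) ≡⟨ Σ-shift 1ℤ {cubic} cubic-cong ⟩
    Σℤ cubic ≡⟨ sym (ZS.S-perm {y} {cubic} (λ q → *-cong (+-cong (*-cong (≈-refl {A}) q) (≈-refl {B})) (≈-refl {inv den})) cubic-cong (λ v → (den * v - B) * inv A)
        (λ v → cancelˡ den den≉0 (≈-trans (affine-eq den A B den≉0 _) (combination₁ (den * v - B) (*-inv A≉0) (lem₁ A B (den * v) (inv A)))))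
        (λ {t} {t′} q → cancelˡ A A≉0 (combination₃ 1ℤ 1ℤ -1ℤ (*-cong (≈-refl {den}) q) (≈-sym (affine-eq den A B den≉0 t)) (≈-sym (affine-eq den A B den≉0 t′)) (lem₂ A B t t′ (den * y t) (den * y t′))))) ⟩
    Σℤ (λ x → cubic (y x)) ≡⟨ Σ-cong twisted ⟩
    Σℤ (λ x → sgn (R den xor R A) * (χ x * χ (x + 1ℤ) * χ (x + + 5))) ≡⟨ Σ-* (sgn (R den xor R A)) (λ x → χ x * χ (x + 1ℤ) * χ (x + + 5)) ⟩
    sgn (R den xor R A) * F ∎
    where
    open ≡-Reasoning
    den w : ℤ
    den = + ↧ₙ n
    w = residue n p
    y : ℤ → ℤ
    y = affine den A B
    cubic : ℤ → ℤ
    cubic y = χ (y * (y + + 1) * (y + w))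
    cubic-cong : ∀ {a b} → a ≈ b → cubic a ≡ cubic b
    cubic-cong q = χ-cong (*-cong (*-cong q (+-cong q (≈-refl {+ 1}))) (+-cong q (≈-refl {w})))
    lem₁ : ∀ A B v i → A * ((v - B) * i) + B - v ≡ (v - B) * (A * i - 1ℤ)
    lem₁ = solve-∀
    lem₂ : ∀ A B t t′ v v′ → A * t - A * t′ ≡ 1ℤ * (v - v′) + 1ℤ * (A * t + B - v) + -1ℤ * (A * t′ + B - v′)
    lem₂ = solve-∀

    -- The search succeeds and does not end in the default 0, because the residue of numerator times
    -- inverse denominator passes the test.
    w-spec : w * den ≈ ↥ n
    w-spec = sub≈0⁻ (Z-true (trans (sym (Z-divb _)) (findFirst-true (λ w → divb p (+ w * den - ↥ n)) (∈-upTo⁺ (red-< (↥ n * inv den)))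
        (trans (Z-divb _) (Z-intro (sub≈0 (≈-trans (*-cong (red-≈ (↥ n * inv den)) (≈-refl {den})) (combination₁ (↥ n) (*-inv den≉0) (lem (↥ n) den (inv den))))))))))
      where
      lem : ∀ m d i → m * i * d - m ≡ m * (d * i - 1ℤ)
      lem = solve-∀

    twisted : ∀ x → cubic (y x) ≡ sgn (R den xor R A) * (χ x * χ (x + 1ℤ) * χ (x + + 5))
    twisted x = trans (undo (R den) (R A) (trans (sym (trans (χ-* den Y) (cong (_* χ Y) (χ-nonzero den≉0))))
        (trans (sym (χ-square-* den (den * Y) den≉0)) (trans (χ-cong cubes) (trans (χ-square-* A (A * X) A≉0)
          (trans (χ-* A X) (cong (_* χ X) (χ-nonzero A≉0))))))))
        (cong (sgn (R den xor R A) *_) (trans (χ-* (x * (x + 1ℤ)) (x + + 5)) (cong (_* χ (x + + 5)) (χ-* x (x + 1ℤ)))))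
      where
      X Y : ℤ
      X = x * (x + 1ℤ) * (x + + 5)
      Y = y x * (y x + + 1) * (y x + w)
      undo : ∀ a b {u v} → sgn a * u ≡ sgn b * v → u ≡ sgn (a xor b) * v
      undo a b {u} {v} q = trans (trans (sym (ℤP.*-identityˡ u)) (trans (cong (_* u) (sym (sgn-square a))) (ℤP.*-assoc (sgn a) (sgn a) u)))
        (trans (cong (sgn a *_) q) (trans (sym (ℤP.*-assoc (sgn a) (sgn b) v)) (cong (_* v) (sym (sgn-xor a b)))))
      cubes : den * den * (den * Y) ≈ A * A * (A * X)
      cubes = ≈-trans (≡⇒≈ (lem den (y x) w)) (≈-trans (*-cong ax (*-cong (+-cong ax (≈-refl {den})) (+-cong ax w-spec))) (≡⇒≈ (identity x)))
        where
        ax : den * y x ≈ A * x + B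
        ax = affine-eq den A B den≉0 x
        lem : ∀ d y w → d * d * (d * (y * (y + 1ℤ) * (y + w))) ≡ d * y * ((d * y + d) * (d * y + w * d))
        lem = solve-∀

  -- Reduction to p modulo 80

  c q : ℕ
  c = p % 80
  q = p / 80

  p≡c : p ≡ c ℕ.+ q ℕ.* 80
  p≡c = ℕDM.m≡m%n+[m/n]*n p 80

  residue-modulo : ∀ m k .{{_ : ℕ.NonZero m}} → k ℕ.* m ≡ 80 → p % m ≡ c % m
  residue-modulo m k eq = trans (cong (_% m) (trans p≡c (cong (λ n → c ℕ.+ q ℕ.* n) (sym eq))))
    (trans (cong (λ n → (c ℕ.+ n) % m) (sym (ℕP.*-assoc q k m))) (ℕDM.[m+kn]%n≡m%n c (q ℕ.* k) m))

  -- The subtraction in `half` truncates at 0, so c > 0 has to be excluded from failing: c = 0 would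
  -- make p even.
  half-c : h ≡ half c ℕ.+ q ℕ.* 40
  half-c = trans (sym half≡) (trans (cong half p≡c) (lem c 0<c))
    where
    0<c : 0 < c
    0<c = ℕP.n≢0⇒n>0 λ z → 2∤p (ℕD.∣-trans (ℕD.divides 40 refl) (ℕD.m%n≡0⇒n∣m p 80 z))
    lem : ∀ c → 0 < c → half (c ℕ.+ q ℕ.* 80) ≡ half c ℕ.+ q ℕ.* 40
    lem (suc c) _ = trans (cong (λ n → (c ℕ.+ n) / 2) (sym (ℕP.*-assoc q 40 2)))
      (trans (ℕDM.+-distrib-/-∣ʳ c (ℕD.n∣m*n (q ℕ.* 40))) (cong (c / 2 ℕ.+_) (ℕDM.m*n/n≡m (q ℕ.* 40) 2)))

  e≡ : e ≡ minus-one-nonsquare c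
  e≡ = trans R-minus-one (trans (cong odd half-c) (shift-periodic odd 40 (odd-+ 40) q (half c)))

  -- Gauss's lemma for 2: all doubles 2 k with k ≤ h are already reduced, and those above h are the
  -- last ⌈h/2⌉ of them.
  R-two : R (+ 2) ≡ odd ⌈ h /2⌉
  R-two = trans (R-γ 2≉0) (trans (cong (λ n → ⊕.sum n f) (sym (ℕP.⌊n/2⌋+⌈n/2⌉≡n h)))
      (trans (⊕.sum-split ⌊ h /2⌋ ⌈ h /2⌉ f) (cong₂ _xor_ (⊕.sum-ε ⌊ h /2⌋ lower) (trans (⊕.sum-cong ⌈ h /2⌉ upper) (⊕-const ⌈ h /2⌉)))))
    where
    f : ℕ → Bool
    f k = hi (+ 2 * + suc k)
    f≡ : ∀ k → k < h → f k ≡ (h ℕ.<ᵇ 2 ℕ.* suc k)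
    f≡ k k<h = cong (h ℕ.<ᵇ_) (trans (cong red (sym (ℤP.pos-* 2 (suc k)))) (red-small (subst (2 ℕ.* suc k <_) (sym p≡)
      (s≤s (subst (2 ℕ.* suc k ≤_) (cong (h ℕ.+_) (ℕP.+-identityʳ h)) (ℕP.*-monoʳ-≤ 2 k<h))))))
    lower : ∀ k → k < ⌊ h /2⌋ → f k ≡ false
    lower k k<a = trans (f≡ k (ℕP.<-≤-trans k<a (ℕP.⌊n/2⌋≤n h)))
      (<ᵇ-intro-false (ℕP.≤-trans (ℕP.*-monoʳ-≤ 2 k<a) (2⌊/2⌋≤ h)))
    upper : ∀ i → i < ⌈ h /2⌉ → f (⌊ h /2⌋ ℕ.+ i) ≡ true
    upper i i<b = trans (f≡ (⌊ h /2⌋ ℕ.+ i) (subst (⌊ h /2⌋ ℕ.+ i <_) (ℕP.⌊n/2⌋+⌈n/2⌉≡n h) (ℕP.+-monoʳ-< ⌊ h /2⌋ i<b)))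
      (<ᵇ-intro (ℕP.<-≤-trans (<2+2⌊/2⌋ h) (ℕP.*-monoʳ-≤ 2 (s≤s (ℕP.m≤m+n ⌊ h /2⌋ i)))))

  two≡ : R (+ 2) ≡ two-nonsquare c
  two≡ = trans R-two (trans (cong (λ n → odd ⌈ n /2⌉) half-c) (shift-periodic (λ n → odd ⌈ n /2⌉) 40 (λ n → odd-+ 20 ⌈ n /2⌉) q (half c)))

  υ : Unit10
  υ = unit (c % 10)

  υ-spec : p ≡ toNat υ ℕ.+ p / 10 ℕ.* 10
  υ-spec = trans (ℕDM.m≡m%n+[m/n]*n p 10) (cong (ℕ._+ p / 10 ℕ.* 10) (trans (spec (p % 10) refl (ℕDM.m%n<n p 10)) (cong (toNat ∘ unit) (residue-modulo 10 8 refl))))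
    where
    even : ∀ k → p % 10 ≡ k ℕ.* 2 → ⊥
    even k e = 2∤p (ℕD.divides (k ℕ.+ p / 10 ℕ.* 5) (trans (ℕDM.m≡m%n+[m/n]*n p 10) (trans (cong₂ ℕ._+_ e (sym (ℕP.*-assoc (p / 10) 5 2))) (sym (ℕP.*-distribʳ-+ 2 k (p / 10 ℕ.* 5))))))
    multiple-of-five : p % 10 ≡ 5 → ⊥
    multiple-of-five e = 5∤p (ℕD.divides (1 ℕ.+ p / 10 ℕ.* 2) (trans (ℕDM.m≡m%n+[m/n]*n p 10) (trans (cong₂ ℕ._+_ e (sym (ℕP.*-assoc (p / 10) 2 5))) (sym (ℕP.*-distribʳ-+ 5 1 (p / 10 ℕ.* 2))))))
    spec : ∀ r → p % 10 ≡ r → r < 10 → r ≡ toNat (unit r)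
    spec 0 e _ = ⊥-elim (even 0 e)
    spec 1 e _ = refl
    spec 2 e _ = ⊥-elim (even 1 e)
    spec 3 e _ = refl
    spec 4 e _ = ⊥-elim (even 2 e)
    spec 5 e _ = ⊥-elim (multiple-of-five e)
    spec 6 e _ = ⊥-elim (even 3 e)
    spec 7 e _ = refl
    spec 8 e _ = ⊥-elim (even 4 e)
    spec 9 e _ = refl
    spec (suc (suc (suc (suc (suc (suc (suc (suc (suc (suc r)))))))))) e (s≤s (s≤s (s≤s (s≤s (s≤s (s≤s (s≤s (s≤s (s≤s (s≤s ()))))))))))

  s≡ : s ≡ five-nonsquare c
  s≡ = R-5 υ (p / 10) υ-spec

  N-squares : N false false false ≡ square-parity e s (R (+ 2)) υ
  N-squares = by e s refl refl
    where
    by : ∀ a b → e ≡ a → s ≡ b → N false false false ≡ square-parity a b (R (+ 2)) υ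
    by false b     e≡ s≡ = trans (N-minus-one-square e≡) s≡
    by true  false e≡ s≡ = N-five-square e≡ s≡ (isNine υ) λ t t² → root-bit t t² υ υ-spec (trans (sym s≡) (R-5 υ (p / 10) υ-spec))
      where
      root-bit : ∀ t → t * t ≈ 1ℤ - t → ∀ u → p ≡ toNat u ℕ.+ p / 10 ℕ.* 10 → false ≡ five-bit u → R (- + 3 + -1ℤ * t) ≡ isNine u
      root-bit t t² u1 eq _ = R-Δ {t} t² u1 (p / 10) eq false refl
      root-bit t t² u9 eq _ = R-Δ {t} t² u9 (p / 10) eq true refl
    by true  true  e≡ s≡ = trans (N-five-nonsquare e≡ s≡ υ (p / 10) ⌈ h /2⌉ υ-spec (odd⇒suc≡2⌈/2⌉ h (trans (sym R-minus-one) e≡)))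
      (cong (_xor isThree υ) (sym R-two))

  N₀≡ : N false false false ≡ N₀ c
  N₀≡ = trans N-squares (trans (cong₂ (λ a b → square-parity a b (R (+ 2)) υ) e≡ s≡) (cong (λ t → square-parity (minus-one-nonsquare c) (five-nonsquare c) t υ) two≡))

  p₁₆ : + p ≡ + (c % 16) + + (p / 16) * + 16
  p₁₆ = trans (cong +_ (trans (ℕDM.m≡m%n+[m/n]*n p 16) (cong (ℕ._+ p / 16 ℕ.* 16) (residue-modulo 16 5 refl))))
    (trans (ℤP.pos-+ (c % 16) (p / 16 ℕ.* 16)) (cong (λ z → + (c % 16) + z) (ℤP.pos-* (p / 16) 16)))

  F₁₆ : ∃ λ k → F - trace₁₆ c ≡ k * + 16
  F₁₆ = let m , parity = count-parity false false false in
      m - + (p / 16) , trans (cong (_- trace₁₆ c) (solve-for-F (count false false false) (K false false false e s) F (+ p) (count-F false false false)))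
        (trans (cong₂ (λ n z → + 8 * n + K false false false e s + + 3 - z - trace₁₆ c) (trans parity (cong (λ b → ⟦ b ⟧ + + 2 * m) N₀≡)) p₁₆)
          (trans (cong (λ z → + 8 * (⟦ N₀ c ⟧ + + 2 * m) + z + + 3 - (+ (c % 16) + + (p / 16) * + 16) - trace₁₆ c) (cong₂ (K false false false) e≡ s≡))
            (lem ⟦ N₀ c ⟧ m (K false false false (minus-one-nonsquare c) (five-nonsquare c)) (+ (c % 16)) (+ (p / 16)))))
    where
    solve-for-F : ∀ n k f q → + 8 * n + k ≡ q - + 3 + 1ℤ * f → f ≡ + 8 * n + k + + 3 - q
    solve-for-F n k f q eq = trans (lem f q) (cong (λ z → z + + 3 - q) (sym eq))
      where
      lem : ∀ f q → f ≡ q - + 3 + 1ℤ * f + + 3 - q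
      lem = solve-∀
    lem : ∀ n m k r q → + 8 * (n + + 2 * m) + k + + 3 - (r + q * + 16) - (+ 8 * n + k + + 3 - r) ≡ (m - q) * + 16
    lem = solve-∀

  -- In `count-F` everything but 8 · count is known modulo 16 once `F₁₆` is, and modulo 16 an even
  -- part of the count disappears.
  N₁₆ : ∀ b₁ b₂ b₃ → N b₁ b₂ b₃ ≡ pattern₁₆ b₁ b₂ b₃ c
  N₁₆ b₁ b₂ b₃ = trans (read (N b₁ b₂ b₃)) (cong (_≡ᵇ 8) (%ℕ-cong (+ 8 * ⟦ N b₁ b₂ b₃ ⟧) X (proj₁ difference₁₆) 16 (proj₂ difference₁₆)))
    where
    σ X : ℤ
    σ = sgn b₁ * (sgn b₂ * sgn b₃)
    X = + (c % 16) - L b₁ b₂ b₃ - K b₁ b₂ b₃ (minus-one-nonsquare c) (five-nonsquare c) + σ * trace₁₆ c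
    read : ∀ b → b ≡ ((+ 8 * ⟦ b ⟧) %ℕ 16 ≡ᵇ 8)
    read true  = refl
    read false = refl
    difference₁₆ : ∃ λ k → + 8 * ⟦ N b₁ b₂ b₃ ⟧ - X ≡ k * + 16
    difference₁₆ = let m , parity = count-parity b₁ b₂ b₃ ; k , F≡ = F₁₆ in
      + (p / 16) + σ * k - m ,
      combine ⟦ N b₁ b₂ b₃ ⟧ m (K b₁ b₂ b₃ (minus-one-nonsquare c) (five-nonsquare c)) (L b₁ b₂ b₃) (+ (c % 16)) (+ (p / 16)) F (trace₁₆ c) k
        (trans (cong (λ z → + 8 * z + K b₁ b₂ b₃ (minus-one-nonsquare c) (five-nonsquare c)) (sym parity))
                (trans (cong (λ z → + 8 * count b₁ b₂ b₃ + z) (sym (cong₂ (K b₁ b₂ b₃) e≡ s≡))) (trans (count-F b₁ b₂ b₃) (cong (λ z → z - L b₁ b₂ b₃ + σ * F) p₁₆)))) F≡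
      where
      combine : ∀ n m k l r q f t j → + 8 * (n + + 2 * m) + k ≡ r + q * + 16 - l + σ * f → f - t ≡ j * + 16 →
                + 8 * n - (r - l - k + σ * t) ≡ (q + σ * j - m) * + 16
      combine n m k l r q f t j eq eq′ = trans (lem₁ n m k l r t σ)
        (trans (cong (λ z → z - k - + 16 * m - (r - l - k + σ * t)) eq)
          (trans (lem₂ m k l r q f t σ) (trans (cong (λ z → (q - m) * + 16 + σ * z) eq′) (lem₃ m q j σ))))
        where
        lem₁ : ∀ n m k l r t s → + 8 * n - (r - l - k + s * t) ≡ + 8 * (n + + 2 * m) + k - k - + 16 * m - (r - l - k + s * t)
        lem₁ = solve-∀
        lem₂ : ∀ m k l r q f t s → r + q * + 16 - l + s * f - k - + 16 * m - (r - l - k + s * t) ≡ (q - m) * + 16 + s * (f - t)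
        lem₂ = solve-∀
        lem₃ : ∀ m q j s → (q - m) * + 16 + s * (j * + 16) ≡ (q + s * j - m) * + 16
        lem₃ = solve-∀

  sgn-F₁₆ : ∀ b → (sgn b * F) %ℕ 16 ≡ (sgn b * trace₁₆ c) %ℕ 16
  sgn-F₁₆ b = let k , eq = F₁₆ in %ℕ-cong (sgn b * F) (sgn b * trace₁₆ c) (sgn b * k) 16
      (trans (lem (sgn b) F (trace₁₆ c)) (trans (cong (sgn b *_) eq) (sym (ℤP.*-assoc (sgn b) k (+ 16)))))
    where
    lem : ∀ s f t → s * f - s * t ≡ s * (f - t)
    lem = solve-∀

  Square-parity : Square (λ i j → i * i - i * j - j * j) ≡ (if e then not (N false false false xor (not s ∧ not (R (+ 2)))) else R (+ 2) ∧ s)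
  Square-parity = by e refl
    where
    by : ∀ b → e ≡ b → Square (λ i j → i * i - i * j - j * j) ≡ (if b then not (N false false false xor (not s ∧ not (R (+ 2)))) else R (+ 2) ∧ s)
    by false e≡ = Square-residue e≡
    by true  e≡ = trans (Square-nonresidue e≡) (trans (difference-parity≡ e≡) (cong₂ (λ a b → not (N false false false xor (a ∧ b))) (Q-notR 5≉0)
      (trans (R-neg {+ 2} 2≉0) (cong (_xor R (+ 2)) e≡))))

  -- On the scale den · y the cubic has the roots 0, - den and - num. In each case an affine map of
  -- slope A = ± 1 carries 0, -1, -5 to these three, and B is the image of 0.
  valuesI-F : ∀ {n} (i : n ∈ valuesI) → Fp01 p n ≡ sgn (twist i e s) * F
  valuesI-F (here refl) =
    trans (Fp01-affine five 1ℤ 0ℤ 1≉0 1≉0 identity) (cong (λ b → sgn b * F) (cong₂ _xor_ R-one R-one))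
    where
    identity : ∀ x → (1ℤ * x + 0ℤ) * ((1ℤ * x + 0ℤ + 1ℤ) * (1ℤ * x + 0ℤ + + 5)) ≡ 1ℤ * 1ℤ * (1ℤ * (x * (x + 1ℤ) * (x + + 5)))
    identity = solve-∀
  valuesI-F (there (here refl)) =
    trans (Fp01-affine (- + 4 ℚ./ 1) -1ℤ -1ℤ 1≉0 -1≉0 identity) (cong (λ b → sgn b * F) (cong (_xor e) R-one))
    where
    identity : ∀ x → (-1ℤ * x + -1ℤ) * ((-1ℤ * x + -1ℤ + 1ℤ) * (-1ℤ * x + -1ℤ + - + 4)) ≡ -1ℤ * -1ℤ * (-1ℤ * (x * (x + 1ℤ) * (x + + 5)))
    identity = solve-∀
  valuesI-F (there (there (here refl))) =
    trans (Fp01-affine (+ 1 ℚ./ 5) 1ℤ 0ℤ 5≉0 1≉0 identity) (cong (λ b → sgn b * F) (cong (s xor_) R-one))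
    where
    identity : ∀ x → (1ℤ * x + 0ℤ) * ((1ℤ * x + 0ℤ + + 5) * (1ℤ * x + 0ℤ + 1ℤ)) ≡ 1ℤ * 1ℤ * (1ℤ * (x * (x + 1ℤ) * (x + + 5)))
    identity = solve-∀
  valuesI-F (there (there (there (here refl)))) =
    Fp01-affine (+ 4 ℚ./ 5) -1ℤ (- + 5) 5≉0 -1≉0 identity
    where
    identity : ∀ x → (-1ℤ * x + - + 5) * ((-1ℤ * x + - + 5 + + 5) * (-1ℤ * x + - + 5 + + 4)) ≡ -1ℤ * -1ℤ * (-1ℤ * (x * (x + 1ℤ) * (x + + 5)))
    identity = solve-∀
  valuesI-F (there (there (there (there (here refl))))) =
    trans (Fp01-affine (+ 5 ℚ./ 4) -1ℤ (- + 5) 4≉0 -1≉0 identity) (cong (λ b → sgn b * F) (cong (_xor e) R-four))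
    where
    identity : ∀ x → (-1ℤ * x + - + 5) * ((-1ℤ * x + - + 5 + + 4) * (-1ℤ * x + - + 5 + + 5)) ≡ -1ℤ * -1ℤ * (-1ℤ * (x * (x + 1ℤ) * (x + + 5)))
    identity = solve-∀
  valuesI-F (there (there (there (there (there (here refl)))))) =
    trans (Fp01-affine (-1ℤ ℚ./ 4) 1ℤ 1ℤ 4≉0 1≉0 identity) (cong (λ b → sgn b * F) (cong₂ _xor_ R-four R-one))
    where
    identity : ∀ x → (1ℤ * x + 1ℤ) * ((1ℤ * x + 1ℤ + + 4) * (1ℤ * x + 1ℤ + -1ℤ)) ≡ 1ℤ * 1ℤ * (1ℤ * (x * (x + 1ℤ) * (x + + 5)))
    identity = solve-∀

  -- The first form becomes i² - 3 i j + j² under i ↦ j - i, the next two are symmetric already, and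
  -- those without a mixed term are rotated. The exclusive-ors in `form-pattern` stay unreduced, as
  -- the substitutions produce them.
  formsII-N : ∀ {f} (i : f ∈ formsII) → Tri f ≡ N′ (form-pattern i e s)
  formsII-N (here refl) =
    trans (Tri-reflect (λ i j → i * i + i * j - j * j) (form 1ℤ (- + 3)) lem) (trans (Tri-form-minus-3 1ℤ 1≉0) (cong (λ b → N (e xor b) (not e xor false) (not e xor false)) R-one))
    where
    lem : ∀ i j → (j - i) * (j - i) + (j - i) * j - j * j ≡ 1ℤ * (i * i + j * j) + - + 3 * (i * j)
    lem = solve-∀
  formsII-N (there (here refl)) =
    trans (Tri-cong {λ i j → i * i + + 3 * i * j + j * j} {form 1ℤ (+ 3)} lem) (Tri-form-3 1ℤ 1≉0)
    where
    lem : ∀ i j → i * i + + 3 * i * j + j * j ≡ 1ℤ * (i * i + j * j) + + 3 * (i * j)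
    lem = solve-∀
  formsII-N (there (there (here refl))) =
    trans (Tri-cong {λ i j → i * i - + 3 * i * j + j * j} {form 1ℤ (- + 3)} lem) (trans (Tri-form-minus-3 1ℤ 1≉0) (cong (λ b → N (e xor b) (not e xor false) (not e xor false)) R-one))
    where
    lem : ∀ i j → i * i - + 3 * i * j + j * j ≡ 1ℤ * (i * i + j * j) + - + 3 * (i * j)
    lem = solve-∀
  formsII-N (there (there (there (here refl)))) =
    trans (Tri-rotate (λ i j → + 4 * i * i + j * j) (form (+ 5) (- + 6)) (λ i {j} {j′} q → +-cong (≈-refl {+ 4 * i * i}) (*-cong q q)) lem lem′) Tri-form-5-minus-6
    where
    lem : ∀ i j → + 4 * i * i + (- j) * (- j) ≡ + 4 * i * i + j * j
    lem = solve-∀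
    lem′ : ∀ a b → + 4 * (a - b) * (a - b) + (a + b) * (a + b) ≡ (+ 5) * (b * b + a * a) + (- + 6) * (b * a)
    lem′ = solve-∀
  formsII-N (there (there (there (there (here refl))))) =
    trans (Tri-rotate (λ i j → i * i + + 4 * j * j) (form (+ 5) (+ 6)) (λ i {j} {j′} q → +-cong (≈-refl {i * i}) (*-cong (*-cong (≈-refl {+ 4}) q) q)) lem lem′) Tri-form-5-6
    where
    lem : ∀ i j → i * i + + 4 * (- j) * (- j) ≡ i * i + + 4 * j * j
    lem = solve-∀
    lem′ : ∀ a b → (a - b) * (a - b) + + 4 * (a + b) * (a + b) ≡ (+ 5) * (b * b + a * a) + (+ 6) * (b * a)
    lem′ = solve-∀
  formsII-N (there (there (there (there (there (here refl)))))) =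
    trans (Tri-rotate (λ i j → + 5 * i * i - j * j) (form (+ 4) (- + 12)) (λ i {j} {j′} q → sub-cong (≈-refl {+ 5 * i * i}) (*-cong q q)) lem lem′) (trans (Tri-form-minus-3 (+ 4) 4≉0) (cong (λ b → N (e xor b) (not e xor false) (not e xor false)) R-four))
    where
    lem : ∀ i j → + 5 * i * i - (- j) * (- j) ≡ + 5 * i * i - j * j
    lem = solve-∀
    lem′ : ∀ a b → + 5 * (a - b) * (a - b) - (a + b) * (a + b) ≡ (+ 4) * (b * b + a * a) + (- + 12) * (b * a)
    lem′ = solve-∀
  formsII-N (there (there (there (there (there (there (here refl))))))) =
    trans (Tri-rotate (λ i j → i * i - + 5 * j * j) (form (- + 4) (- + 12)) (λ i {j} {j′} q → sub-cong (≈-refl {i * i}) (*-cong (*-cong (≈-refl {+ 5}) q) q)) lem lem′) (trans (Tri-form-3 (- + 4) -4≉0) (cong (λ b → N (e xor b) (not e xor e) (not e xor e)) R-four))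
    where
    lem : ∀ i j → i * i - + 5 * (- j) * (- j) ≡ i * i - + 5 * j * j
    lem = solve-∀
    lem′ : ∀ a b → (a - b) * (a - b) - + 5 * (a + b) * (a + b) ≡ (- + 4) * (b * b + a * a) + (- + 12) * (b * a)
    lem′ = solve-∀

  Fp01₁₆ : ∀ {n} (i : n ∈ valuesI) → mod16 (Fp01 p n) ≡ (sgn (twist i (minus-one-nonsquare c) (five-nonsquare c)) * trace₁₆ c) %ℕ 16
  Fp01₁₆ i = trans (cong (_%ℕ 16) (valuesI-F i))
    (trans (sgn-F₁₆ (twist i e s)) (cong₂ (λ a b → (sgn (twist i a b) * trace₁₆ c) %ℕ 16) e≡ s≡))

  N₁₆′ : ∀ b → N′ b ≡ pattern₁₆′ b c
  N₁₆′ (b₁ , b₂ , b₃) = N₁₆ b₁ b₂ b₃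

  legProd-II : ∀ {f} (i : f ∈ formsII) → legProd f p (pairsLt p) ≡ sgn (pattern₁₆′ (form-pattern i (minus-one-nonsquare c) (five-nonsquare c)) c)
  legProd-II {f} i = trans (legProd-pairsLt f) (cong sgn (trans (formsII-N i)
    (trans (N₁₆′ (form-pattern i e s)) (cong₂ (λ a b → pattern₁₆′ (form-pattern i a b) c) e≡ s≡))))

  legProd-III : legProd (λ i j → i * i - i * j - j * j) p (pairsAll p) ≡
                sgn (square-product (minus-one-nonsquare c) (five-nonsquare c) (two-nonsquare c) (N₀ c))
  legProd-III = trans (legProd-pairsAll (λ i j → i * i - i * j - j * j)) (cong sgn
    (trans Square-parity (trans (cong₂ (λ a b → square-product a b (R (+ 2)) (N false false false)) e≡ s≡)
      (cong₂ (square-product (minus-one-nonsquare c) (five-nonsquare c)) two≡ N₀≡))))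

-- Since 5 divides 80, the prime 5 is alone in its class and may be left out.
record ByClass (g : PrimeFun) : Set where
  field
    value   : ℕ → ℚ
    big     : ∀ {p} → dom g p → BigPrime p
    correct : ∀ p → Prime p → 5 < p → val g p ≡ value (p % 80)
open ByClass

-- From residue classes to equivalence and periodicity

congruent : ∀ {a b} → CongMod a b 80 → a % 80 ≡ b % 80
congruent {a} {b} d with ℤS.∣ᵤ⇒∣ {+ 80} {+ a - + b} d
... | ℤS.divides k eq = %ℕ-cong (+ a) (+ b) k 80 eq

prime≢4 : ∀ {p} → Prime p → p ≢ 4
prime≢4 pr refl = [ (λ ()) , (λ ()) ]′ (prime⇒irreducible pr (ℕD.divides {2} 2 refl))

>5 : ∀ {p} → BigPrime p → p ≢ 5 → 5 < p
>5 (pr , 3<p) p≢5 = ℕP.≤∧≢⇒< (ℕP.≤∧≢⇒< 3<p (≢-sym (prime≢4 pr))) (≢-sym p≢5)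

-- Both functions are constant on the class of r, so slope 1 and the difference of the two constants
-- suffice. The prime 5 does not occur, as r is coprime to 80.
equivalent : ∀ {g h} → ByClass g → ByClass h → Equivalent g h
equivalent {g} {h} G H = 80 , s≤s z≤n , λ r r<80 coprime →
    ℚ.1ℚ , value G r ℚ.- value H r , (λ ()) , λ p dg dh p≡r →
      let p%80 = trans (congruent {p} {r} p≡r) (ℕDM.m<n⇒m%n≡m r<80)
          5<p  = >5 (big G dg) λ { refl → not-coprime r p%80 coprime }
          pr   = proj₁ (big G dg)
      in trans (correct G p pr 5<p) (trans (cong (value G) p%80) (trans (sym (shift (value G r) (value H r)))
           (cong (λ v → ℚ.1ℚ ℚ.* v ℚ.+ (value G r ℚ.- value H r)) (sym (trans (correct H p pr 5<p) (cong (value H) p%80))))))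
  where
  not-coprime : ∀ r → 5 ≡ r → ¬ (gcd r 80 ≡ 1)
  not-coprime r refl ()
  shift : ∀ x y → ℚ.1ℚ ℚ.* y ℚ.+ (x ℚ.- y) ≡ x
  shift x y = trans (cong₂ ℚ._+_ (ℚP.*-identityˡ y) (ℚP.+-comm x (ℚ.- y)))
    (trans (sym (ℚP.+-assoc y (ℚ.- y) x)) (trans (cong (ℚ._+ x) (ℚP.+-inverseʳ y)) (ℚP.+-identityˡ x)))

periodic : ∀ {g} → ByClass g → Periodic g
periodic {g} G = 80 , s≤s z≤n , λ p₁ p₂ d₁ d₂ p₁≡p₂ → by p₁ p₂ d₁ d₂ (congruent {p₁} {p₂} p₁≡p₂) (p₁ ℕ.≟ 5) (p₂ ℕ.≟ 5)
  where
  only-five : ∀ {p} → BigPrime p → p % 80 ≡ 5 → p ≡ 5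
  only-five {p} (pr , _) e = [ (λ ()) , sym ]′ (prime⇒irreducible pr (ℕD.divides (1 ℕ.+ p / 80 ℕ.* 16)
    (trans (ℕDM.m≡m%n+[m/n]*n p 80) (trans (cong₂ ℕ._+_ e (sym (ℕP.*-assoc (p / 80) 16 5))) (sym (ℕP.*-distribʳ-+ 5 1 (p / 80 ℕ.* 16)))))))
  by : ∀ p₁ p₂ → dom g p₁ → dom g p₂ → p₁ % 80 ≡ p₂ % 80 → Dec (p₁ ≡ 5) → Dec (p₂ ≡ 5) → val g p₁ ≡ val g p₂
  by p₁ p₂ d₁ d₂ e (yes refl) _          = cong (val g) (sym (only-five (big G d₂) (sym e)))
  by p₁ p₂ d₁ d₂ e (no _)     (yes refl) = cong (val g) (only-five (big G d₁) e)
  by p₁ p₂ d₁ d₂ e (no n₁)    (no n₂)    = trans (correct G p₁ (proj₁ (big G d₁)) (>5 (big G d₁) n₁))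
    (trans (cong (value G) e) (sym (correct G p₂ (proj₁ (big G d₂)) (>5 (big G d₂) n₂))))

valuesI-class : ∀ {n} → n ∈ valuesI → ByClass (Ffun n)
valuesI-class i = record
  { value   = λ c → ℕtoℚ ((sgn (twist i (minus-one-nonsquare c) (five-nonsquare c)) * trace₁₆ c) %ℕ 16)
  ; big     = proj₁
  ; correct = λ p pr 5<p → cong ℕtoℚ (Modulo.Fp01₁₆ p pr 5<p i)
  }

formsII-class : ∀ {f} → f ∈ formsII → ByClass (prodII f)
formsII-class i = record
  { value   = λ c → ℤtoℚ (sgn (pattern₁₆′ (form-pattern i (minus-one-nonsquare c) (five-nonsquare c)) c))
  ; big     = id
  ; correct = λ p pr 5<p → cong ℤtoℚ (Modulo.legProd-II p pr 5<p i)
  }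

prodIII-class : ByClass prodIII
prodIII-class = record
  { value   = λ c → ℤtoℚ (sgn (square-product (minus-one-nonsquare c) (five-nonsquare c) (two-nonsquare c) (N₀ c)))
  ; big     = id
  ; correct = λ p pr 5<p → cong ℤtoℚ (Modulo.legProd-III p pr 5<p)
  }

theorem3p6 : (∀ n₁ n₂ → n₁ ∈ valuesI → n₂ ∈ valuesI → Equivalent (Ffun n₁) (Ffun n₂))
    × (∀ f → f ∈ formsII → Equivalent (Ffun five) (prodII f))
    × Equivalent (Ffun five) prodIII
    × (Periodic (Ffun five) × (∀ f → f ∈ formsII → Periodic (prodII f)) × Periodic prodIII)
theorem3p6 =
    (λ n₁ n₂ i₁ i₂ → equivalent (valuesI-class i₁) (valuesI-class i₂))
  , (λ f i → equivalent five-class (formsII-class i))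
  , equivalent five-class prodIII-class
  , (periodic five-class , (λ f i → periodic (formsII-class i)) , periodic prodIII-class)
  where
  five-class : ByClass (Ffun five)
  five-class = valuesI-class (here refl)
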